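{- Let $k\ge 1$. A graph $G$ is $k$-level if and only if $G$ has no minor isomorphic to $\operatorname{cone}(H)$ for any minimally biconnected graph $H$ on $k+1$ vertices.
   Context: A graph $G$ is $k$-level if the base configuration $V_{\mathcal{M}(G)}=\{\mathbf{1}_T: T \text{ a spanning forest of } G\}\subset\mathbb{R}^{E(G)}$ of its graphic matroid is $k$-level, i.e. every facet-defining affine function takes at most $k$ distinct values on it (for a finite point set $V$ and affine $\ell\ge 0$ on $V$, $\{v:\ell(v)=0\}$ is a face; inclusion-maximal faces other than $V$ are facets, and the corresponding $\ell$ are facet-defining). The cone over $H=(V,E)$ with apex $w\notin V$ is $(V\cup\{w\},E\cup\{wv:v\in V\})$. A graph is minimally biconnected if it is biconnected and deleting any edge destroys biconnectivity. -}

module Defs where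

open import Algebra.Bundles using (CommutativeRing)
open import Algebra.Definitions using (Invertible)
import Algebra.Properties.CommutativeMonoid.Sum as Sum
open import Data.Bool.Base using (if_then_else_)
open import Data.Fin.Base using (Fin; zero; suc; splitAt)
open import Data.Fin.Properties using (suc-injective; splitAt⁻¹-↑ˡ; splitAt⁻¹-↑ʳ)
open import Data.Fin.Subset using (Subset; ⊤; Empty; Nonempty; _∩_; _-_)
  renaming (_∈_ to _∈ₛ_; _⊆_ to _⊆ₛ_)
open import Data.List.Base using (List; []; _∷_)
open import Data.List.Relation.Unary.Unique.Propositional using (Unique)
open import Data.Nat.Base using (ℕ; suc; _+_)
open import Data.Product.Base using (Σ; ∃; ∃₂; _×_; _,_)
open import Data.Sum.Base using (_⊎_; inj₁; inj₂)
open import Data.Vec.Base using (lookup)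
open import Data.Vec.Functional using (Vector)
open import Function.Base using (_∘_)
open import Level using (_⊔_) renaming (suc to lsuc)
open import Relation.Binary.Construct.Closure.ReflexiveTransitive using (Star; ε; _◅_)
open import Relation.Binary.Core using (Rel)
open import Relation.Binary.PropositionalEquality using (_≡_; _≢_; refl; sym; trans; cong)
open import Relation.Binary.Structures using (IsDecTotalOrder)
open import Relation.Nullary using (¬_)
open import Relation.Unary using (Pred; _∈_; _⊆_)

------------------------------------------------------------------------
-- Ordered fields

-- These stand in for ℝ, which the library does not have. Classically ℝ is
-- one of them; decidability of the order then holds by excluded middle.

record OrderedField c ℓ₁ ℓ₂ : Set (lsuc (c ⊔ ℓ₁ ⊔ ℓ₂)) where
  field
    commutativeRing : CommutativeRing c ℓ₁

  open CommutativeRing commutativeRing public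
    hiding (refl; sym; trans; reflexive)
    renaming (_+_ to _⊕_; _-_ to _⊖_)

  infix 4 _≤_

  field
    _≤_             : Rel Carrier ℓ₂
    isDecTotalOrder : IsDecTotalOrder _≈_ _≤_
    0≉1             : ¬ (0# ≈ 1#)
    inverse         : ∀ {x} → ¬ (x ≈ 0#) → Invertible _≈_ 1# _*_ x
    +-monoˡ-≤       : ∀ z {x y} → x ≤ y → x ⊕ z ≤ y ⊕ z
    *-nonNeg        : ∀ {x y} → 0# ≤ x → 0# ≤ y → 0# ≤ x * y

------------------------------------------------------------------------
-- Faces, facets and levels of point configurations

module _ {c ℓ₁ ℓ₂} (F : OrderedField c ℓ₁ ℓ₂) where
  open OrderedField F
  open Sum +-commutativeMonoid using (sum)

  record AffineFunction (m : ℕ) : Set c where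
    constructor affine
    field
      constant    : Carrier
      coefficient : Vector Carrier m

  eval : ∀ {m} → AffineFunction m → Vector Carrier m → Carrier
  eval (affine b a) x = b ⊕ sum (λ i → a i * x i)

  module _ {m v} (V : Pred (Vector Carrier m) v) where

    NonNegativeOn : AffineFunction m → Set _
    NonNegativeOn l = ∀ {x} → x ∈ V → 0# ≤ eval l x

    Face : AffineFunction m → Pred (Vector Carrier m) _
    Face l x = x ∈ V × eval l x ≈ 0#

    -- As Face l ⊆ V always holds, ¬ (V ⊆ Face l) says that the face
    -- differs from V. The empty face is not excluded: it is the only
    -- facet of a one-point configuration.
    FacetDefining : AffineFunction m → Set _
    FacetDefining l =
        NonNegativeOn l
      × ¬ (V ⊆ Face l)
      × (∀ l′ → NonNegativeOn l′ → ¬ (V ⊆ Face l′) →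
           Face l ⊆ Face l′ → Face l′ ⊆ Face l)

    AtMostValues : ℕ → AffineFunction m → Set _
    AtMostValues k l =
      Σ (Vector Carrier k) λ values → ∀ {x} → x ∈ V → ∃ λ i → eval l x ≈ values i

    IsLevel : ℕ → Set _
    IsLevel k = ∀ l → FacetDefining l → AtMostValues k l

------------------------------------------------------------------------
-- Finite simple graphs

-- Edges are numbered so that E(G) = Fin size indexes the coordinates of
-- the ambient space. The orientation given by end₁ and end₂ is irrelevant.

record Graph : Set where
  field
    order : ℕ
    size  : ℕ
    end₁  : Fin size → Fin order
    end₂  : Fin size → Fin order

  Vertex : Set
  Vertex = Fin order

  Edge : Set
  Edge = Fin size

  Joins : Edge → Vertex → Vertex → Set
  Joins e u v = (end₁ e ≡ u × end₂ e ≡ v) ⊎ (end₁ e ≡ v × end₂ e ≡ u)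

  field
    noLoops     : ∀ e → end₁ e ≢ end₂ e
    noParallels : ∀ {e f u v} → Joins e u v → Joins f u v → e ≡ f

  -- Below, X and T select the vertices in X and those edges in T with both
  -- ends in X; thus (⊤ , T) is a spanning subgraph and (X , ⊤) an induced one.

  Adjacent : Subset order → Subset size → Rel Vertex _
  Adjacent X T u v = u ∈ₛ X × v ∈ₛ X × ∃ λ e → e ∈ₛ T × Joins e u v

  Walk : Subset order → Subset size → Rel Vertex _
  Walk X T = Star (Adjacent X T)

  Connected : Subset order → Subset size → Set
  Connected X T = Nonempty X × (∀ {u v} → u ∈ₛ X → v ∈ₛ X → Walk X T u v)

  walkEdges : ∀ {X T u v} → Walk X T u v → List Edge
  walkEdges ε                       = []
  walkEdges ((_ , _ , e , _) ◅ w) = e ∷ walkEdges w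

  -- The last vertex is left out, so that for a closed walk the common first
  -- and last vertex is listed once.
  walkVertices : ∀ {X T u v} → Walk X T u v → List Vertex
  walkVertices ε                = []
  walkVertices (_◅_ {i = u} _ w) = u ∷ walkVertices w

  IsCycle : ∀ {T u} → Walk ⊤ T u u → Set
  IsCycle w = walkEdges w ≢ [] × Unique (walkEdges w) × Unique (walkVertices w)

  Acyclic : Subset size → Set
  Acyclic T = ∀ {u} (w : Walk ⊤ T u u) → ¬ IsCycle w

  -- The bases of the graphic matroid: inclusion-maximal acyclic edge sets.
  SpanningForest : Subset size → Set
  SpanningForest T = Acyclic T × (∀ T′ → Acyclic T′ → T ⊆ₛ T′ → T′ ⊆ₛ T)

  Biconnected : Subset size → Set
  Biconnected T = Connected ⊤ T × (∀ v → Connected (⊤ - v) T)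

  -- Under this definition the complete graph on two vertices qualifies.
  MinimallyBiconnected : Set
  MinimallyBiconnected = Biconnected ⊤ × (∀ e → ¬ Biconnected (⊤ - e))

open Graph

------------------------------------------------------------------------
-- Levelness of graphs

module _ {c ℓ₁ ℓ₂} (F : OrderedField c ℓ₁ ℓ₂) (G : Graph) where
  open OrderedField F using (Carrier; 0#; 1#)

  indicator : Subset (size G) → Vector Carrier (size G)
  indicator T e = if lookup T e then 1# else 0#

  baseConfiguration : Pred (Vector Carrier (size G)) c
  baseConfiguration x = ∃ λ T → SpanningForest G T × x ≡ indicator T

IsLevelGraph : ∀ {c ℓ₁ ℓ₂} → OrderedField c ℓ₁ ℓ₂ → ℕ → Graph → Set _
IsLevelGraph F k G = IsLevel F (baseConfiguration F G) k

------------------------------------------------------------------------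
-- Minors

-- K ≼ G: some minor of G is isomorphic to K. The set branch x is contracted
-- to the vertex x of K; all other vertices and edges are deleted.

record _≼_ (K G : Graph) : Set where
  field
    branch    : Vertex K → Subset (order G)
    connected : ∀ x → Connected G (branch x) ⊤
    disjoint  : ∀ {x y} → x ≢ y → Empty (branch x ∩ branch y)
    edge      : ∀ e → ∃₂ λ u v →
                  u ∈ₛ branch (end₁ K e) × v ∈ₛ branch (end₂ K e) ×
                  ∃ λ f → Joins G f u v

------------------------------------------------------------------------
-- Cones

-- The apex is zero and v becomes suc v. The edges of H come first, followed
-- by one edge from the apex to each vertex of H.

module _ (H : Graph) where

  private
    n = order H
    m = size H

  coneEnd₁ : Edge H ⊎ Vertex H → Fin (suc n)
  coneEnd₁ (inj₁ e) = suc (end₁ H e)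
  coneEnd₁ (inj₂ v) = zero

  coneEnd₂ : Edge H ⊎ Vertex H → Fin (suc n)
  coneEnd₂ (inj₁ e) = suc (end₂ H e)
  coneEnd₂ (inj₂ v) = suc v

  private
    ConeJoins : Edge H ⊎ Vertex H → Fin (suc n) → Fin (suc n) → Set
    ConeJoins s u v =
      (coneEnd₁ s ≡ u × coneEnd₂ s ≡ v) ⊎ (coneEnd₁ s ≡ v × coneEnd₂ s ≡ u)

    coneNoLoops : ∀ s → coneEnd₁ s ≢ coneEnd₂ s
    coneNoLoops (inj₁ e) eq = noLoops H e (suc-injective eq)

    coneNoParallels : ∀ s t {u v} → ConeJoins s u v → ConeJoins t u v → s ≡ t
    coneNoParallels (inj₁ e) (inj₁ f) (inj₁ (refl , refl)) (inj₁ (p , q)) =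
      cong inj₁ (noParallels H (inj₁ (refl , refl)) (inj₁ (suc-injective p , suc-injective q)))
    coneNoParallels (inj₁ e) (inj₁ f) (inj₁ (refl , refl)) (inj₂ (p , q)) =
      cong inj₁ (noParallels H (inj₁ (refl , refl)) (inj₂ (suc-injective p , suc-injective q)))
    coneNoParallels (inj₁ e) (inj₁ f) (inj₂ (refl , refl)) (inj₁ (p , q)) =
      cong inj₁ (noParallels H (inj₂ (refl , refl)) (inj₁ (suc-injective p , suc-injective q)))
    coneNoParallels (inj₁ e) (inj₁ f) (inj₂ (refl , refl)) (inj₂ (p , q)) =
      cong inj₁ (noParallels H (inj₂ (refl , refl)) (inj₂ (suc-injective p , suc-injective q)))
    coneNoParallels (inj₁ e) (inj₂ x) (inj₁ (refl , refl)) (inj₁ (() , _))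
    coneNoParallels (inj₁ e) (inj₂ x) (inj₁ (refl , refl)) (inj₂ (() , _))
    coneNoParallels (inj₁ e) (inj₂ x) (inj₂ (refl , refl)) (inj₁ (() , _))
    coneNoParallels (inj₁ e) (inj₂ x) (inj₂ (refl , refl)) (inj₂ (() , _))
    coneNoParallels (inj₂ x) (inj₁ f) (inj₁ (refl , refl)) (inj₁ (() , _))
    coneNoParallels (inj₂ x) (inj₁ f) (inj₁ (refl , refl)) (inj₂ (_ , ()))
    coneNoParallels (inj₂ x) (inj₁ f) (inj₂ (refl , refl)) (inj₁ (_ , ()))
    coneNoParallels (inj₂ x) (inj₁ f) (inj₂ (refl , refl)) (inj₂ (() , _))
    coneNoParallels (inj₂ x) (inj₂ y) (inj₁ (refl , refl)) (inj₁ (_ , q)) =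
      cong inj₂ (sym (suc-injective q))
    coneNoParallels (inj₂ x) (inj₂ y) (inj₁ (refl , refl)) (inj₂ (() , _))
    coneNoParallels (inj₂ x) (inj₂ y) (inj₂ (refl , refl)) (inj₁ (() , _))
    coneNoParallels (inj₂ x) (inj₂ y) (inj₂ (refl , refl)) (inj₂ (_ , q)) =
      cong inj₂ (sym (suc-injective q))

    splitAt-injective : ∀ (i j : Fin (m + n)) → splitAt m i ≡ splitAt m j → i ≡ j
    splitAt-injective i j eq with splitAt m i in p | splitAt m j in q
    splitAt-injective i j refl | inj₁ _ | inj₁ _ =
      trans (sym (splitAt⁻¹-↑ˡ p)) (splitAt⁻¹-↑ˡ q)
    splitAt-injective i j refl | inj₂ _ | inj₂ _ =
      trans (sym (splitAt⁻¹-↑ʳ p)) (splitAt⁻¹-↑ʳ q)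

  cone : Graph
  cone = record
    { order       = suc n
    ; size        = m + n
    ; end₁        = coneEnd₁ ∘ splitAt m
    ; end₂        = coneEnd₂ ∘ splitAt m
    ; noLoops     = coneNoLoops ∘ splitAt m
    ; noParallels = λ {e} {f} p q →
        splitAt-injective e f (coneNoParallels (splitAt m e) (splitAt m f) p q)
    }

{-# OPTIONS --safe #-}
module Submission where

open import Defs
open import Data.Nat.Base using (ℕ; suc; _≤_)
open import Function.Bundles using (_⇔_; mk⇔)
open import Relation.Binary.PropositionalEquality using (_≡_)
open import Relation.Nullary using (¬_)

import Algebra.Properties.CommutativeMonoid.Sum as Sum
import Algebra.Properties.Ring as RingProperties
import Algebra.Properties.Semiring.Sum as SemiringSum
open import Data.Bool.Base using (true; if_then_else_)
open import Data.Empty using (⊥; ⊥-elim)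
open import Data.Fin.Base using (Fin; zero; suc; toℕ; fromℕ<; splitAt; _↑ˡ_; _↑ʳ_; punchIn; punchOut)
import Data.Fin.Properties as Fin
open import Data.Fin.Properties using (_≟_; any?; all?; suc-injective; splitAt-↑ˡ; splitAt-↑ʳ; toℕ-injective; toℕ<n; toℕ-fromℕ<; punchIn-injective; punchIn-punchOut)
import Data.Fin.Subset as Subset
open import Data.Fin.Subset using (Subset; inside; outside; ∣_∣; ⊤; ⁅_⁆; _∩_; _─_; _-_; _∈_; _∉_; _⊆_; Nonempty)
open import Data.Fin.Subset.Properties using (_∈?_; ∈⊤; ∉⊥; ∣⊤∣≡n; ∣⊥∣≡0; ∣⁅x⁆∣≡1; x∈⁅x⁆; x∈⁅y⁆⇒x≡y; ⊆-antisym; in⊆in; out⊆; p⊆q⇒∣p∣≤∣q∣; p⊂q⇒∣p∣<∣q∣; x∈p∩q⁺; x∈p∩q⁻; ∣p∩q∣≤∣p∣; x∈p∧x∉q⇒x∈p─q; p─q⊆p; p─⊥≡p)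
open import Data.List.Base using (List; []; _∷_; _++_; map; length; filter)
open import Data.List.Membership.Propositional using (find; lose) renaming (_∈_ to _∈ₗ_; _∉_ to _∉ₗ_)
import Data.List.Membership.DecPropositional as DecMembership
open import Data.List.Membership.Propositional.Properties using (∈-map⁺; ∈-map⁻; ∈-++⁺ˡ; ∈-++⁺ʳ; ∈-++⁻; ∈-filter⁺; ∈-filter⁻)
open import Data.List.Properties using (length-map; length-++)
open import Data.List.Relation.Unary.All as All using (All; []; _∷_)
import Data.List.Relation.Unary.All.Properties as All
open import Data.List.Relation.Unary.AllPairs using ([]; _∷_)
open import Data.List.Relation.Unary.Any as Any using (here; there)
open import Data.List.Relation.Unary.Unique.Propositional using (Unique)
import Data.List.Relation.Unary.Unique.Propositional.Properties as Unique
open import Data.Nat.Base using (zero; pred; _+_; _∸_; _<_; z≤n; s≤s)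
open import Data.Nat.Induction using (<-wellFounded; Acc; acc)
import Data.Nat.Properties as ℕ
open import Data.Product.Base using (∃; ∃₂; _×_; _,_; proj₁; proj₂)
open import Data.Sum.Base using (_⊎_; inj₁; inj₂; [_,_]′)
import Data.Unit.Base as Unit
open import Data.Vec.Base using ([]; _∷_; here; there; tabulate; lookup; _[_]≔_)
open import Data.Vec.Functional using (Vector) renaming (_∷_ to _∷ᵥ_)
open import Data.Vec.Properties using (lookup∘tabulate; lookup∘update; lookup∘update′; []=⇒lookup; lookup⇒[]=)
open import Function.Base using (_∘_; id)
open import Level using (0ℓ; _⊔_)
open import Relation.Binary.Construct.Closure.ReflexiveTransitive as Star using (ε; _◅_; _◅◅_; reverse)
open import Relation.Binary.Core using (Rel)
open import Relation.Binary.Definitions using (DecidableEquality)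
open import Relation.Binary.PropositionalEquality using (_≢_; refl; sym; trans; cong; subst; subst₂; isEquivalence)
open import Relation.Binary.Structures using (IsEquivalence; IsDecTotalOrder)
open import Relation.Nullary using (Dec; yes; no; does; contradiction)
open import Relation.Nullary.Decidable using (map′; ¬?; _×-dec_; _⊎-dec_; ¬¬-excluded-middle; decidable-stable)
open import Relation.Unary using (Pred; Decidable) renaming (_∈_ to _∈ᵤ_; _⊆_ to _⊆ᵤ_)

-- Bases are the acyclic spanning edge sets, compared through Steinitz exchange.
--
-- Minor ⇒ many values. Lift cone(H) to G along spanning trees C of the branch sets (extended to
-- all of G), and let A consist of C and the rim edges. On bases, rank A ∸ ∣ T ∩ A ∣ is nonnegative;
-- some facet contains its zeros but not the base in which all spokes are chosen. By biconnectivity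
-- of H its functional is constant on the rim and constant on the spokes, so exchanging spokes for
-- rim edges one at a time, from the star to a spanning tree of H, changes it by the same nonzero
-- amount each time.
--
-- Many values ⇒ minor. Call A tight if every base on the facet spans it, and loose if some base
-- does not. For tight and loose A the facet functional is a multiple of rank A ∸ ∣ T ∩ A ∣; the
-- light edges of an uneven exchange are such an A. A minimal one is the edge set of a biconnected
-- G[W]. Among the sets U of vertices outside W for which the edges avoiding U are loose, a minimal
-- one is connected, and by the number of values it has more than k neighbours in W. Contracting U
-- to the apex, and merging vertices of W while preserving biconnectivity until each part contains
-- one of k + 1 chosen neighbours, gives the cone. For k = 1, where the facet may be of the form
-- x_e = 0, an edge of a cycle serves as G[W] instead.

-- Generated equivalence relations and Steinitz exchange

-- Whether a functional defines a facet depends on all affine functions, so facets arise only under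
-- a double negation. This is enough: minors are refuted by deriving falsity, and having at most `k`
-- values on a finite configuration is decidable, hence stable. Tightness and looseness serve one
-- principle: a facet functional is a multiple of any nonnegative one that vanishes on its face but
-- not everywhere. Both must survive the passage to smaller sets. At a cut vertex, contracting one
-- side retracts links onto the other; when part of `U` is given up, uniqueness of paths in a base
-- shows which part stays loose. A tight set may be replaced by the graph it induces only if it is
-- closed in the matroid. It is, once every edge lies in a base on the face. The exception is a
-- facet of the form x_e = 0, which has two values; this isolates `k = 1`. It is found by shrinking
-- the set that a separating pair cuts off.

infixr 5 _∙_

-- Symmetry and transitivity are constructors, so an invariant is proved by exhibiting an
-- equivalence relation that contains `R`, without induction along walks.
data Conn {A : Set} (R : Rel A 0ℓ) : Rel A 0ℓ where
  step : ∀ {u v} → R u v → Conn R u v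
  stop : ∀ {u} → Conn R u u
  back : ∀ {u v} → Conn R u v → Conn R v u
  _∙_  : ∀ {u v w} → Conn R u v → Conn R v w → Conn R u w

module _ {A : Set} {R : Rel A 0ℓ} where

  conn-fold : ∀ {ℓ} {E : Rel A ℓ} → IsEquivalence E → (∀ {a b} → R a b → E a b) →
              ∀ {u v} → Conn R u v → E u v
  conn-fold eq f (step r) = f r
  conn-fold eq f stop     = IsEquivalence.refl eq
  conn-fold eq f (back p) = IsEquivalence.sym eq (conn-fold eq f p)
  conn-fold eq f (p ∙ q)  = IsEquivalence.trans eq (conn-fold eq f p) (conn-fold eq f q)

  conn-gmap : ∀ {B : Set} {S : Rel B 0ℓ} (φ : A → B) →
              (∀ {a b} → R a b → Conn S (φ a) (φ b)) →
              ∀ {u v} → Conn R u v → Conn S (φ u) (φ v)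
  conn-gmap φ f (step r) = f r
  conn-gmap φ f stop     = stop
  conn-gmap φ f (back p) = back (conn-gmap φ f p)
  conn-gmap φ f (p ∙ q)  = conn-gmap φ f p ∙ conn-gmap φ f q

  conn-map : ∀ {S : Rel A 0ℓ} → (∀ {a b} → R a b → Conn S a b) →
             ∀ {u v} → Conn R u v → Conn S u v
  conn-map = conn-gmap id

  conn-cong : ∀ {a b x y} → a ≡ x → b ≡ y → Conn R a b → Conn R x y
  conn-cong refl refl p = p

  conn-closed : ∀ {ℓ} {P : A → Set ℓ} →
                (∀ {a b} → R a b → (P a → P b) × (P b → P a)) →
                ∀ {u v} → Conn R u v → P u → P v
  conn-closed {P = P} f = proj₁ ∘ conn-fold {E = λ a b → (P a → P b) × (P b → P a)} (record
    { refl  = id , id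
    ; sym   = λ (p , q) → q , p
    ; trans = λ (p , q) (p′ , q′) → (p′ ∘ p) , (q ∘ q′)
    }) f

module _ {A : Set} {R S : Rel A 0ℓ} {a b : A}
         (split : ∀ {x y} → S x y → R x y ⊎ (x ≡ a × y ≡ b)) where

  private
    Via : Rel A 0ℓ
    Via u v = Conn R u v ⊎ (Conn R u a × Conn R b v) ⊎ (Conn R u b × Conn R a v)

    via-trans : ∀ {u v w} → Via u v → Via v w → Via u w
    via-trans (inj₁ p)              (inj₁ q)              = inj₁ (p ∙ q)
    via-trans (inj₁ p)              (inj₂ (inj₁ (q , r))) = inj₂ (inj₁ (p ∙ q , r))
    via-trans (inj₁ p)              (inj₂ (inj₂ (q , r))) = inj₂ (inj₂ (p ∙ q , r))
    via-trans (inj₂ (inj₁ (p , q))) (inj₁ r)              = inj₂ (inj₁ (p , q ∙ r))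
    via-trans (inj₂ (inj₁ (p , q))) (inj₂ (inj₁ (r , s))) = inj₂ (inj₁ (p , s))
    via-trans (inj₂ (inj₁ (p , q))) (inj₂ (inj₂ (r , s))) = inj₁ (p ∙ s)
    via-trans (inj₂ (inj₂ (p , q))) (inj₁ r)              = inj₂ (inj₂ (p , q ∙ r))
    via-trans (inj₂ (inj₂ (p , q))) (inj₂ (inj₁ (r , s))) = inj₁ (p ∙ s)
    via-trans (inj₂ (inj₂ (p , q))) (inj₂ (inj₂ (r , s))) = inj₂ (inj₂ (p , s))

  -- The additional pair need be traversed at most once: `Via` is already transitive, since between
  -- two traversals there is a detour that can be cut out.
  conn-split : ∀ {u v} → Conn S u v →
               Conn R u v ⊎ (Conn R u a × Conn R b v) ⊎ (Conn R u b × Conn R a v)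
  conn-split = conn-fold {E = Via} (record
    { refl  = inj₁ stop
    ; sym   = λ { (inj₁ p)              → inj₁ (back p)
                ; (inj₂ (inj₁ (p , q))) → inj₂ (inj₂ (back q , back p))
                ; (inj₂ (inj₂ (p , q))) → inj₂ (inj₁ (back q , back p)) }
    ; trans = via-trans
    }) λ s → case-split (split s)
    where
    case-split : ∀ {x y} → R x y ⊎ (x ≡ a × y ≡ b) → Via x y
    case-split (inj₁ r)             = inj₁ (step r)
    case-split (inj₂ (refl , refl)) = inj₂ (inj₁ (stop , stop))

  -- The exchange axiom of this closure operator. A connection of `u` and `v` must run through the
  -- pair `(a , b)`; once `u` and `v` are joined directly, its two remaining pieces lead from `a` to
  -- `b`.
  conn-exchange : ∀ {R′ : Rel A 0ℓ} {u v} → (∀ {x y} → R x y → R′ x y) → R′ u v →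
                  ¬ Conn R u v → Conn S u v → Conn R′ a b
  conn-exchange R⇒R′ uv ¬p p with conn-split p
  ... | inj₁ q              = ⊥-elim (¬p q)
  ... | inj₂ (inj₁ (q , r)) = back (conn-map (step ∘ R⇒R′) q) ∙ step uv ∙ back (conn-map (step ∘ R⇒R′) r)
  ... | inj₂ (inj₂ (q , r)) = conn-map (step ∘ R⇒R′) r ∙ back (step uv) ∙ conn-map (step ∘ R⇒R′) q

module _ {A : Set} where

  -- Lists of arbitrary vertex pairs instead of edge sets: a generating list will later contain the
  -- rays of a star that need not be edges of the graph, and the size bound has to apply to it.
  Listed : List (A × A) → Rel A 0ℓ
  Listed L u v = (u , v) ∈ₗ L

  split-∷ : ∀ {a b L} {x y : A} → Listed ((a , b) ∷ L) x y → Listed L x y ⊎ (x ≡ a × y ≡ b)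
  split-∷ (here refl) = inj₂ (refl , refl)
  split-∷ (there p)   = inj₁ p

  conn? : DecidableEquality A → ∀ L u v → Dec (Conn (Listed L) u v)
  conn? _≟_ [] u v = map′ (λ { refl → stop }) (conn-fold isEquivalence λ ()) (u ≟ v)
  conn? _≟_ ((a , b) ∷ L) u v = map′ to (conn-split split-∷)
      (conn? _≟_ L u v ⊎-dec (conn? _≟_ L u a ×-dec conn? _≟_ L b v)
                       ⊎-dec (conn? _≟_ L u b ×-dec conn? _≟_ L a v))
    where
    up : ∀ {x y} → Conn (Listed L) x y → Conn (Listed ((a , b) ∷ L)) x y
    up = conn-map (step ∘ there)
    to : _ → Conn (Listed ((a , b) ∷ L)) u v
    to (inj₁ p)              = up p
    to (inj₂ (inj₁ (p , q))) = up p ∙ step (here refl) ∙ up q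
    to (inj₂ (inj₂ (p , q))) = up p ∙ back (step (here refl)) ∙ up q

  Spanned : List (A × A) → A × A → Set
  Spanned L (a , b) = Conn (Listed L) a b

  Independent : List (A × A) → List (A × A) → Set
  Independent P []       = Unit.⊤
  Independent P (x ∷ xs) = ¬ Spanned P x × Independent (x ∷ P) xs

  module _ (_≟_ : DecidableEquality A) where

    -- Pairs move from `Q` to `P` until `x` becomes spanned. The pair whose move achieves this is
    -- dropped, because exchange recovers it from `x` and the pairs moved before it.
    steinitz-exchange : ∀ x P Q → Spanned (P ++ Q) x → ¬ Spanned P x →
      ∃ λ Q′ → suc (length Q′) ≡ length Q ×
               (∀ {u v} → Conn (Listed (P ++ Q)) u v → Conn (Listed (x ∷ P ++ Q′)) u v)
    steinitz-exchange x P [] p ¬p = ⊥-elim (¬p (conn-map only-P p))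
      where
      only-P : ∀ {a b} → Listed (P ++ []) a b → Conn (Listed P) a b
      only-P m with ∈-++⁻ P m
      ... | inj₁ q = step q
    steinitz-exchange x@(u , v) P (q ∷ Q) p ¬p with conn? _≟_ (q ∷ P) u v
    ... | yes c = Q , refl , conn-map enlarge
      where
      q-spanned : Spanned (x ∷ P) q
      q-spanned = conn-exchange split-∷ there (here refl) ¬p c
      enlarge : ∀ {a b} → Listed (P ++ q ∷ Q) a b → Conn (Listed (x ∷ P ++ Q)) a b
      enlarge m with ∈-++⁻ P m
      ... | inj₁ r           = step (there (∈-++⁺ˡ r))
      ... | inj₂ (here refl) = conn-map (λ { (here e) → step (here e) ; (there r) → step (there (∈-++⁺ˡ r)) }) q-spanned
      ... | inj₂ (there r)   = step (there (∈-++⁺ʳ P r))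
    ... | no ¬c with steinitz-exchange x (q ∷ P) Q (conn-map (step ∘ shift) p) ¬c
      where
      shift : ∀ {a b} → Listed (P ++ q ∷ Q) a b → Listed (q ∷ P ++ Q) a b
      shift m with ∈-++⁻ P m
      ... | inj₁ r           = there (∈-++⁺ˡ r)
      ... | inj₂ (here refl) = here refl
      ... | inj₂ (there r)   = there (∈-++⁺ʳ P r)
    ...   | Q′ , len , f = q ∷ Q′ , cong suc len , λ c → conn-map (step ∘ unshift) (f (conn-map (step ∘ shift) c))
      where
      shift : ∀ {a b} → Listed (P ++ q ∷ Q) a b → Listed (q ∷ P ++ Q) a b
      shift m with ∈-++⁻ P m
      ... | inj₁ r           = there (∈-++⁺ˡ r)
      ... | inj₂ (here refl) = here refl
      ... | inj₂ (there r)   = there (∈-++⁺ʳ P r)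
      unshift : ∀ {a b} → Listed (x ∷ (q ∷ P) ++ Q′) a b → Listed (x ∷ P ++ q ∷ Q′) a b
      unshift (here e)          = here e
      unshift (there (here e))  = there (∈-++⁺ʳ P (here e))
      unshift (there (there m)) with ∈-++⁻ P m
      ... | inj₁ r = there (∈-++⁺ˡ r)
      ... | inj₂ r = there (∈-++⁺ʳ P (there r))

    steinitz : ∀ P xs Q → Independent P xs → (∀ {x} → x ∈ₗ xs → Spanned (P ++ Q) x) →
               length xs ≤ length Q
    steinitz P []       Q ind          sp = z≤n
    steinitz P (x ∷ xs) Q (¬p , ind) sp
      with Q′ , len , f ← steinitz-exchange x P Q (sp (here refl)) ¬p =
      subst (_ ≤_) len (s≤s (steinitz (x ∷ P) xs Q′ ind (λ m → f (sp (there m)))))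

-- Finite subsets: selection, insertion, deletion

module _ {n : ℕ} where

  module _ {ℓ} {P : Pred (Fin n) ℓ} (P? : Decidable P) where

    select : Subset n
    select = tabulate (does ∘ P?)

    ∈-select⁺ : ∀ {x} → P x → x ∈ select
    ∈-select⁺ {x} px = lookup⇒[]= x select (trans (lookup∘tabulate (does ∘ P?) x) eq)
      where
      eq : does (P? x) ≡ true
      eq with P? x
      ... | yes _ = refl
      ... | no ¬p = contradiction px ¬p

    ∈-select⁻ : ∀ {x} → x ∈ select → P x
    ∈-select⁻ {x} m with P? x | trans (sym (lookup∘tabulate (does ∘ P?) x)) ([]=⇒lookup m)
    ... | yes p | _ = p

  add del : Subset n → Fin n → Subset n
  add T e = T [ e ]≔ inside
  del T e = T [ e ]≔ outside

  ∈-add : ∀ T e → e ∈ add T e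
  ∈-add T e = lookup⇒[]= e _ (lookup∘update e T inside)

  ∈-add⁺ : ∀ {T e x} → x ∈ T → x ∈ add T e
  ∈-add⁺ {T} {e} {x} m with x ≟ e
  ... | yes refl = ∈-add T e
  ... | no x≢e   = lookup⇒[]= x _ (trans (lookup∘update′ x≢e T inside) ([]=⇒lookup m))

  ∈-add⁻ : ∀ {T e x} → x ∈ add T e → x ∈ T ⊎ x ≡ e
  ∈-add⁻ {T} {e} {x} m with x ≟ e
  ... | yes x≡e = inj₂ x≡e
  ... | no x≢e  = inj₁ (lookup⇒[]= x _ (trans (sym (lookup∘update′ x≢e T inside)) ([]=⇒lookup m)))

  ∈-del⁺ : ∀ {T e x} → x ∈ T → x ≢ e → x ∈ del T e
  ∈-del⁺ {T} {e} {x} m x≢e = lookup⇒[]= x _ (trans (lookup∘update′ x≢e T outside) ([]=⇒lookup m))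

  ∈-del⁻ : ∀ {T e x} → x ∈ del T e → x ∈ T × x ≢ e
  ∈-del⁻ {T} {e} {x} m with x ≟ e
  ... | yes refl = contradiction (trans (sym (lookup∘update x T outside)) ([]=⇒lookup m)) λ ()
  ... | no x≢e   = lookup⇒[]= x _ (trans (sym (lookup∘update′ x≢e T outside)) ([]=⇒lookup m)) , x≢e

  ∣del∣< : ∀ {T e} → e ∈ T → ∣ del T e ∣ < ∣ T ∣
  ∣del∣< {T} {e} m = p⊂q⇒∣p∣<∣q∣ (proj₁ ∘ ∈-del⁻ , e , m , λ m′ → proj₂ (∈-del⁻ m′) refl)

∣add∣ : ∀ {n} {T : Subset n} {e} → e ∉ T → ∣ add T e ∣ ≡ suc ∣ T ∣
∣add∣ {T = inside  ∷ T} {Fin.zero}  e∉T = contradiction here e∉T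
∣add∣ {T = outside ∷ T} {Fin.zero}  e∉T = refl
∣add∣ {T = inside  ∷ T} {Fin.suc e} e∉T = cong suc (∣add∣ (e∉T ∘ there))
∣add∣ {T = outside ∷ T} {Fin.suc e} e∉T = ∣add∣ (e∉T ∘ there)

members : ∀ {n} → Subset n → List (Fin n)
members []            = []
members (inside  ∷ p) = zero ∷ map suc (members p)
members (outside ∷ p) = map suc (members p)

∈-members⁺ : ∀ {n} {p : Subset n} {x} → x ∈ p → x ∈ₗ members p
∈-members⁺ {p = inside  ∷ p} here      = here refl
∈-members⁺ {p = inside  ∷ p} (there m) = there (∈-map⁺ suc (∈-members⁺ m))
∈-members⁺ {p = outside ∷ p} (there m) = ∈-map⁺ suc (∈-members⁺ m)

∈-members⁻ : ∀ {n} {p : Subset n} {x} → x ∈ₗ members p → x ∈ p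
∈-members⁻ {p = inside  ∷ p} (here refl) = here
∈-members⁻ {p = inside  ∷ p} (there m) with ∈-map⁻ suc m
... | _ , m′ , refl = there (∈-members⁻ m′)
∈-members⁻ {p = outside ∷ p} m with ∈-map⁻ suc m
... | _ , m′ , refl = there (∈-members⁻ m′)

length-members : ∀ {n} (p : Subset n) → length (members p) ≡ ∣ p ∣
length-members []            = refl
length-members (inside  ∷ p) = cong suc (trans (length-map suc (members p)) (length-members p))
length-members (outside ∷ p) = trans (length-map suc (members p)) (length-members p)

members-unique : ∀ {n} (p : Subset n) → Unique (members p)
members-unique []            = []
members-unique (inside  ∷ p) = All.map⁺ (All.universal (λ _ ()) (members p)) ∷ Unique.map⁺ suc-injective
    (members-unique p)
members-unique (outside ∷ p) = Unique.map⁺ suc-injective (members-unique p)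

-- The graphic matroid: forests, bases and exchange

module GraphicMatroid (G : Graph) where
  open Graph G public

  data Chosen (T : Subset size) : Rel Vertex 0ℓ where
    chosen : ∀ {e} → e ∈ T → Chosen T (end₁ e) (end₂ e)

  Link : Subset size → Rel Vertex 0ℓ
  Link T = Conn (Chosen T)

  Spans : Subset size → Edge → Set
  Spans T e = Link T (end₁ e) (end₂ e)

  -- Independence in matroid terms; `forest⇒acyclic` and `acyclic⇒forest` match it with the absence
  -- of cycles.
  Forest : Subset size → Set
  Forest T = ∀ {e} → e ∈ T → ¬ Spans (del T e) e

  Basis : Subset size → Set
  Basis T = Forest T × (∀ e → Spans T e)

  -- For a basis `T` this amounts to `∣ T ∩ A ∣` being the rank of `A`, by `trace-size-≤`.
  Covers : Subset size → Subset size → Set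
  Covers T A = ∀ {e} → e ∈ A → Spans (T ∩ A) e

  ends : Edge → Vertex × Vertex
  ends e = end₁ e , end₂ e

  pairs : Subset size → List (Vertex × Vertex)
  pairs = map ends ∘ members

  span : ∀ {T e} → e ∈ T → Spans T e
  span m = step (chosen m)

  joins-link : ∀ {T e u v} → Spans T e → Joins e u v → Link T u v
  joins-link s (inj₁ (refl , refl)) = s
  joins-link s (inj₂ (refl , refl)) = back s

  joins-span : ∀ {T e u v} → Link T u v → Joins e u v → Spans T e
  joins-span s (inj₁ (refl , refl)) = s
  joins-span s (inj₂ (refl , refl)) = back s

  link-gmap : ∀ {B : Set} {S : Rel B 0ℓ} {T} (φ : Vertex → B) →
              (∀ {e} → e ∈ T → Conn S (φ (end₁ e)) (φ (end₂ e))) →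
              ∀ {u v} → Link T u v → Conn S (φ u) (φ v)
  link-gmap φ f = conn-gmap φ λ { (chosen m) → f m }

  link-map : ∀ {S : Rel Vertex 0ℓ} {T} → (∀ {e} → e ∈ T → Conn S (end₁ e) (end₂ e)) →
             ∀ {u v} → Link T u v → Conn S u v
  link-map = link-gmap id

  link-mono : ∀ {T T′} → T ⊆ T′ → ∀ {u v} → Link T u v → Link T′ u v
  link-mono T⊆T′ = link-map (span ∘ T⊆T′)

  link-closed : ∀ {ℓ T} {P : Vertex → Set ℓ} →
                (∀ {e} → e ∈ T → (P (end₁ e) → P (end₂ e)) × (P (end₂ e) → P (end₁ e))) →
                ∀ {u v} → Link T u v → P u → P v
  link-closed f = conn-closed λ { (chosen m) → f m }

  link⇒listed : ∀ {T u v} → Link T u v → Conn (Listed (pairs T)) u v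
  link⇒listed = link-map (step ∘ ∈-map⁺ ends ∘ ∈-members⁺)

  listed⇒link : ∀ {T u v} → Conn (Listed (pairs T)) u v → Link T u v
  listed⇒link = conn-map λ m → case (∈-map⁻ ends m)
    where
    case : ∀ {T u v} → ∃ (λ e → e ∈ₗ members T × (u , v) ≡ ends e) → Link T u v
    case (e , m , refl) = span (∈-members⁻ m)

  link? : ∀ T u v → Dec (Link T u v)
  link? T u v = map′ listed⇒link link⇒listed (conn? _≟_ (pairs T) u v)

  spans? : ∀ T e → Dec (Spans T e)
  spans? T e = link? T (end₁ e) (end₂ e)

  forest? : ∀ T → Dec (Forest T)
  forest? T = map′ (λ f {e} → f e) (λ f e → f {e}) (all? λ e → implies? (e ∈? T) (¬? (spans? (del T e) e)))
    where
    implies? : ∀ {P Q : Set} → Dec P → Dec Q → Dec (P → Q)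
    implies? _       (yes q) = yes λ _ → q
    implies? (yes p) (no ¬q) = no λ f → ¬q (f p)
    implies? (no ¬p) (no ¬q) = yes λ p → contradiction p ¬p

  basis? : ∀ T → Dec (Basis T)
  basis? T = forest? T ×-dec all? (spans? T)

  split-del : ∀ {T e x y} → Chosen T x y → Chosen (del T e) x y ⊎ (x ≡ end₁ e × y ≡ end₂ e)
  split-del {e = e} (chosen {f} m) with f ≟ e
  ... | yes refl = inj₂ (refl , refl)
  ... | no f≢e   = inj₁ (chosen (∈-del⁺ m f≢e))

  -- As `f` is indispensable for linking `u` and `v` in `T`, its ends are linked to them without it,
  -- and the link between `u` and `v` in `Z` closes the circuit.
  exchange : ∀ {T Z f u v} → del T f ⊆ Z → Link Z u v → ¬ Link (del T f) u v → Link T u v → Spans Z f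
  exchange {Z = Z} T-f⊆Z uv ¬l l =
    conn-map id (conn-exchange split-del (λ { (chosen m) → span (T-f⊆Z m) }) uv ¬l l)

  forest-⊆ : ∀ {T X} → X ⊆ T → Forest T → Forest X
  forest-⊆ X⊆T forest m = forest (X⊆T m) ∘ link-mono λ m′ → ∈-del⁺ (X⊆T (proj₁ (∈-del⁻ m′))) (proj₂ (∈-del⁻ m′))

  -- If `e` put an old edge `f` on a cycle, then exchanging `f` for `e` would show that `T` spans
  -- `e`.
  forest-add : ∀ {T e} → Forest T → ¬ Spans T e → Forest (add T e)
  forest-add {T} {e} forest ¬s {f} m s with ∈-add⁻ m
  ... | inj₂ refl = ¬s (link-mono T+e-e⊆T s)
    where
    T+e-e⊆T : del (add T f) f ⊆ T
    T+e-e⊆T m′ with ∈-add⁻ (proj₁ (∈-del⁻ m′))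
    ... | inj₁ m″ = m″
    ... | inj₂ eq = contradiction eq (proj₂ (∈-del⁻ m′))
  ... | inj₁ f∈T = ¬s (conn-map id (conn-exchange {R = Chosen (del T f)} split
      (λ { (chosen m′) → span (proj₁ (∈-del⁻ m′)) }) (span f∈T) (forest f∈T) s))
    where
    split : ∀ {x y} → Chosen (del (add T e) f) x y → Chosen (del T f) x y ⊎ (x ≡ end₁ e × y ≡ end₂ e)
    split (chosen m′) with ∈-add⁻ (proj₁ (∈-del⁻ m′))
    ... | inj₁ m″   = inj₁ (chosen (∈-del⁺ m″ (proj₂ (∈-del⁻ m′))))
    ... | inj₂ refl = inj₂ (refl , refl)

  private
    extend-list : ∀ {I} → Forest I → ∀ es → ∃ λ B → Forest B × I ⊆ B ×
                  (∀ {e} → e ∈ B → e ∈ I ⊎ e ∈ₗ es) × (∀ {e} → e ∈ₗ es → Spans B e)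
    extend-list {I} forest [] = I , forest , id , inj₁ , λ ()
    extend-list {I} forest (e ∷ es) with extend-list forest es
    ... | B , fB , I⊆B , B⊆ , sp with spans? B e
    ...   | yes s = B , fB , I⊆B , [ inj₁ , inj₂ ∘ there ]′ ∘ B⊆ , λ { (here refl) → s ; (there m) → sp m }
    ...   | no ¬s = add B e , forest-add fB ¬s , ∈-add⁺ ∘ I⊆B , back-to ,
        λ { (here refl) → span (∈-add B e) ; (there m) → link-mono ∈-add⁺ (sp m) }
      where
      back-to : ∀ {x} → x ∈ add B e → x ∈ I ⊎ x ∈ₗ (e ∷ es)
      back-to m with ∈-add⁻ m
      ... | inj₁ m′   = [ inj₁ , inj₂ ∘ there ]′ (B⊆ m′)
      ... | inj₂ refl = inj₂ (here refl)

  extend : ∀ {I D} → Forest I → I ⊆ D →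
           ∃ λ B → Forest B × I ⊆ B × B ⊆ D × (∀ {e} → e ∈ D → Spans B e)
  extend {I} {D} forest I⊆D with extend-list forest (members D)
  ... | B , fB , I⊆B , B⊆ , sp = B , fB , I⊆B , [ I⊆D , ∈-members⁻ ]′ ∘ B⊆ , sp ∘ ∈-members⁺

  swap : Subset size → Edge → Edge → Subset size
  swap T f e = add (del T f) e

  -- If `f` is spanned after the exchange, `del T f` cannot span `e`, or it would span `f` too. This
  -- gives independence, and also `e ∉ T`, on which the formula for the change of value depends.
  basis-swap : ∀ {T f e} → Basis T → f ∈ T → f ≢ e → Spans (swap T f e) f → e ∉ T × Basis (swap T f e)
  basis-swap {T} {f} {e} (forest , spanning) f∈T f≢e s =
    (λ e∈T → ¬s (span (∈-del⁺ e∈T (f≢e ∘ sym)))) ,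
    forest-add (forest-⊆ (proj₁ ∘ ∈-del⁻) forest) ¬s ,
    λ x → link-map T⇒ (spanning x)
    where
    ¬s : ¬ Spans (del T f) e
    ¬s r = forest f∈T (link-map T+e⇒ s)
      where
      T+e⇒ : ∀ {x} → x ∈ swap T f e → Spans (del T f) x
      T+e⇒ m with ∈-add⁻ m
      ... | inj₁ m′   = span m′
      ... | inj₂ refl = r
    T⇒ : ∀ {x} → x ∈ T → Spans (swap T f e) x
    T⇒ {x} m with x ≟ f
    ... | yes refl = s
    ... | no x≢f   = span (∈-add⁺ (∈-del⁺ m x≢f))

  private
    peel-acc : ∀ {X Y u v} → Acc _<_ ∣ Y ∣ → X ⊆ Y → Link Y u v → ¬ Link X u v →
      ∃ λ f → f ∈ Y × f ∉ X × (∀ {Z} → del Y f ⊆ Z → Link Z u v → Spans Z f)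
    peel-acc {X} {Y} {u} {v} (acc rec) X⊆Y l ¬l with any? (λ f → (f ∈? Y) ×-dec ¬? (f ∈? X))
    ... | no none = contradiction (link-mono Y⊆X l) ¬l
      where
      Y⊆X : Y ⊆ X
      Y⊆X {x} m with x ∈? X
      ... | yes p = p
      ... | no ¬p = contradiction (x , m , ¬p) none
    ... | yes (f , f∈Y , f∉X) with link? (del Y f) u v
    ...   | no ¬l′ = f , f∈Y , f∉X , λ Y-f⊆Z l″ → exchange Y-f⊆Z l″ ¬l′ l
    ...   | yes l′ with peel-acc (rec (∣del∣< f∈Y)) (λ m → ∈-del⁺ (X⊆Y m) λ { refl → f∉X m }) l′ ¬l
    ...     | g , g∈ , g∉X , h = g , proj₁ (∈-del⁻ g∈) , g∉X , λ Y-g⊆Z →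
      h λ m → Y-g⊆Z (∈-del⁺ (proj₁ (∈-del⁻ (proj₁ (∈-del⁻ m)))) (proj₂ (∈-del⁻ m)))

  -- Edges outside `X` are deleted from `Y` until `u` and `v` fall apart; the last one is critical.
  -- This yields an edge outside `X` on a path from `u` to `v` without any mention of paths.
  peel : ∀ {X Y u v} → X ⊆ Y → Link Y u v → ¬ Link X u v →
      ∃ λ f → f ∈ Y × f ∉ X × (∀ {Z} → del Y f ⊆ Z → Link Z u v → Spans Z f)
  peel = peel-acc (<-wellFounded _)

  -- Uniqueness of paths in a forest: a critical edge of `X` missing from `Y` would be bypassed by
  -- the link in `Y`, and so lie on a cycle of `T`.
  link-∩ : ∀ {T X Y u v} → Forest T → X ⊆ T → Y ⊆ T → Link X u v → Link Y u v → Link (X ∩ Y) u v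
  link-∩ {T} {X} {Y} {u} {v} forest X⊆T Y⊆T lX lY with link? (X ∩ Y) u v
  ... | yes l = l
  ... | no ¬l with peel (proj₁ ∘ x∈p∩q⁻ X Y) lX ¬l
  ...   | f , f∈X , f∉X∩Y , h = contradiction
    (h (λ m → ∈-del⁺ (X⊆T (proj₁ (∈-del⁻ m))) (proj₂ (∈-del⁻ m)))
       (link-mono (λ m → ∈-del⁺ (Y⊆T m) λ { refl → f∉X∩Y (x∈p∩q⁺ (f∈X , m)) }) lY))
    (forest (X⊆T f∈X))

  private
    independent : ∀ {T} → Forest T → ∀ P es → Unique es → (∀ {e} → e ∈ₗ es → e ∈ T) →
                  (∀ {p} → p ∈ₗ P → ∃ λ f → f ∈ T × f ∉ₗ es × p ≡ ends f) →
                  Independent P (map ends es)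
    independent forest P []       u        es⊆T P⊆ = Unit.tt
    independent {T} forest P (e ∷ es) (e∉ ∷ u) es⊆T P⊆ =
      (λ c → forest (es⊆T (here refl)) (conn-map (into ∘ P⊆) c)) ,
      independent forest (ends e ∷ P) es u (es⊆T ∘ there) λ
        { (here refl) → e , es⊆T (here refl) , (λ m → All.lookup e∉ m refl) , refl
        ; (there m)   → weaken (P⊆ m) }
      where
      into : ∀ {x y} → ∃ (λ f → f ∈ T × f ∉ₗ (e ∷ es) × (x , y) ≡ ends f) → Link (del T e) x y
      into (f , f∈T , f∉ , refl) = span (∈-del⁺ f∈T λ { refl → f∉ (here refl) })
      weaken : ∀ {p} → ∃ (λ f → f ∈ T × f ∉ₗ (e ∷ es) × p ≡ ends f) → ∃ (λ f → f ∈ T × f ∉ₗ es × p ≡ ends f)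
      weaken (f , f∈T , f∉ , eq) = f , f∈T , f∉ ∘ there , eq

  forest-size-listed : ∀ {X Q} → Forest X → (∀ {e} → e ∈ X → Spanned Q (ends e)) → ∣ X ∣ ≤ length Q
  forest-size-listed {X} {Q} forest sp = subst (_≤ length Q)
    (trans (length-map ends (members X)) (length-members X))
    (steinitz _≟_ [] (pairs X) Q (independent forest [] (members X) (members-unique X) ∈-members⁻ λ ()) sp′)
    where
    sp′ : ∀ {p} → p ∈ₗ pairs X → Spanned Q p
    sp′ m with ∈-map⁻ ends m
    ... | e , m′ , refl = sp (∈-members⁻ m′)

  length-pairs : ∀ B → length (pairs B) ≡ ∣ B ∣
  length-pairs B = trans (length-map ends (members B)) (length-members B)

  forest-size : ∀ {X B} → Forest X → (∀ {e} → e ∈ X → Spans B e) → ∣ X ∣ ≤ ∣ B ∣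
  forest-size {X} {B} forest sp = subst (∣ X ∣ ≤_) (length-pairs B) (forest-size-listed forest (link⇒listed ∘ sp))

  forest-size-< : ∀ {X B e} → Forest X → (∀ {e} → e ∈ X → Spans B e) → ¬ Spans X e → Spans B e → ∣ X ∣ < ∣ B ∣
  forest-size-< {X} {B} {e} forest sp ¬s s = subst (_≤ ∣ B ∣) (∣add∣ (¬s ∘ span))
    (forest-size (forest-add forest ¬s) λ m → [ sp , (λ { refl → s }) ]′ (∈-add⁻ m))

-- Walks, cycles and the enumeration of bases

subsets : ∀ n → List (Subset n)
subsets zero    = [] ∷ []
subsets (suc n) = map (inside ∷_) (subsets n) ++ map (outside ∷_) (subsets n)

∈-subsets : ∀ {n} (p : Subset n) → p ∈ₗ subsets n
∈-subsets []            = here refl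
∈-subsets (inside  ∷ p) = ∈-++⁺ˡ (∈-map⁺ (inside ∷_) (∈-subsets p))
∈-subsets {suc n} (outside ∷ p) = ∈-++⁺ʳ (map (inside ∷_) (subsets n)) (∈-map⁺ (outside ∷_) (∈-subsets p))

module Walks (G : Graph) where
  open GraphicMatroid G

  joins-sym : ∀ {e u v} → Joins e u v → Joins e v u
  joins-sym (inj₁ p) = inj₂ p
  joins-sym (inj₂ p) = inj₁ p

  joins-end : ∀ {e x y u v} → Joins e x y → Joins e u v → x ≡ u ⊎ x ≡ v
  joins-end (inj₁ (refl , refl)) (inj₁ (refl , refl)) = inj₁ refl
  joins-end (inj₁ (refl , refl)) (inj₂ (refl , refl)) = inj₂ refl
  joins-end (inj₂ (refl , refl)) (inj₁ (refl , refl)) = inj₂ refl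
  joins-end (inj₂ (refl , refl)) (inj₂ (refl , refl)) = inj₁ refl

  module _ (X : Subset order) (T : Subset size) where

    Inside : Edge → Set
    Inside e = e ∈ T × end₁ e ∈ X × end₂ e ∈ X

    inside? : ∀ e → Dec (Inside e)
    inside? e = (e ∈? T) ×-dec (end₁ e ∈? X) ×-dec (end₂ e ∈? X)

    induced : Subset size
    induced = select inside?

  walk-sym : ∀ {X T u v} → Walk X T u v → Walk X T v u
  walk-sym = reverse λ (u∈ , v∈ , e , e∈ , j) → v∈ , u∈ , e , e∈ , joins-sym j

  link⇒walk : ∀ {X T F u v} → (∀ {e} → e ∈ F → Inside X T e) → Link F u v → Walk X T u v
  link⇒walk F⊆ = conn-fold
    (record { refl = ε ; sym = walk-sym ; trans = _◅◅_ })
    λ { (chosen {e} m) → (proj₁ (proj₂ (F⊆ m)) , proj₂ (proj₂ (F⊆ m)) , e , proj₁ (F⊆ m) , inj₁ (refl , refl)) ◅ ε }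

  walk⇒link : ∀ {X T F u v} → (∀ {e} → Inside X T e → e ∈ F) → Walk X T u v → Link F u v
  walk⇒link ⊆F ε = stop
  walk⇒link {X} ⊆F ((u∈ , v∈ , e , e∈ , j) ◅ w) = joins-link (span (⊆F (e∈ , ends∈ j))) j ∙ walk⇒link ⊆F w
    where
    ends∈ : Joins e _ _ → end₁ e ∈ X × end₂ e ∈ X
    ends∈ (inj₁ (refl , refl)) = u∈ , v∈
    ends∈ (inj₂ (refl , refl)) = v∈ , u∈

  private
    start∈ : ∀ {X T u v} (w : Walk X T u v) → u ∈ₗ (v ∷ walkVertices w)
    start∈ ε       = here refl
    start∈ (_ ◅ _) = there (here refl)

    deeper : ∀ {a} {A : Set a} {x y z : A} {zs} → x ∈ₗ (y ∷ zs) → x ∈ₗ (y ∷ z ∷ zs)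
    deeper (here eq) = here eq
    deeper (there m) = there (there m)

    touched : ∀ {X T u v x y f} (w : Walk X T u v) → f ∈ₗ walkEdges w → Joins f x y → x ∈ₗ (v ∷ walkVertices w)
    touched ((_ , _ , _ , _ , j′) ◅ w) (here refl) j with joins-end j j′
    ... | inj₁ refl = there (here refl)
    ... | inj₂ refl = deeper (start∈ w)
    touched (_ ◅ w) (there m) j = deeper (touched w m j)

    record Simple {X T u v} (w : Walk X T u v) : Set where
      constructor simple
      field
        vertices : Unique (v ∷ walkVertices w)
        edges    : Unique (walkEdges w)

    Avoids : ∀ {X T u v} → Walk X T u v → Edge → Set
    Avoids w e = All (_≢ e) (walkEdges w)

    drop-second : ∀ {a} {A : Set a} {x y : A} {zs} → Unique (x ∷ y ∷ zs) → Unique (x ∷ zs)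
    drop-second ((_ ∷ a) ∷ (_ ∷ u)) = a ∷ u

    cut : ∀ {X T u v x e} (w : Walk X T u v) → Simple w → Avoids w e → x ∈ₗ walkVertices w →
          ∃ λ (w′ : Walk X T x v) → Simple w′ × Avoids w′ e
    cut w@(_ ◅ _)  s                  a       (here refl) = w , s , a
    cut (_ ◅ w) (simple vs (_ ∷ es)) (_ ∷ a) (there m)   = cut w (simple (drop-second vs) es) a m

    -- Loop erasure: if the first vertex occurs again, the walk is cut to that occurrence. Avoidance
    -- of `e` is recorded separately because the result is a walk in `T`, to be closed up to a cycle
    -- by `e` itself.
    simplify : ∀ {X T u v e} → Walk X (del T e) u v → ∃ λ (w : Walk X T u v) → Simple w × Avoids w e
    simplify ε = ε , simple ([] ∷ []) [] , []
    simplify {v = v} (_◅_ {i = x} (u∈ , v∈ , f , f∈ , j) w₀) with simplify w₀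
    ... | w , s , a with x ∈ₗ? (v ∷ walkVertices w)
      where open DecMembership _≟_ using () renaming (_∈?_ to _∈ₗ?_)
    ...   | yes (here refl) = ε , simple ([] ∷ []) [] , []
    ...   | yes (there m)   = cut w s a m
    ...   | no x∉           =
      (u∈ , v∈ , f , proj₁ (∈-del⁻ f∈) , j) ◅ w ,
      simple (extended (Simple.vertices s)) (All.¬Any⇒All¬ _ (λ m → x∉ (touched w m j)) ∷ Simple.edges s) ,
      proj₂ (∈-del⁻ f∈) ∷ a
      where
      extended : Unique (v ∷ walkVertices w) → Unique (v ∷ x ∷ walkVertices w)
      extended (p ∷ u) = ((λ v≡x → x∉ (here (sym v≡x))) ∷ p) ∷ All.¬Any⇒All¬ _ (x∉ ∘ there) ∷ u

    walk-avoiding : ∀ {T e u v} (w : Walk ⊤ T u v) → All (e ≢_) (walkEdges w) → Link (del T e) u v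
    walk-avoiding ε [] = stop
    walk-avoiding ((_ , _ , f , f∈ , j) ◅ w) (e≢f ∷ a) =
      joins-link (span (∈-del⁺ f∈ (e≢f ∘ sym))) j ∙ walk-avoiding w a

  forest⇒acyclic : ∀ {T} → Forest T → Acyclic T
  forest⇒acyclic forest ε (nonempty , _) = nonempty refl
  forest⇒acyclic forest ((_ , _ , e , e∈ , j) ◅ w) (_ , (e∉ ∷ _) , _) =
    forest e∈ (joins-span (back (walk-avoiding w e∉)) j)

  acyclic⇒forest : ∀ {T} → Acyclic T → Forest T
  acyclic⇒forest acyclic {e} e∈ s with simplify {X = ⊤} {e = e} (link⇒walk (λ m → m , ∈⊤ , ∈⊤) (back s))
  ... | w , simple vs es , a = acyclic
    ((∈⊤ , ∈⊤ , e , e∈ , inj₁ (refl , refl)) ◅ w)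
    ((λ ()) , All.map (_∘ sym) a ∷ es , vs)

  basis⇒spanningForest : ∀ {T} → Basis T → SpanningForest T
  basis⇒spanningForest {T} (forest , spanning) = forest⇒acyclic forest , maximal
    where
    maximal : ∀ T′ → Acyclic T′ → T ⊆ T′ → T′ ⊆ T
    maximal T′ acyclic T⊆T′ {e} e∈T′ with e ∈? T
    ... | yes e∈T = e∈T
    ... | no e∉T  = contradiction
      (link-mono (λ m → ∈-del⁺ (T⊆T′ m) λ { refl → e∉T m }) (spanning e))
      (acyclic⇒forest acyclic e∈T′)

  spanningForest⇒basis : ∀ {T} → SpanningForest T → Basis T
  spanningForest⇒basis {T} (acyclic , maximal) = acyclic⇒forest acyclic , spanning
    where
    spanning : ∀ e → Spans T e
    spanning e with spans? T e
    ... | yes s = s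
    ... | no ¬s = contradiction
      (span (maximal (add T e) (forest⇒acyclic (forest-add (acyclic⇒forest acyclic) ¬s)) ∈-add⁺ (∈-add T e)))
      ¬s

  bases : List (Subset size)
  bases = filter basis? (subsets size)

  ∈-bases⁺ : ∀ {T} → Basis T → T ∈ₗ bases
  ∈-bases⁺ {T} = ∈-filter⁺ basis? (∈-subsets T)

  ∈-bases⁻ : ∀ {T} → T ∈ₗ bases → Basis T
  ∈-bases⁻ m = proj₂ (∈-filter⁻ basis? {xs = subsets size} m)

-- Finite point configurations over an ordered field

length-filter-< : ∀ {a p q} {A : Set a} {P : Pred A p} {Q : Pred A q} (P? : Decidable P) (Q? : Decidable Q) xs →
  (∀ {x} → x ∈ₗ xs → Q x → P x) → ∀ {y} → y ∈ₗ xs → P y → ¬ Q y →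
  length (filter Q? xs) < length (filter P? xs)
length-filter-< {P = P} {Q} P? Q? xs Q⇒P m py ¬qy = strict xs Q⇒P m
  where
  weak : ∀ xs → (∀ {x} → x ∈ₗ xs → Q x → P x) → length (filter Q? xs) ≤ length (filter P? xs)
  weak []       f = z≤n
  weak (x ∷ xs) f with Q? x | P? x
  ... | yes q | yes p = s≤s (weak xs (f ∘ there))
  ... | yes q | no ¬p = contradiction (f (here refl) q) ¬p
  ... | no ¬q | yes p = ℕ.m≤n⇒m≤1+n (weak xs (f ∘ there))
  ... | no ¬q | no ¬p = weak xs (f ∘ there)
  strict : ∀ xs → (∀ {x} → x ∈ₗ xs → Q x → P x) → _ ∈ₗ xs → length (filter Q? xs) < length (filter P? xs)
  strict (x ∷ xs) f (here refl) with Q? x | P? x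
  ... | yes q | _     = contradiction q ¬qy
  ... | no ¬q | yes p = s≤s (weak xs (f ∘ there))
  ... | no ¬q | no ¬p = contradiction py ¬p
  strict (x ∷ xs) f (there m) with Q? x | P? x
  ... | yes q | yes p = s≤s (strict xs (f ∘ there) m)
  ... | yes q | no ¬p = contradiction (f (here refl) q) ¬p
  ... | no ¬q | yes p = ℕ.m≤n⇒m≤1+n (strict xs (f ∘ there) m)
  ... | no ¬q | no ¬p = strict xs (f ∘ there) m

module Ordered {c ℓ₁ ℓ₂} (F : OrderedField c ℓ₁ ℓ₂) where
  open OrderedField F public hiding (zero) renaming (_≤_ to _⊑_)
  open IsDecTotalOrder isDecTotalOrder public
    using (_≤?_; total; antisym; ≤-respʳ-≈; ≤-respˡ-≈; module Eq)
    renaming (_≟_ to _≈?_; refl to ≤-refl; trans to ≤-trans; reflexive to ≤-reflexive)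
  open Eq public using () renaming (refl to ≈-refl; sym to ≈-sym; trans to ≈-trans)
  open RingProperties ring public using (-‿distribˡ-*; -‿distribʳ-*; -‿involutive)
  open Sum +-commutativeMonoid public using (sum; sum-cong-≋; ∑-distrib-+)
  open SemiringSum semiring public using (*-distribˡ-sum)

  ⊖-mono : ∀ {x y} → x ⊑ y → 0# ⊑ y ⊖ x
  ⊖-mono {x} {y} x≤y = ≤-respˡ-≈ (-‿inverseʳ x) (+-monoˡ-≤ (- x) x≤y)

  ⊖⊕-cancel : ∀ x y → (y ⊖ x) ⊕ x ≈ y
  ⊖⊕-cancel x y = ≈-trans (+-assoc y (- x) x) (≈-trans (+-congˡ (-‿inverseˡ x)) (+-identityʳ y))

  ⊕⊖-cancel : ∀ x y → (y ⊕ x) ⊖ x ≈ y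
  ⊕⊖-cancel x y = ≈-trans (+-assoc y x (- x)) (≈-trans (+-congˡ (-‿inverseʳ x)) (+-identityʳ y))

  ⊖-mono⁻ : ∀ {x y} → 0# ⊑ y ⊖ x → x ⊑ y
  ⊖-mono⁻ {x} {y} p = ≤-respˡ-≈ (+-identityˡ x) (≤-respʳ-≈ (⊖⊕-cancel x y) (+-monoˡ-≤ x p))

  ⊖≈0⇒≈ : ∀ {x y} → y ⊖ x ≈ 0# → y ≈ x
  ⊖≈0⇒≈ {x} {y} p = ≈-trans (≈-sym (⊖⊕-cancel x y)) (≈-trans (+-congʳ p) (+-identityˡ x))

  +-mono-≤ : ∀ {x y u v} → x ⊑ y → u ⊑ v → x ⊕ u ⊑ y ⊕ v
  +-mono-≤ {x} {y} {u} {v} x≤y u≤v = ≤-trans (+-monoˡ-≤ u x≤y)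
    (≤-respˡ-≈ (+-comm u y) (≤-respʳ-≈ (+-comm v y) (+-monoˡ-≤ y u≤v)))

  -‿nonNeg : ∀ {x} → x ⊑ 0# → 0# ⊑ - x
  -‿nonNeg x≤0 = ≤-respʳ-≈ (+-identityˡ _) (⊖-mono x≤0)

  *-monoʳ-≤ : ∀ {z x y} → 0# ⊑ z → x ⊑ y → x * z ⊑ y * z
  *-monoʳ-≤ {z} {x} {y} 0≤z x≤y = ⊖-mono⁻ (≤-respʳ-≈
    (≈-trans (distribʳ z y (- x)) (+-congˡ (≈-sym (-‿distribˡ-* x z))))
    (*-nonNeg (⊖-mono x≤y) 0≤z))

  0≤1 : 0# ⊑ 1#
  0≤1 with total 0# 1#
  ... | inj₁ p = p
  ... | inj₂ p = ≤-respʳ-≈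
    (≈-trans (≈-sym (-‿distribˡ-* 1# (- 1#))) (≈-trans (-‿cong (*-identityˡ (- 1#))) (-‿involutive 1#)))
    (*-nonNeg (-‿nonNeg p) (-‿nonNeg p))

  cancel-inverse : ∀ {x y i} → i * x ≈ 1# → (y * i) * x ≈ y
  cancel-inverse {x} {y} {i} p = ≈-trans (*-assoc y i x) (≈-trans (*-congˡ p) (*-identityʳ y))

  ι : ℕ → Carrier
  ι zero    = 0#
  ι (suc n) = 1# ⊕ ι n

  0≤ι : ∀ n → 0# ⊑ ι n
  0≤ι zero    = ≤-refl
  0≤ι (suc n) = ≤-respˡ-≈ (+-identityˡ 0#) (+-mono-≤ 0≤1 (0≤ι n))

  ι-suc≉0 : ∀ n → ¬ ι (suc n) ≈ 0#
  ι-suc≉0 n p = 0≉1 (antisym 0≤1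
    (≤-respˡ-≈ (+-identityʳ 1#) (≤-trans (+-mono-≤ ≤-refl (0≤ι n)) (≤-reflexive p))))

  ι-injective : ∀ {m n} → ι m ≈ ι n → m ≡ n
  ι-injective {zero}  {zero}  p = refl
  ι-injective {zero}  {suc n} p = contradiction (≈-sym p) (ι-suc≉0 n)
  ι-injective {suc m} {zero}  p = contradiction p (ι-suc≉0 m)
  ι-injective {suc m} {suc n} p = cong suc (ι-injective (≈-trans (drop m) (≈-trans (+-congˡ p) (≈-sym (drop n)))))
    where
    drop : ∀ k → ι k ≈ - 1# ⊕ (1# ⊕ ι k)
    drop k = ≈-trans (≈-sym (+-identityˡ (ι k))) (≈-trans (+-congʳ (≈-sym (-‿inverseˡ 1#))) (+-assoc (- 1#) 1# (ι k)))

  ι*-injective : ∀ {γ m n} → ¬ γ ≈ 0# → ι m * γ ≈ ι n * γ → m ≡ n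
  ι*-injective {γ} {m} {n} γ≉0 eq with inverse γ≉0
  ... | γ⁻¹ , _ , right = ι-injective (≈-trans (≈-sym (cancel-inverse right))
      (≈-trans (*-congʳ eq) (cancel-inverse right)))

  +-interchange : ∀ w x y z → (w ⊕ x) ⊕ (y ⊕ z) ≈ (w ⊕ y) ⊕ (x ⊕ z)
  +-interchange w x y z = ≈-trans (+-assoc w x (y ⊕ z)) (≈-trans (+-congˡ (≈-trans (≈-sym (+-assoc x y z))
    (≈-trans (+-congʳ (+-comm x y)) (+-assoc y x z)))) (≈-sym (+-assoc w y (x ⊕ z))))

  module _ {m : ℕ} where

    value : AffineFunction F m → Vector Carrier m → Carrier
    value = eval F

    constantly : Carrier → AffineFunction F m
    constantly b = affine b (λ _ → 0#)

    value-constantly : ∀ b x → value (constantly b) x ≈ b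
    value-constantly b x = ≈-trans (+-congˡ (≈-trans (sum-cong-≋ λ i → zeroˡ (x i)) (sum-0 m))) (+-identityʳ b)
      where
      sum-0 : ∀ n → sum {n} (λ _ → 0#) ≈ 0#
      sum-0 zero    = ≈-refl
      sum-0 (suc n) = ≈-trans (+-identityˡ _) (sum-0 n)

    _⊕_·_ : AffineFunction F m → Carrier → AffineFunction F m → AffineFunction F m
    affine b a ⊕ s · affine b′ a′ = affine (b ⊕ s * b′) (λ i → a i ⊕ s * a′ i)

    value-⊕· : ∀ g s h x → value (g ⊕ s · h) x ≈ value g x ⊕ s * value h x
    value-⊕· (affine b a) s (affine b′ a′) x = ≈-trans
      (+-congˡ (≈-trans (sum-cong-≋ λ i → ≈-trans (distribʳ (x i) (a i) (s * a′ i)) (+-congˡ (*-assoc s (a′ i) (x i))))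
               (≈-trans (∑-distrib-+ (λ i → a i * x i) (λ i → s * (a′ i * x i)))
                      (+-congˡ (≈-sym (*-distribˡ-sum s λ i → a′ i * x i))))))
      (≈-trans (+-interchange b (s * b′) _ _) (+-congˡ (≈-sym (distribˡ s b′ _))))

  -- V is given both as a predicate and as a list, which makes it finite.
  module Configuration {m v} (V : Pred (Vector Carrier m) v) (points : List (Vector Carrier m))
           (listed : ∀ {x} → x ∈ᵤ V → x ∈ₗ points) (unlisted : ∀ {x} → x ∈ₗ points → x ∈ᵤ V) where

    private
      module _ (g h : AffineFunction F m) where

        Ratio : List (Vector Carrier m) → Set _
        Ratio xs = ∃ λ t → (∀ {x} → x ∈ₗ xs → t * value h x ⊑ value g x) ×
                   ∃ λ q → q ∈ₗ xs × ¬ value h q ≈ 0# × value g q ≈ t * value h q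

        ratio-list : ∀ xs → (∀ {x} → x ∈ₗ xs → 0# ⊑ value g x) → (∀ {x} → x ∈ₗ xs → 0# ⊑ value h x) →
                     (∀ {x} → x ∈ₗ xs → value h x ≈ 0#) ⊎ Ratio xs
        ratio-list [] g≥0 h≥0 = inj₁ λ ()
        ratio-list (x ∷ xs) g≥0 h≥0 with ratio-list xs (g≥0 ∘ there) (h≥0 ∘ there) | value h x ≈? 0#
        ... | inj₁ zeros | yes z = inj₁ λ { (here refl) → z ; (there i) → zeros i }
        ... | inj₂ (t , low , q , q∈ , h≉0 , eq) | yes z = inj₂ (t ,
          (λ { (here refl) → ≤-respˡ-≈ (≈-sym (≈-trans (*-congˡ z) (zeroʳ t))) (g≥0 (here refl)) ; (there i) →
              low i }) ,
          q , there q∈ , h≉0 , eq)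
        ... | inj₁ zeros | no x≉0 with inverse x≉0
        ...   | i , ix , _ = inj₂ (value g x * i ,
          (λ { (here refl) → ≤-reflexive (cancel-inverse ix)
             ; (there j) → ≤-respˡ-≈ (≈-sym (≈-trans (*-congˡ (zeros j)) (zeroʳ _))) (g≥0 (there j)) }) ,
          x , here refl , x≉0 , ≈-sym (cancel-inverse ix))
        ratio-list (x ∷ xs) g≥0 h≥0 | inj₂ (t , low , q , q∈ , h≉0 , eq) | no x≉0 with inverse x≉0
        ... | i , ix , _ with total t (value g x * i)
        ...   | inj₁ t≤s = inj₂ (t ,
          (λ { (here refl) → ≤-respʳ-≈ (cancel-inverse ix) (*-monoʳ-≤ (h≥0 (here refl)) t≤s) ; (there j) → low j }) ,
          q , there q∈ , h≉0 , eq)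
        ...   | inj₂ s≤t = inj₂ (value g x * i ,
          (λ { (here refl) → ≤-reflexive (cancel-inverse ix)
             ; (there j) → ≤-trans (*-monoʳ-≤ (h≥0 (there j)) s≤t) (low j) }) ,
          x , here refl , x≉0 , ≈-sym (cancel-inverse ix))

    -- A minimum ratio test: `t` is the least quotient of `g` by `h` over the points where `h` is
    -- nonzero, attained at `q`. The minimum exists because `V` is listed.
    ratio : ∀ g h → NonNegativeOn F V g → NonNegativeOn F V h → ¬ (V ⊆ᵤ Face F V h) →
            ∃ λ t → (∀ {x} → x ∈ᵤ V → t * value h x ⊑ value g x) ×
            ∃ λ q → q ∈ᵤ V × ¬ value h q ≈ 0# × value g q ≈ t * value h q
    ratio g h g≥0 h≥0 proper with ratio-list g h points (g≥0 ∘ unlisted) (h≥0 ∘ unlisted)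
    ... | inj₁ zeros = ⊥-elim (proper λ x∈ → x∈ , zeros (listed x∈))
    ... | inj₂ (t , low , q , q∈ , rest) = t , low ∘ listed , q , unlisted q∈ , rest

    module _ (g h : AffineFunction F m) {t : Carrier} where

      difference : AffineFunction F m
      difference = g ⊕ (- t) · h

      value-difference : ∀ x → value difference x ≈ value g x ⊖ t * value h x
      value-difference x = ≈-trans (value-⊕· g (- t) h x) (+-congˡ (≈-sym (-‿distribˡ-* t (value h x))))

      difference-nonNeg : (∀ {x} → x ∈ᵤ V → t * value h x ⊑ value g x) → NonNegativeOn F V difference
      difference-nonNeg low x∈ = ≤-respʳ-≈ (≈-sym (value-difference _)) (⊖-mono (low x∈))

      difference-zero : ∀ {x} → value g x ≈ t * value h x → value difference x ≈ 0#
      difference-zero {x} eq = ≈-trans (value-difference x) (≈-trans (+-congʳ eq) (-‿inverseʳ _))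

      difference-face : ∀ {x} → value g x ≈ 0# → value h x ≈ 0# → value difference x ≈ 0#
      difference-face {x} p q = difference-zero (≈-trans p (≈-sym (≈-trans (*-congˡ q) (zeroʳ t))))

    -- Subtract the largest multiple of h which leaves g nonnegative: the face of the
    -- difference contains that of g and one more point, so it is everything.
    proportional : ∀ {g h} → FacetDefining F V g → NonNegativeOn F V h → ¬ (V ⊆ᵤ Face F V h) →
                   Face F V g ⊆ᵤ Face F V h → ∃ λ t → ∀ {x} → x ∈ᵤ V → value g x ≈ t * value h x
    proportional {g} {h} (g≥0 , g-proper , maximal) h≥0 h-proper g⊆h
      with ratio g h g≥0 h≥0 h-proper
    ... | t , low , q , q∈ , h≉0 , eq = t , λ {x} x∈ →
      decidable-stable (value g x ≈? t * value h x) λ ≉ → h≉0 (proj₂ (g⊆h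
        (maximal (difference g h) (difference-nonNeg g h low)
          (λ all → ≉ (⊖≈0⇒≈ (≈-trans (≈-sym (value-difference g h x)) (proj₂ (all x∈)))))
          (λ (y∈ , gy) → y∈ , difference-face g h gy (proj₂ (g⊆h (y∈ , gy))))
          (q∈ , difference-zero g h eq))))

    private
      nonzero? : ∀ (l : AffineFunction F m) → Decidable (λ x → ¬ value l x ≈ 0#)
      nonzero? l x = ¬? (value l x ≈? 0#)

      defect : AffineFunction F m → ℕ
      defect l = length (filter (nonzero? l) points)

      defect-< : ∀ {l l′ q} → (∀ {x} → x ∈ᵤ V → value l x ≈ 0# → value l′ x ≈ 0#) →
                 q ∈ᵤ V → ¬ value l q ≈ 0# → value l′ q ≈ 0# → defect l′ < defect l
      defect-< {l} {l′} keep q∈ l≉0 l′≈0 = length-filter-< (nonzero? l) (nonzero? l′) points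
        (λ x∈ → _∘ keep (unlisted x∈)) (listed q∈) l≉0 (λ ≉ → ≉ l′≈0)

    -- If `l` fails to define a facet, some `l′` vanishes on strictly more points without vanishing
    -- everywhere. Either it is nonzero at `p` and replaces `l`, or it vanishes at `p`, and
    -- subtracting its largest admissible multiple from `l` gains a zero while keeping the value at
    -- `p`. The number of nonzero points drops in both cases.
    facet-through : ∀ {l p} → NonNegativeOn F V l → p ∈ᵤ V → ¬ value l p ≈ 0# →
      ¬ ¬ (∃ λ g → FacetDefining F V g × ¬ value g p ≈ 0# × Face F V l ⊆ᵤ Face F V g)
    facet-through {p = p} l≥0 p∈ l≉0 = go (<-wellFounded _) l≥0 l≉0
      where
      go : ∀ {l} → Acc _<_ (defect l) → NonNegativeOn F V l → ¬ value l p ≈ 0# →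
           ¬ ¬ (∃ λ g → FacetDefining F V g × ¬ value g p ≈ 0# × Face F V l ⊆ᵤ Face F V g)
      go {l} (acc rec) l≥0 l≉0 k = k (l ,
        (l≥0 , (λ all → l≉0 (proj₂ (all p∈))) , λ l′ l′≥0 l′-proper l⊆l′ {q} (q∈ , l′q) →
          q∈ , decidable-stable (value l q ≈? 0#) (λ lq → enlarge l′ l′≥0 l′-proper l⊆l′ q∈ l′q lq)) ,
        l≉0 , id)
        where
        enlarge : ∀ l′ → NonNegativeOn F V l′ → ¬ (V ⊆ᵤ Face F V l′) → Face F V l ⊆ᵤ Face F V l′ →
                  ∀ {q} → q ∈ᵤ V → value l′ q ≈ 0# → ¬ value l q ≈ 0# → ⊥
        enlarge l′ l′≥0 l′-proper l⊆l′ q∈ l′q lq with value l′ p ≈? 0#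
        ... | no l′≉0 = go (rec (defect-< {l} {l′} (λ x∈ lx → proj₂ (l⊆l′ (x∈ , lx))) q∈ lq l′q)) l′≥0 l′≉0
          λ (g , facet , g≉0 , l′⊆g) → k (g , facet , g≉0 , λ {x} l0 → l′⊆g {x} (l⊆l′ {x} l0))
        ... | yes l′p with ratio l l′ l≥0 l′≥0 l′-proper
        ...   | t , low , r , r∈ , l′r , eq = go
          (rec (defect-< {l} {difference l l′} keep r∈ (λ lr → l′r (proj₂ (l⊆l′ (r∈ , lr)))) (difference-zero l l′ eq)))
          (difference-nonNeg l l′ low)
          (λ z → l≉0 (≈-trans (⊖≈0⇒≈ (≈-trans (≈-sym (value-difference l l′ p)) z)) (≈-trans (*-congˡ l′p) (zeroʳ t))))
          λ (g , facet , g≉0 , d⊆g) → k (g , facet , g≉0 , λ {x} (x∈ , lx) → d⊆g {x} (x∈ , keep x∈ lx))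
          where
          keep : ∀ {x} → x ∈ᵤ V → value l x ≈ 0# → value (difference l l′ {t}) x ≈ 0#
          keep x∈ lx = difference-face l l′ lx (proj₂ (l⊆l′ (x∈ , lx)))

    private
      Covered : ℕ → List Carrier → Set _
      Covered k ys = ∃ λ (values : Vector Carrier k) → ∀ {y} → y ∈ₗ ys → ∃ λ i → y ≈ values i

      -- Greedy: one value is spent on the head of the list and on everything equal to it.
      covered? : ∀ k ys → Dec (Covered k ys)
      covered? zero []       = yes ((λ ()) , λ ())
      covered? zero (y ∷ ys) = no λ (_ , f) → Fin.¬Fin0 (proj₁ (f (here refl)))
      covered? (suc k) [] = yes ((λ _ → 0#) , λ ())
      covered? (suc k) (y ∷ ys) = map′ to from (covered? k (filter (λ z → ¬? (z ≈? y)) ys))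
        where
        others : Decidable (λ z → ¬ z ≈ y)
        others z = ¬? (z ≈? y)
        to : Covered k (filter others ys) → Covered (suc k) (y ∷ ys)
        to (values , f) = y ∷ᵥ values , λ { (here refl) → zero , ≈-refl ; (there m) → by m }
          where
          by : ∀ {z} → z ∈ₗ ys → ∃ λ i → z ≈ (y ∷ᵥ values) i
          by {z} m with z ≈? y
          ... | yes z≈y = zero , z≈y
          ... | no z≉y with f (∈-filter⁺ others m z≉y)
          ...   | i , eq = suc i , eq
        from : Covered (suc k) (y ∷ ys) → Covered k (filter others ys)
        from (values , f) with f (here refl)
        ... | j , y≈ = values ∘ punchIn j , λ m → by (∈-filter⁻ others {xs = ys} m)
          where
          by : ∀ {z} → z ∈ₗ ys × ¬ z ≈ y → ∃ λ i → z ≈ values (punchIn j i)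
          by (m , z≉y) with f (there m)
          ... | i , z≈ with j Fin.≟ i
          ...   | yes refl = contradiction (≈-trans z≈ (≈-sym y≈)) z≉y
          ...   | no j≢i = punchOut j≢i , ≈-trans z≈ (Eq.reflexive (cong values (sym (punchIn-punchOut j≢i))))

    -- This decidability lets levelness be concluded from a cone minor that exists only under a
    -- double negation.
    atMostValues? : ∀ k l → Dec (AtMostValues F V k l)
    atMostValues? k l = map′ to from (covered? k (map (value l) points))
      where
      to : Covered k (map (value l) points) → AtMostValues F V k l
      to (values , f) = values , λ x∈ → f (∈-map⁺ (value l) (listed x∈))
      from : AtMostValues F V k l → Covered k (map (value l) points)
      from (values , f) = values , λ m → by (∈-map⁻ (value l) m)
        where
        by : ∀ {y} → ∃ (λ x → x ∈ₗ points × y ≡ value l x) → ∃ λ i → y ≈ values i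
        by (x , m , refl) = f (unlisted m)

    distinct-values : ∀ {k n l} (p : Fin n → Vector Carrier m) → (∀ i → p i ∈ᵤ V) →
                      (∀ {i j} → value l (p i) ≈ value l (p j) → i ≡ j) → k < n → ¬ AtMostValues F V k l
    distinct-values p p∈ distinct k<n (values , f) with Fin.pigeonhole k<n (λ i → proj₁ (f (p∈ i)))
    ... | i , j , i<j , eq = Fin.<⇒≢ i<j (distinct
      (≈-trans (proj₂ (f (p∈ i))) (≈-trans (Eq.reflexive (cong values eq)) (≈-sym (proj₂ (f (p∈ j)))))))

-- The base configuration as a point set

module BaseConfiguration {c ℓ₁ ℓ₂} (F : OrderedField c ℓ₁ ℓ₂) (G : Graph) where
  open Ordered F public
  open GraphicMatroid G public
  open Walks G public
  open AffineFunction public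

  private
    bit : ∀ {n} → Subset n → Fin n → Carrier
    bit T i = if lookup T i then 1# else 0#

    weight : ∀ {n} → Vector Carrier n → Subset n → Carrier
    weight a T = sum (λ i → a i * bit T i)

    weight-add : ∀ {n} a {T : Subset n} {e} → e ∉ T → weight a (add T e) ≈ a e ⊕ weight a T
    weight-add a {inside ∷ T}  {zero}  e∉T = contradiction here e∉T
    weight-add a {outside ∷ T} {zero}  e∉T = ≈-trans (+-congʳ (*-identityʳ (a zero)))
      (+-congˡ (≈-sym (≈-trans (+-congʳ (zeroʳ (a zero))) (+-identityˡ _))))
    weight-add a {x ∷ T} {suc e} e∉T = ≈-trans (+-congˡ (weight-add (a ∘ suc) (e∉T ∘ there)))
      (≈-trans (≈-sym (+-assoc _ _ _)) (≈-trans (+-congʳ (+-comm _ _)) (+-assoc _ _ _)))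

    weight-del : ∀ {n} a {T : Subset n} {e} → e ∈ T → weight a T ≈ a e ⊕ weight a (del T e)
    weight-del a {inside ∷ T}  {zero}  here = ≈-trans (+-congʳ (*-identityʳ (a zero)))
      (+-congˡ (≈-sym (≈-trans (+-congʳ (zeroʳ (a zero))) (+-identityˡ _))))
    weight-del a {x ∷ T} {suc e} (there m) = ≈-trans (+-congˡ (weight-del (a ∘ suc) m))
      (≈-trans (≈-sym (+-assoc _ _ _)) (≈-trans (+-congʳ (+-comm _ _)) (+-assoc _ _ _)))

    minus-on : ∀ {n} → Subset n → Vector Carrier n
    minus-on A i = if lookup A i then - 1# else 0#

    weight-minus : ∀ {n} (T A : Subset n) → ι ∣ T ∩ A ∣ ⊕ weight (minus-on A) T ≈ 0#
    weight-minus []            []            = +-identityˡ 0#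
    weight-minus (inside ∷ T)  (inside ∷ A)  = ≈-trans (+-interchange 1# _ _ _)
      (≈-trans (+-cong (≈-trans (+-congˡ (*-identityʳ (- 1#))) (-‿inverseʳ 1#)) (weight-minus T A)) (+-identityˡ 0#))
    weight-minus (inside ∷ T)  (outside ∷ A) =
      ≈-trans (+-congˡ (≈-trans (+-congʳ (zeroˡ 1#)) (+-identityˡ _))) (weight-minus T A)
    weight-minus (outside ∷ T) (x ∷ A)       =
      ≈-trans (+-congˡ (≈-trans (+-congʳ (zeroʳ _)) (+-identityˡ _))) (weight-minus T A)

  V = baseConfiguration F G

  val : AffineFunction F size → Subset size → Carrier
  val l T = value l (indicator F G T)

  val-swap : ∀ l {T f e} → f ∈ T → e ∉ T → val l (swap T f e) ⊕ coefficient l f ≈ val l T ⊕ coefficient l e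
  val-swap (affine b a) {T} {f} {e} f∈T e∉T = ≈-trans (+-congʳ (+-congˡ (weight-add a (e∉T ∘ proj₁ ∘ ∈-del⁻))))
    (≈-trans (rearrange b (a e) (weight a (del T f)) (a f)) (+-congʳ (+-congˡ (≈-sym (weight-del a f∈T)))))
    where
    rearrange : ∀ b x w y → (b ⊕ (x ⊕ w)) ⊕ y ≈ (b ⊕ (y ⊕ w)) ⊕ x
    rearrange b x w y = ≈-trans (+-assoc b _ y) (≈-trans (+-congˡ
      (≈-trans (+-comm (x ⊕ w) y) (≈-trans (+-congˡ (+-comm x w)) (≈-sym (+-assoc y w x))))) (≈-sym (+-assoc b _ x)))

  -- The functional `r - x(A)`; with `r` the rank of `A`, its nonnegativity is the rank inequality
  -- of the base polytope.
  deficit : ℕ → Subset size → AffineFunction F size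
  deficit r A = affine (ι r) (minus-on A)

  ι-+ : ∀ m n → ι (m + n) ≈ ι m ⊕ ι n
  ι-+ zero    n = ≈-sym (+-identityˡ (ι n))
  ι-+ (suc m) n = ≈-trans (+-congˡ (ι-+ m n)) (≈-sym (+-assoc 1# (ι m) (ι n)))

  val-deficit : ∀ {r A T d} → ∣ T ∩ A ∣ + d ≡ r → val (deficit r A) T ≈ ι d
  val-deficit {r} {A} {T} {d} refl =
    ≈-trans (+-congʳ (≈-trans (ι-+ ∣ T ∩ A ∣ d) (+-comm _ _)))
    (≈-trans (+-assoc (ι d) _ _) (≈-trans (+-congˡ (weight-minus T A)) (+-identityʳ (ι d))))

  points : List (Vector Carrier size)
  points = map (indicator F G) bases

  listed : ∀ {x} → x ∈ᵤ V → x ∈ₗ points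
  listed (T , sf , refl) = ∈-map⁺ (indicator F G) (∈-bases⁺ (spanningForest⇒basis sf))

  unlisted : ∀ {x} → x ∈ₗ points → x ∈ᵤ V
  unlisted m with ∈-map⁻ (indicator F G) m
  ... | T , m′ , eq = T , basis⇒spanningForest (∈-bases⁻ m′) , eq

  open Configuration V points listed unlisted public

  vertex : ∀ {T} → Basis T → indicator F G T ∈ᵤ V
  vertex b = _ , basis⇒spanningForest b , refl

  trace-size-≤ : ∀ {A T T′} → Basis T → Covers T′ A → ∣ T ∩ A ∣ ≤ ∣ T′ ∩ A ∣
  trace-size-≤ {A} {T} (forest , _) sp =
    forest-size (forest-⊆ (proj₁ ∘ x∈p∩q⁻ T A) forest) (sp ∘ proj₂ ∘ x∈p∩q⁻ T A)

  trace-size-< : ∀ {A T T′ e} → Basis T → Covers T′ A → e ∈ A → ¬ Spans (T ∩ A) e → ∣ T ∩ A ∣ < ∣ T′ ∩ A ∣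
  trace-size-< {A} {T} (forest , _) sp e∈A ¬s =
    forest-size-< (forest-⊆ (proj₁ ∘ x∈p∩q⁻ T A) forest) (sp ∘ proj₂ ∘ x∈p∩q⁻ T A) ¬s (sp e∈A)

  deficit-nonNeg : ∀ {A T′} → Covers T′ A → NonNegativeOn F V (deficit ∣ T′ ∩ A ∣ A)
  deficit-nonNeg {A} {T′} sp (T , sf , refl) = ≤-respʳ-≈
    (≈-sym (val-deficit {A = A} {T} (ℕ.m+[n∸m]≡n (trace-size-≤ (spanningForest⇒basis sf) sp))))
        (0≤ι (∣ T′ ∩ A ∣ ∸ ∣ T ∩ A ∣))

minus≡del : ∀ {n} (p : Subset n) x → p - x ≡ del p x
minus≡del (y ∷ p) zero    = cong (outside ∷_) (p─⊥≡p p)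
minus≡del (y ∷ p) (suc x) = cong (y ∷_) (minus≡del p x)

⊈⇒∃ : ∀ {n} {p q : Subset n} → ¬ (p ⊆ q) → ∃ λ x → x ∈ p × x ∉ q
⊈⇒∃ {p = p} {q} p⊈q with any? (λ x → (x ∈? p) ×-dec ¬? (x ∈? q))
... | yes w   = w
... | no none = ⊥-elim (p⊈q λ {x} x∈p → inside-q x x∈p)
  where
  inside-q : ∀ x → x ∈ p → x ∈ q
  inside-q x x∈p with x ∈? q
  ... | yes x∈q = x∈q
  ... | no x∉q  = contradiction (x , x∈p , x∉q) none

⊆-of-size : ∀ {n} {p q : Subset n} → p ⊆ q → ∣ q ∣ ≤ ∣ p ∣ → q ⊆ p
⊆-of-size {p = p} {q} p⊆q q≤p {x} x∈q with x ∈? p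
... | yes x∈p = x∈p
... | no x∉p  = contradiction (p⊂q⇒∣p∣<∣q∣ {p = p} {q} (p⊆q , x , x∈q , x∉p)) (ℕ.≤⇒≯ q≤p)

module _ (G : Graph) where
  open Graph G

  exit : ∀ {ℓ X T u v} {P : Vertex → Set ℓ} → Decidable P → Walk X T u v → P u → ¬ P v →
         ∃₂ λ a b → P a × ¬ P b × a ∈ X × b ∈ X × ∃ λ e → e ∈ T × Joins e a b
  exit P? ε pu ¬pv = contradiction pu ¬pv
  exit P? (_◅_ {i = u} {j = w} (u∈ , w∈ , e , e∈ , j) walk) pu ¬pv with P? w
  ... | yes pw = exit P? walk pw ¬pv
  ... | no ¬pw = u , w , pu , ¬pw , u∈ , w∈ , e , e∈ , j

-- From cone minors to facets with many values

module ConeMinor (H G : Graph) (minor : cone H ≼ G) where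
  open GraphicMatroid G
  open Walks G
  open _≼_ minor

  private module H = Graph H

  abstract
    private
      Realized : H.Edge ⊎ H.Vertex → Set
      Realized s = ∃₂ λ u v → u ∈ branch (coneEnd₁ H s) × v ∈ branch (coneEnd₂ H s) × ∃ λ f → Joins f u v

      realized : ∀ s → Realized s
      realized (inj₁ e) = subst Realized (splitAt-↑ˡ H.size e H.order) (edge (e ↑ˡ H.order))
      realized (inj₂ v) = subst Realized (splitAt-↑ʳ H.size H.order v) (edge (H.size ↑ʳ v))

    rim : H.Edge → Edge
    rim e = proj₁ (proj₂ (proj₂ (proj₂ (proj₂ (realized (inj₁ e))))))

    spoke : H.Vertex → Edge
    spoke v = proj₁ (proj₂ (proj₂ (proj₂ (proj₂ (realized (inj₂ v))))))

    hub foot : H.Vertex → Vertex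
    hub v  = proj₁ (realized (inj₂ v))
    foot v = proj₁ (proj₂ (realized (inj₂ v)))

    hub∈ : ∀ v → hub v ∈ branch zero
    hub∈ v = proj₁ (proj₂ (proj₂ (realized (inj₂ v))))

    foot∈ : ∀ v → foot v ∈ branch (suc v)
    foot∈ v = proj₁ (proj₂ (proj₂ (proj₂ (realized (inj₂ v)))))

    spoke-joins : ∀ v → Joins (spoke v) (hub v) (foot v)
    spoke-joins v = proj₂ (proj₂ (proj₂ (proj₂ (proj₂ (realized (inj₂ v))))))

    rim-joins : ∀ {e x y} → H.Joins e x y → ∃₂ λ a b → a ∈ branch (suc x) × b ∈ branch (suc y) × Joins (rim e) a b
    rim-joins {e} (inj₁ (refl , refl)) with realized (inj₁ e)
    ... | a , b , a∈ , b∈ , _ , j = a , b , a∈ , b∈ , j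
    rim-joins {e} (inj₂ (refl , refl)) with realized (inj₁ e)
    ... | a , b , a∈ , b∈ , _ , j = b , a , b∈ , a∈ , joins-sym j

    same-branch : ∀ {i j x} → x ∈ branch i → x ∈ branch j → i ≡ j
    same-branch {i} {j} x∈i x∈j with i ≟ j
    ... | yes i≡j = i≡j
    ... | no i≢j  = contradiction (_ , x∈p∩q⁺ (x∈i , x∈j)) (disjoint i≢j)

    private
      Internal Spoke Rim : Edge → Set
      Internal e = ∃ λ i → end₁ e ∈ branch i × end₂ e ∈ branch i
      Spoke e    = ∃ λ v → spoke v ≡ e
      Rim e      = ∃ λ f → rim f ≡ e

      internal? : ∀ e → Dec (Internal e)
      internal? e = any? λ i → (end₁ e ∈? branch i) ×-dec (end₂ e ∈? branch i)

      spoke? : ∀ e → Dec (Spoke e)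
      spoke? e = any? λ v → spoke v ≟ e

      rim? : ∀ e → Dec (Rim e)
      rim? e = any? λ f → rim f ≟ e

      internal-joins : ∀ {e u v} → Internal e → Joins e u v → ∃ λ i → u ∈ branch i × v ∈ branch i
      internal-joins w            (inj₁ (refl , refl)) = w
      internal-joins (i , p , q) (inj₂ (refl , refl)) = i , q , p

      spoke-not-internal : ∀ v → ¬ Internal (spoke v)
      spoke-not-internal v int with internal-joins int (spoke-joins v)
      ... | i , p , q with same-branch p (hub∈ v) | same-branch q (foot∈ v)
      ... | refl | ()

      spoke-injective : ∀ {v w} → spoke v ≡ spoke w → v ≡ w
      spoke-injective {v} {w} eq with joins-end {spoke w} (joins-sym {spoke w}
          (subst (λ e → Joins e (hub v) (foot v)) eq (spoke-joins v))) (spoke-joins w)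
      ... | inj₁ p = contradiction (same-branch (foot∈ v) (subst (_∈ branch zero) (sym p) (hub∈ w))) λ ()
      ... | inj₂ p = suc-injective (same-branch (foot∈ v) (subst (_∈ branch (suc w)) (sym p) (foot∈ w)))

      spoke≢rim : ∀ v e → spoke v ≢ rim e
      spoke≢rim v e eq with rim-joins {e} (inj₁ (refl , refl))
      ... | a , b , a∈ , b∈ , j with joins-end (subst (λ e → Joins e (hub v) (foot v)) eq (spoke-joins v)) j
      ...   | inj₁ p = contradiction (same-branch (hub∈ v) (subst (_∈ _) (sym p) a∈)) λ ()
      ...   | inj₂ p = contradiction (same-branch (hub∈ v) (subst (_∈ _) (sym p) b∈)) λ ()

      internals skeleton : Subset size
      internals = select internal?
      skeleton  = select (λ e → internal? e ⊎-dec spoke? e)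

      -- The base is built in three layers, each extending the previous forest: internal edges, then
      -- spokes, then all edges. Thus the branch sets are connected inside it, and no spoke is lost
      -- to a rim edge.
      internals-span : ∃ λ B → Forest B × Subset.⊥ ⊆ B × B ⊆ internals × (∀ {e} → e ∈ internals → Spans B e)
      internals-span = extend {I = Subset.⊥} {D = internals} (λ m → contradiction m ∉⊥) (λ m → contradiction m ∉⊥)

      C₁ : Subset size
      C₁ = proj₁ internals-span

      C₁-internal : ∀ {e} → e ∈ C₁ → Internal e
      C₁-internal m = ∈-select⁻ internal? (proj₁ (proj₂ (proj₂ (proj₂ internals-span))) m)

      C₁-link : ∀ {i u v} → u ∈ branch i → v ∈ branch i → Link C₁ u v
      C₁-link {i} u∈ v∈ = link-map (proj₂ (proj₂ (proj₂ (proj₂ internals-span))))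
        (walk⇒link (λ (_ , p , q) → ∈-select⁺ internal? (i , p , q)) (proj₂ (connected i) u∈ v∈))

      skeleton-span : ∃ λ B → Forest B × C₁ ⊆ B × B ⊆ skeleton × (∀ {e} → e ∈ skeleton → Spans B e)
      skeleton-span = extend {D = skeleton} (proj₁ (proj₂ internals-span))
        (λ m → ∈-select⁺ (λ e → internal? e ⊎-dec spoke? e) (inj₁ (C₁-internal m)))

      B₁ : Subset size
      B₁ = proj₁ skeleton-span

      -- Deleting a spoke from the skeleton separates the branch set at its foot from the rest.
      spoke∈B₁ : ∀ v → spoke v ∈ B₁
      spoke∈B₁ v with spoke v ∈? B₁
      ... | yes m = m
      ... | no ∉B = contradiction (same-branch (hub∈ v) (link-closed {P = _∈ branch (suc v)} closed
              (joins-link′ (proj₂ (proj₂ (proj₂ (proj₂ skeleton-span)))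
                (∈-select⁺ (λ e → internal? e ⊎-dec spoke? e) (inj₂ (v , refl))))) (foot∈ v))) λ ()
        where
        joins-link′ : Spans B₁ (spoke v) → Link B₁ (foot v) (hub v)
        joins-link′ s = joins-link s (joins-sym (spoke-joins v))
        closed : ∀ {e} → e ∈ B₁ → (end₁ e ∈ branch (suc v) → end₂ e ∈ branch (suc v)) ×
            (end₂ e ∈ branch (suc v) → end₁ e ∈ branch (suc v))
        closed m with ∈-select⁻ (λ e → internal? e ⊎-dec spoke? e) (proj₁ (proj₂ (proj₂ (proj₂ skeleton-span))) m)
        ... | inj₁ (i , p , q) = (λ p′ → subst (λ j → _ ∈ branch j) (same-branch p p′) q) ,
            (λ q′ → subst (λ j → _ ∈ branch j) (same-branch q q′) p)
        ... | inj₂ (w , refl) = (λ p → ⊥-elim (away (inj₁ (refl , refl)) p)) ,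
            (λ q → ⊥-elim (away (inj₂ (refl , refl)) q))
          where
          away : ∀ {x y} → Joins (spoke w) x y → ¬ x ∈ branch (suc v)
          away j x∈ with joins-end j (spoke-joins w)
          ... | inj₁ refl = contradiction (same-branch x∈ (hub∈ w)) λ ()
          ... | inj₂ refl with same-branch x∈ (foot∈ w)
          ...   | refl = ∉B m

      full-span : ∃ λ B → Forest B × B₁ ⊆ B × B ⊆ ⊤ × (∀ {e} → e ∈ ⊤ → Spans B e)
      full-span = extend {D = ⊤} (proj₁ (proj₂ skeleton-span)) (λ _ → ∈⊤)

    T₀ : Subset size
    T₀ = proj₁ full-span

    T₀-basis : Basis T₀
    T₀-basis = proj₁ (proj₂ full-span) , λ e → proj₂ (proj₂ (proj₂ (proj₂ full-span))) ∈⊤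

    spoke∈T₀ : ∀ v → spoke v ∈ T₀
    spoke∈T₀ v = proj₁ (proj₂ (proj₂ full-span)) (spoke∈B₁ v)

    private
      C? : Decidable (λ e → e ∈ T₀ × ¬ Spoke e)
      C? e = (e ∈? T₀) ×-dec ¬? (spoke? e)

    -- Besides the trees of the branch sets this keeps all edges of `T₀` elsewhere in `G`, so that
    -- the later exchanges concern only spokes and rim edges.
    C : Subset size
    C = select C?

    C⊆T₀ : C ⊆ T₀
    C⊆T₀ = proj₁ ∘ ∈-select⁻ C?

    spoke∉C : ∀ v → spoke v ∉ C
    spoke∉C v m = proj₂ (∈-select⁻ C? m) (v , refl)

    branch-link : ∀ {i u v} → u ∈ branch i → v ∈ branch i → Link C u v
    branch-link u∈ v∈ = link-mono
      (λ m → ∈-select⁺ C? (proj₁ (proj₂ (proj₂ full-span)) (proj₁ (proj₂ (proj₂ skeleton-span)) m) ,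
        λ { (v , refl) → spoke-not-internal v (C₁-internal m) }))
      (C₁-link u∈ v∈)

    private
      -- Such a link, continued through the apex branch and, if need be, down the spoke of the other
      -- branch set, would bypass the spoke of `v` inside the forest `T₀`.
      separated-suc : ∀ {v j x y} → x ∈ branch (suc v) → y ∈ branch j → Link C x y → suc v ≢ j → ⊥
      separated-suc {v} {j} {x} {y} x∈ y∈ l ne = proj₁ T₀-basis (spoke∈T₀ v)
          (joins-span (back (to-hub j y∈ ne)) (spoke-joins v))
        where
        C⊆ : C ⊆ del T₀ (spoke v)
        C⊆ m = ∈-del⁺ (C⊆T₀ m) λ { refl → spoke∉C v m }
        via : ∀ {i a b} → a ∈ branch i → b ∈ branch i → Link (del T₀ (spoke v)) a b
        via a∈ b∈ = link-mono C⊆ (branch-link a∈ b∈)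
        to-hub : ∀ j → y ∈ branch j → suc v ≢ j → Link (del T₀ (spoke v)) (foot v) (hub v)
        to-hub zero    y∈ ne = via (foot∈ v) x∈ ∙ link-mono C⊆ l ∙ via y∈ (hub∈ v)
        to-hub (suc w) y∈ ne = via (foot∈ v) x∈ ∙ link-mono C⊆ l ∙ via y∈ (foot∈ w) ∙
          back (joins-link (span (∈-del⁺ (spoke∈T₀ w) λ eq → ne (cong suc (sym (spoke-injective eq)))))
              (spoke-joins w)) ∙
          via (hub∈ w) (hub∈ v)

    separated : ∀ {i j x y} → x ∈ branch i → y ∈ branch j → Link C x y → i ≡ j
    separated {zero}  {zero}  x∈ y∈ l = refl
    separated {zero}  {suc w} x∈ y∈ l = ⊥-elim (separated-suc y∈ x∈ (back l) λ ())
    separated {suc v} {j}     x∈ y∈ l with suc v ≟ j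
    ... | yes eq = eq
    ... | no ne  = ⊥-elim (separated-suc x∈ y∈ l ne)

    private
      A? : Decidable (λ e → e ∈ C ⊎ Rim e)
      A? e = (e ∈? C) ⊎-dec rim? e

    A : Subset size
    A = select A?

    C⊆A : C ⊆ A
    C⊆A = ∈-select⁺ A? ∘ inj₁

    rim∈A : ∀ e → rim e ∈ A
    rim∈A e = ∈-select⁺ A? (inj₂ (e , refl))

    ∈A⁻ : ∀ {e} → e ∈ A → e ∈ C ⊎ ∃ λ f → rim f ≡ e
    ∈A⁻ = ∈-select⁻ A?

    spoke∉A : ∀ v → spoke v ∉ A
    spoke∉A v m with ∈A⁻ m
    ... | inj₁ m′       = spoke∉C v m′
    ... | inj₂ (e , eq) = spoke≢rim v e (sym eq)

    -- Within `A`, the base `T₀` retains only `C`, which separates the branch sets that a rim edge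
    -- joins. Hence the deficit of `A` is positive at `T₀`.
    rim-unspanned : ∀ e → ¬ Spans (T₀ ∩ A) (rim e)
    rim-unspanned e s with rim-joins {e} (inj₁ (refl , refl))
    ... | a , b , a∈ , b∈ , j = H.noLoops e (suc-injective (separated a∈ b∈ (joins-link (link-mono T₀∩A⊆C s) j)))
      where
      T₀∩A⊆C : T₀ ∩ A ⊆ C
      T₀∩A⊆C m = ∈-select⁺ C? (proj₁ (x∈p∩q⁻ T₀ A m) , λ { (v , refl) → spoke∉A v (proj₂ (x∈p∩q⁻ T₀ A m)) })

  -- A base between the star and a tree: `Y` has been gathered around `root` by rim edges, while
  -- each vertex outside `Y` still hangs on its spoke. The spoke of `root` stays throughout and
  -- keeps `Y` attached to the apex.
  record Stage (root : H.Vertex) (Y : Subset H.order) (T : Subset size) : Set where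
    field
      basis    : Basis T
      C⊆       : C ⊆ T
      root∈    : root ∈ Y
      rooted   : spoke root ∈ T
      spokes   : ∀ {v} → v ∉ Y → spoke v ∈ T
      together : ∀ {v} → v ∈ Y → Link (T ∩ A) (foot v) (foot root)

  open Stage

  stage₀ : ∀ v → Stage v ⁅ v ⁆ T₀
  stage₀ v = record
    { basis    = T₀-basis
    ; C⊆       = C⊆T₀
    ; root∈    = x∈⁅x⁆ v
    ; rooted   = spoke∈T₀ v
    ; spokes   = λ _ → spoke∈T₀ _
    ; together = λ m → subst (λ w → Link (T₀ ∩ A) (foot w) (foot v)) (sym (x∈⁅y⁆⇒x≡y v m)) stop
    }

  module _ {root Y T} (st : Stage root Y T) where

    covers : (∀ v → v ∈ Y) → ∀ {e} → e ∈ A → Spans (T ∩ A) e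
    covers all {e} m with ∈A⁻ m
    ... | inj₁ e∈C = span (x∈p∩q⁺ (C⊆ st e∈C , m))
    ... | inj₂ (f , refl) with rim-joins {f} (inj₁ (refl , refl))
    ...   | a , b , a∈ , b∈ , j = joins-span
      (lift (branch-link a∈ (foot∈ _)) ∙ together st (all _) ∙ back (together st (all _)) ∙
          lift (branch-link (foot∈ _) b∈)) j
      where
      lift : ∀ {u v} → Link C u v → Link (T ∩ A) u v
      lift = link-mono λ m → x∈p∩q⁺ (C⊆ st m , C⊆A m)

    module _ {v e} (v∉Y : v ∉ Y) {y} (y∈Y : y ∈ Y) (e-joins : H.Joins e y v) where

      private
        T′ : Subset size
        T′ = swap T (spoke v) (rim e)

        keep : ∀ {x} → x ∈ T → x ≢ spoke v → x ∈ T′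
        keep m ne = ∈-add⁺ (∈-del⁺ m ne)

        keep-C : ∀ {x} → x ∈ C → x ∈ T′
        keep-C m = keep (C⊆ st m) λ { refl → spoke∉C v m }

        keep-A : T ∩ A ⊆ T′ ∩ A
        keep-A m = x∈p∩q⁺ (keep (proj₁ (x∈p∩q⁻ T A m)) (λ { refl → spoke∉A v (proj₂ (x∈p∩q⁻ T A m)) }) ,
            proj₂ (x∈p∩q⁻ T A m))

        lift : ∀ {a b} → Link C a b → Link (T′ ∩ A) a b
        lift = link-mono λ m → x∈p∩q⁺ (keep-C m , C⊆A m)

        attach : Link (T′ ∩ A) (foot v) (foot root)
        attach with rim-joins {e} e-joins
        ... | a , b , a∈ , b∈ , j = lift (branch-link (foot∈ v) b∈) ∙
          back (joins-link (span (x∈p∩q⁺ (∈-add _ _ , rim∈A e))) j) ∙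
          lift (branch-link a∈ (foot∈ y)) ∙ link-mono keep-A (together st y∈Y)

        root-kept : spoke root ∈ T′
        root-kept = keep (rooted st) λ eq → v∉Y (subst (_∈ Y) (spoke-injective eq) (root∈ st))

        -- The cycle: from the hub of `v` to that of `root`, down the kept spoke, and within `A`
        -- back to the foot of `v`.
        spanned : Spans T′ (spoke v)
        spanned = joins-span (lift′ (branch-link (hub∈ v) (hub∈ root)) ∙
            joins-link (span root-kept) (spoke-joins root) ∙
          back (link-mono (proj₁ ∘ x∈p∩q⁻ T′ A) attach)) (spoke-joins v)
          where
          lift′ : ∀ {a b} → Link C a b → Link T′ a b
          lift′ = link-mono keep-C

        swapped : rim e ∉ T × Basis T′
        swapped = basis-swap (basis st) (spokes st v∉Y) (spoke≢rim v e) spanned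

      rim∉ : rim e ∉ T
      rim∉ = proj₁ swapped

      stage-step : Stage root (add Y v) T′
      stage-step = record
        { basis    = proj₂ swapped
        ; C⊆       = keep-C
        ; root∈    = ∈-add⁺ (root∈ st)
        ; rooted   = root-kept
        ; spokes   = λ w∉ → keep (spokes st (w∉ ∘ ∈-add⁺)) λ eq →
            w∉ (subst (_∈ add Y v) (sym (spoke-injective eq)) (∈-add Y v))
        ; together = λ m → [ link-mono keep-A ∘ together st , (λ { refl → attach }) ]′ (∈-add⁻ m)
        }

    -- Once all feet are linked, any spoke can take the place of that of `root` without loss in the
    -- trace on `A`. Both bases then lie on the face, which will equate the coefficients of the two
    -- spokes.
    root-swap : (∀ v → v ∈ Y) → ∀ {v} → v ≢ root →
                spoke v ∉ T × Basis (swap T (spoke root) (spoke v)) × T ∩ A ⊆ swap T (spoke root) (spoke v) ∩ A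
    root-swap all {v} v≢root = proj₁ swapped , proj₂ swapped , keep-A
      where
      T′ : Subset size
      T′ = swap T (spoke root) (spoke v)
      keep-A : T ∩ A ⊆ T′ ∩ A
      keep-A m = x∈p∩q⁺ (∈-add⁺ (∈-del⁺ (proj₁ (x∈p∩q⁻ T A m)) λ { refl → spoke∉A root (proj₂ (x∈p∩q⁻ T A m)) })
          , proj₂ (x∈p∩q⁻ T A m))
      lift : ∀ {a b} → Link (T ∩ A) a b → Link T′ a b
      lift = link-mono (proj₁ ∘ x∈p∩q⁻ T′ A ∘ keep-A)
      lift-C : ∀ {a b} → Link C a b → Link T′ a b
      lift-C = lift ∘ link-mono λ m → x∈p∩q⁺ (C⊆ st m , C⊆A m)
      swapped : spoke v ∉ T × Basis T′
      swapped = basis-swap (basis st) (rooted st) (v≢root ∘ sym ∘ spoke-injective)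
        (joins-span (lift-C (branch-link (hub∈ root) (hub∈ v)) ∙ joins-link (span (∈-add _ _)) (spoke-joins v) ∙
            lift (together st (all v))) (spoke-joins root))

-- Values of a facet functional along the exchanges

module LevelsFromMinor {c ℓ₁ ℓ₂} (F : OrderedField c ℓ₁ ℓ₂) (H G : Graph) (minor : cone H ≼ G) where
  open BaseConfiguration F G
  open ConeMinor H G minor
  private module H = Graph H
  open RingProperties ring using (+-cancelˡ)

  -- Here `j` counts the exchanges of a spoke for a rim edge. Quantifying over `l` makes the
  -- construction of bases independent of the facet.
  Swaps : ℕ → Subset size → Set _
  Swaps j T = ∀ l {α β} → (∀ e → coefficient l (rim e) ≈ α) → (∀ v → coefficient l (spoke v) ≈ β) →
              val l T ≈ val l T₀ ⊕ ι j * (α ⊖ β)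

  swaps-step : ∀ {j T v e} → Swaps j T → spoke v ∈ T → rim e ∉ T → Swaps (suc j) (swap T (spoke v) (rim e))
  swaps-step {j} {T} {v} {e} sw v∈T e∉T l {α} {β} rims spokes =
    ≈-trans (≈-sym (⊕⊖-cancel β (val l T′)))
    (≈-trans (+-congʳ (≈-trans (+-congˡ (≈-sym (spokes v))) (≈-trans (val-swap l v∈T e∉T)
        (+-cong (sw l rims spokes) (rims e)))))
    (≈-trans (+-assoc _ α (- β)) (≈-trans (+-assoc _ _ _) (+-congˡ
    (≈-trans (+-comm _ _) (≈-sym (≈-trans (distribʳ (α ⊖ β) 1# (ι j)) (+-congʳ (*-identityˡ _)))))))))
    where
    T′ : Subset size
    T′ = swap T (spoke v) (rim e)

  -- A general connected `W` is allowed, since comparing rim coefficients takes a tree of `H` minus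
  -- a vertex.
  grow : ∀ {W root} → (∀ {u v} → u ∈ W → v ∈ W → H.Walk W ⊤ u v) → root ∈ W → ∀ j → j < ∣ W ∣ →
         ∃₂ λ Y T → ∣ Y ∣ ≡ suc j × Y ⊆ W × Stage root Y T × Swaps j T
  grow {W} {root} conn root∈ zero j< = ⁅ root ⁆ , T₀ , ∣⁅x⁆∣≡1 root ,
    (λ m → subst (_∈ W) (sym (x∈⁅y⁆⇒x≡y root m)) root∈) , stage₀ root ,
    λ l _ _ → ≈-sym (≈-trans (+-congˡ (zeroˡ _)) (+-identityʳ _))
  grow {W} conn root∈ (suc j) j< with grow conn root∈ j (ℕ.<⇒≤ j<)
  ... | Y , T , size≡ , Y⊆W , st , sw with ⊈⇒∃ {p = W} {Y} (λ W⊆Y → ℕ.<⇒≱ j< (subst (∣ W ∣ ≤_) size≡ (p⊆q⇒∣p∣≤∣q∣ W⊆Y)))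
  ...   | z , z∈W , z∉Y with exit H (_∈? Y) (conn root∈ z∈W) (Stage.root∈ st) z∉Y
  ...     | y , v , y∈Y , v∉Y , y∈W , v∈W , e , _ , joins = add Y v , swap T (spoke v) (rim e) ,
    trans (∣add∣ v∉Y) (cong suc size≡) ,
    (λ m → [ Y⊆W , (λ { refl → v∈W }) ]′ (∈-add⁻ m)) ,
    stage-step st v∉Y y∈Y joins ,
    swaps-step {j} sw (Stage.spokes st v∉Y) (rim∉ st v∉Y y∈Y joins)

  grow-all : ∀ {W root} → (∀ {u v} → u ∈ W → v ∈ W → H.Walk W ⊤ u v) → root ∈ W →
             ∃₂ λ Y T → Y ⊆ W × W ⊆ Y × Stage root Y T
  grow-all {W} {root} conn root∈ with ∣ W ∣ in eq | p⊆q⇒∣p∣≤∣q∣ {p = ⁅ root ⁆} {W}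
      (λ m → subst (_∈ W) (sym (x∈⁅y⁆⇒x≡y root m)) root∈)
  ... | zero  | le = contradiction (ℕ.≤-trans (ℕ.≤-reflexive (sym (∣⁅x⁆∣≡1 root))) le) λ ()
  ... | suc j | le with grow conn root∈ j (ℕ.≤-reflexive (sym eq))
  ...   | Y , T , size≡ , Y⊆W , st , _ = Y , T , Y⊆W , ⊆-of-size Y⊆W (ℕ.≤-reflexive (trans eq (sym size≡))) , st

  module _ (biconnected : H.Biconnected ⊤) {root next : H.Vertex} (root≢next : root ≢ next) where

    private
      full : ∃₂ λ Y T → Y ⊆ ⊤ × ⊤ ⊆ Y × Stage root Y T
      full = grow-all (proj₂ (proj₁ biconnected)) ∈⊤

      Tₖ : Subset size
      Tₖ = proj₁ (proj₂ full)

      stₖ : Stage root (proj₁ full) Tₖ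
      stₖ = proj₂ (proj₂ (proj₂ (proj₂ full)))

      everywhere : ∀ v → v ∈ proj₁ full
      everywhere v = proj₁ (proj₂ (proj₂ (proj₂ full))) ∈⊤

      Tₖ-covers : Covers Tₖ A
      Tₖ-covers = covers stₖ everywhere

      l : AffineFunction F size
      l = deficit ∣ Tₖ ∩ A ∣ A

      rim₀ : H.Edge
      rim₀ with exit H (_≟ root) (proj₂ (proj₁ biconnected) ∈⊤ ∈⊤) refl (root≢next ∘ sym)
      ... | _ , _ , _ , _ , _ , _ , e , _ = e

      l-T₀ : ¬ val l T₀ ≈ 0#
      l-T₀ z with ℕ.m≤n⇒∃[o]m+o≡n (trace-size-< T₀-basis Tₖ-covers (rim∈A rim₀) (rim-unspanned rim₀))
      ... | d , eq = ι-suc≉0 d (≈-trans (≈-sym (val-deficit {A = A} {T₀} {suc d} (trans (ℕ.+-suc ∣ T₀ ∩ A ∣ d) eq))) z)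

      l-zero : ∀ {T} → Basis T → Covers T A → val l T ≈ 0#
      l-zero {T} b cov = val-deficit {A = A} {T} {0} (trans (ℕ.+-identityʳ _)
        (ℕ.≤-antisym (trace-size-≤ b Tₖ-covers) (trace-size-≤ (Stage.basis stₖ) cov)))

    module _ {g} (g-T₀ : ¬ val g T₀ ≈ 0#) (l⊆g : Face F V l ⊆ᵤ Face F V g) where

      private
        g-zero : ∀ {T} → Basis T → Covers T A → val g T ≈ 0#
        g-zero b cov = proj₂ (l⊆g (vertex b , l-zero b cov))

        β : Carrier
        β = coefficient g (spoke root)

        spokes-equal : ∀ v → coefficient g (spoke v) ≈ β
        spokes-equal v with v ≟ root
        ... | yes refl = ≈-refl
        ... | no v≢root with root-swap stₖ everywhere v≢root
        ...   | v∉T , basis′ , keep = ≈-sym (+-cancelˡ 0# _ _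
          (≈-trans (+-congʳ (≈-sym (g-zero basis′ (link-mono keep ∘ Tₖ-covers))))
          (≈-trans (val-swap g (Stage.rooted stₖ) v∉T) (+-congʳ (g-zero (Stage.basis stₖ) Tₖ-covers)))))

        -- Both edges complete a spanning tree of H - v to one of H.
        rims-at : ∀ v {a b e f} → H.Joins e v a → H.Joins f v b → coefficient g (rim e) ≈ coefficient g (rim f)
        rims-at v {a} {b} {e} {f} ja jb = +-cancelˡ (val g T) _ _ (≈-trans (≈-sym (by e a ja)) (by f b jb))
          where
          H-v : ∀ {x y} → x ∈ del ⊤ v → y ∈ del ⊤ v → H.Walk (del ⊤ v) ⊤ x y
          H-v = subst (λ X → ∀ {x y} → x ∈ X → y ∈ X → H.Walk X ⊤ x y) (minus≡del ⊤ v) (proj₂ (proj₂ biconnected v))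
          other : ∀ {e a} → H.Joins e v a → a ≢ v
          other {e} (inj₁ (refl , refl)) eq = H.noLoops e (sym eq)
          other {e} (inj₂ (refl , refl)) eq = H.noLoops e eq
          tree : ∃₂ λ Y T → Y ⊆ del ⊤ v × del ⊤ v ⊆ Y × Stage a Y T
          tree = grow-all H-v (∈-del⁺ ∈⊤ (other {e} ja))
          Y : Subset H.order
          Y = proj₁ tree
          T : Subset size
          T = proj₁ (proj₂ tree)
          st : Stage a Y T
          st = proj₂ (proj₂ (proj₂ (proj₂ tree)))
          v∉Y : v ∉ Y
          v∉Y m = proj₂ (∈-del⁻ (proj₁ (proj₂ (proj₂ tree)) m)) refl
          all : ∀ w → w ∈ add Y v
          all w with w ≟ v
          ... | yes refl = ∈-add Y w
          ... | no w≢v     = ∈-add⁺ (proj₁ (proj₂ (proj₂ (proj₂ tree))) (∈-del⁺ ∈⊤ w≢v))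
          by : ∀ e x → H.Joins e v x → 0# ⊕ coefficient g (spoke v) ≈ val g T ⊕ coefficient g (rim e)
          by e x j = ≈-trans (+-congʳ (≈-sym (g-zero (Stage.basis st′) (covers st′ all))))
            (val-swap g (Stage.spokes st v∉Y) (rim∉ st v∉Y x∈Y j′))
            where
            j′ : H.Joins e x v
            j′ = Walks.joins-sym H {e} j
            x∈Y : x ∈ Y
            x∈Y = proj₁ (proj₂ (proj₂ (proj₂ tree))) (∈-del⁺ ∈⊤ (other {e} j))
            st′ : Stage a (add Y v) (swap T (spoke v) (rim e))
            st′ = stage-step st v∉Y x∈Y j′

        α : Carrier
        α = coefficient g (rim rim₀)

        -- Rim edges sharing an end agree by `rims-at`; a walk in `H` carries this from `rim₀` to
        -- `e`.
        rims-equal : ∀ e → coefficient g (rim e) ≈ α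
        rims-equal e = go (proj₂ (proj₁ biconnected) {H.end₁ rim₀} {H.end₁ e} ∈⊤ ∈⊤)
          (λ f j → rims-at (H.end₁ rim₀) {e = f} {rim₀} j (inj₁ (refl , refl))) e (inj₁ (refl , refl))
          where
          go : ∀ {u v} → H.Walk ⊤ ⊤ u v → (∀ f {y} → H.Joins f u y → coefficient g (rim f) ≈ α) →
               ∀ f {y} → H.Joins f v y → coefficient g (rim f) ≈ α
          go ε p = p
          go {u} (_◅_ {j = w} (_ , _ , e , _ , j) walk) p =
            go walk λ f j′ → ≈-trans (rims-at w {e = f} {e} j′ (Walks.joins-sym H {e} j)) (p e j)

        γ : Carrier
        γ = α ⊖ β

        -- After `pred H.order` exchanges all vertices are gathered and `g` vanishes. If exchanges
        -- did not change the value, `g` would vanish at `T₀` as well.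
        γ≉0 : ¬ γ ≈ 0#
        γ≉0 γ≈0 with grow {⊤} {root} (proj₂ (proj₁ biconnected)) ∈⊤ (pred H.order) small
          where
          small : pred H.order < ∣ ⊤ {H.order} ∣
          small = subst (pred H.order <_) (sym (∣⊤∣≡n H.order)) (pred< root)
            where
            pred< : ∀ {n} → Fin n → pred n < n
            pred< {suc n} _ = ℕ.≤-refl
        ... | Y , T , size≡ , _ , st , sw = g-T₀ (≈-trans (≈-sym (≈-trans (sw g rims-equal spokes-equal)
          (≈-trans (+-congˡ (≈-trans (*-congˡ γ≈0) (zeroʳ _))) (+-identityʳ _))))
              (g-zero (Stage.basis st) (covers st all)))
          where
          all : ∀ v → v ∈ Y
          all v = ⊆-of-size {p = Y} {⊤} (λ _ → ∈⊤) (ℕ.≤-reflexive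
              (trans (∣⊤∣≡n H.order) (trans (suc-pred root) (sym size≡)))) ∈⊤
            where
            suc-pred : ∀ {n} → Fin n → n ≡ suc (pred n)
            suc-pred {suc n} _ = refl

      -- One base for each number of exchanges below `H.order`. Successive values differ by `γ`, and
      -- they are pairwise distinct because an ordered field has characteristic zero.
      many-values : ∀ {k} → k < H.order → ¬ AtMostValues F V k g
      many-values = distinct-values {l = g} (λ j → indicator F G (T j)) (λ j → vertex (proj₁ (proj₂ (stage j))))
          distinct
        where
        stage : (j : Fin H.order) → ∃ λ T → Basis T × val g T ≈ val g T₀ ⊕ ι (toℕ j) * γ
        stage j with grow {⊤} {root} (proj₂ (proj₁ biconnected)) ∈⊤ (toℕ j)
            (subst (toℕ j <_) (sym (∣⊤∣≡n H.order)) (toℕ<n j))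
        ... | Y , T , _ , _ , st , sw = T , Stage.basis st , sw g rims-equal spokes-equal
        T : Fin H.order → Subset size
        T j = proj₁ (stage j)
        distinct : ∀ {i j} → val g (T i) ≈ val g (T j) → i ≡ j
        distinct {i} {j} eq = toℕ-injective (ι*-injective γ≉0 (+-cancelˡ (val g T₀) _ _
          (≈-trans (≈-sym (proj₂ (proj₂ (stage i)))) (≈-trans eq (proj₂ (proj₂ (stage j)))))))

    too-many-values : ∀ {k} → k < H.order → ¬ IsLevelGraph F k G
    too-many-values k< level = facet-through {l} (deficit-nonNeg Tₖ-covers) (vertex T₀-basis) l-T₀
      λ (g , facet , g-T₀ , l⊆g) → many-values {g} g-T₀ (λ {x} → l⊆g {x}) k< (level g facet)

-- From facets with many values to cone minors

module Patterns (G : Graph) where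
  open GraphicMatroid G
  open Walks G

  LinkIn : Subset order → Vertex → Vertex → Set
  LinkIn X = Link (induced X ⊤)

  Linked : Subset order → Set
  Linked X = ∀ {u v} → u ∈ X → v ∈ X → LinkIn X u v

  within : ∀ {X e} → end₁ e ∈ X → end₂ e ∈ X → e ∈ induced X ⊤
  within {X} p q = ∈-select⁺ (inside? X ⊤) (∈⊤ , p , q)

  within⁻ : ∀ {X e} → e ∈ induced X ⊤ → end₁ e ∈ X × end₂ e ∈ X
  within⁻ {X} = proj₂ ∘ ∈-select⁻ (inside? X ⊤)

  joins-within : ∀ {X e u v} → Joins e u v → u ∈ X → v ∈ X → LinkIn X u v
  joins-within {X} {e} j@(inj₁ (refl , refl)) p q = joins-link {e = e} (span (within p q)) j
  joins-within {X} {e} j@(inj₂ (refl , refl)) p q = joins-link {e = e} (span (within q p)) j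

  -- A cone before its rim is contracted: `U` is to become the apex, and `N` holds vertices of `W`
  -- with a spoke. That `U` is nonempty follows from `marked` and `size`.
  record ConePattern (k : ℕ) : Set where
    field
      W U N    : Subset order
      W-linked : Linked W
      W-cut    : ∀ v → Linked (del W v)
      U-linked : Linked U
      disjoint : ∀ {v} → v ∈ U → v ∉ W
      N⊆W      : N ⊆ W
      marked   : ∀ {n} → n ∈ N → ∃₂ λ e u → u ∈ U × Joins e u n
      size     : suc k ≤ ∣ N ∣

  component-linked : ∀ {B y} (U? : Decidable (Link B y)) → Linked (select U?)
  component-linked {B} {y} U? u∈ v∈ = back (from-y (∈-select⁻ U? u∈)) ∙ from-y (∈-select⁻ U? v∈)
    where
    In : Vertex → Set
    In x = x ∈ select U? × LinkIn (select U?) y x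
    extend-in : ∀ {e u v} → e ∈ B → Joins e u v → In u → In v
    extend-in {e} e∈ j (u∈ , l) = v∈′ , l ∙ joins-within {e = e} j u∈ v∈′
      where
      v∈′ = ∈-select⁺ U? (∈-select⁻ U? u∈ ∙ joins-link (span e∈) j)
    from-y : ∀ {x} → Link B y x → LinkIn (select U?) y x
    from-y l = proj₂ (link-closed {P = In} (λ m → extend-in m (inj₁ (refl , refl)) , extend-in m (inj₂ (refl , refl))) l
      (∈-select⁺ U? stop , stop))

  module _ (e : Edge) (bypass : Spans (del ⊤ e) e) where

    private
      a b : Vertex
      a = end₁ e
      b = end₂ e

      I? : Decidable (λ f → end₁ f ≢ a × end₁ f ≢ b × end₂ f ≢ a × end₂ f ≢ b)
      I? f = ¬? (end₁ f ≟ a) ×-dec ¬? (end₁ f ≟ b) ×-dec ¬? (end₂ f ≟ a) ×-dec ¬? (end₂ f ≟ b)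

      I : Subset size
      I = select I?

      W : Subset order
      W = add ⁅ a ⁆ b

      ∈W⁻ : ∀ {x} → x ∈ W → x ≡ a ⊎ x ≡ b
      ∈W⁻ m = [ inj₁ ∘ x∈⁅y⁆⇒x≡y a , inj₂ ]′ (∈-add⁻ m)

      Apart : Vertex → Set
      Apart x = x ≢ a × x ≢ b

      link-apart : ∀ {x y} → Link I x y → Apart x → Apart y
      link-apart = link-closed {P = Apart} λ m → let p , q , r , s = ∈-select⁻ I? m in (λ _ → r , s) , λ _ → p , q

      linked-W : ∀ v → Linked (del W v)
      linked-W v {x} {y} x∈ y∈ with ∈W⁻ (proj₁ (∈-del⁻ x∈)) | ∈W⁻ (proj₁ (∈-del⁻ y∈))
      ... | inj₁ refl | inj₁ refl = stop
      ... | inj₂ refl | inj₂ refl = stop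
      ... | inj₁ refl | inj₂ refl = span (within x∈ y∈)
      ... | inj₂ refl | inj₁ refl = back (span (within y∈ x∈))

      linked-W′ : Linked W
      linked-W′ {x} {y} x∈ y∈ with ∈W⁻ x∈ | ∈W⁻ y∈
      ... | inj₁ refl | inj₁ refl = stop
      ... | inj₂ refl | inj₂ refl = stop
      ... | inj₁ refl | inj₂ refl = span (within x∈ y∈)
      ... | inj₂ refl | inj₁ refl = back (span (within y∈ x∈))

      found : ∀ {f g x y} → Joins f a x → Apart x → Link I x y → Joins g y b → ConePattern 1
      found {f} {g} {x} {y} jf apart l jg = record
        { W = W ; U = select U? ; N = W
        ; W-linked = linked-W′
        ; W-cut    = linked-W
        ; U-linked = component-linked U?
        ; disjoint = λ v∈U v∈W → let ≢a , ≢b = link-apart (∈-select⁻ U? v∈U) apart in [ ≢a , ≢b ]′ (∈W⁻ v∈W)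
        ; N⊆W      = id
        ; marked   = λ n∈ → [ (λ { refl → f , x , ∈-select⁺ U? stop , joins-sym {f} jf })
                             , (λ { refl → g , y , ∈-select⁺ U? l , jg }) ]′ (∈W⁻ n∈)
        ; size     = ℕ.≤-reflexive (sym (trans (∣add∣ λ m → noLoops e (sym (x∈⁅y⁆⇒x≡y a m))) (cong suc (∣⁅x⁆∣≡1 a))))
        }
        where
        U? : Decidable (Link I x)
        U? = link? I x

    -- A link from `a` to `b` without `e` cannot be a parallel edge, so it crosses a component of
    -- the graph without `a` and `b` that is adjacent to both; this is the apex. `Near` says that a
    -- vertex is `a` or lies in a component adjacent to `a`. If none of these reached `b`, then
    -- `Near` would be preserved along the link yet fail at `b`.
    bypassed-edge : ¬ ¬ ConePattern 1
    bypassed-edge none = [ (λ b≡a → noLoops e (sym b≡a)) , (λ ((_ , ≢b) , _) → ≢b refl) ]′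
      (link-closed {P = Near} (λ {f} m → near {f} m (inj₁ (refl , refl)) , near {f} m (inj₂ (refl , refl)))
          bypass (inj₁ refl))
      where
      Near : Vertex → Set
      Near x = x ≡ a ⊎ (Apart x × ∃₂ λ f y → Joins f a y × Apart y × Link I y x)
      near : ∀ {f y z} → f ∈ del ⊤ e → Joins f y z → Near y → Near z
      near {f} {y} {z} m j near-y with z ≟ a
      ... | yes z≡a = inj₁ z≡a
      near {f} {y} {z} m j (inj₁ refl) | no z≢a with z ≟ b
      ... | yes refl = contradiction (noParallels j (inj₁ (refl , refl))) (proj₂ (∈-del⁻ m))
      ... | no z≢b   = inj₂ ((z≢a , z≢b) , f , z , j , (z≢a , z≢b) , stop)
      near {f} {y} {z} m j (inj₂ ((y≢a , y≢b) , g , x , jx , apart , l)) | no z≢a with z ≟ b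
      ... | yes refl = ⊥-elim (none (found {g} {f} jx apart l j))
      ... | no z≢b   = inj₂ ((z≢a , z≢b) , g , x , jx , apart , l ∙ joins-link (span (∈-select⁺ I? (apart-ends j))) j)
        where
        apart-ends : Joins f y z → end₁ f ≢ a × end₁ f ≢ b × end₂ f ≢ a × end₂ f ≢ b
        apart-ends (inj₁ (refl , refl)) = y≢a , y≢b , z≢a , z≢b
        apart-ends (inj₂ (refl , refl)) = z≢a , z≢b , y≢a , y≢b

-- Tight and loose edge sets

module TightSets (G : Graph) {ℓ} (OnFace : Subset (Graph.size G) → Set ℓ) where
  open GraphicMatroid G hiding (swap)
  open Walks G
  open Patterns G

  Tight : Subset size → Set ℓ
  Tight A = ∀ {T} → OnFace T → Covers T A

  Loose : Subset size → Set
  Loose A = ∃₂ λ T e → Basis T × e ∈ A × ¬ Spans (T ∩ A) e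

  Touches : Subset order → Edge → Set
  Touches Y e = end₁ e ∈ Y ⊎ end₂ e ∈ Y

  touches? : ∀ Y e → Dec (Touches Y e)
  touches? Y e = (end₁ e ∈? Y) ⊎-dec (end₂ e ∈? Y)

  -- Inside `A` the only exit from `Y` is `v`, as at a cut vertex. A union of components is the case
  -- in which the exit is not taken.
  Hinged : Subset size → Subset order → Vertex → Set
  Hinged A Y v = ∀ {e y z} → e ∈ A → Joins e y z → y ∈ Y → z ∈ Y ⊎ z ≡ v

  module _ {A Y v} (hinged : Hinged A Y v) where

    private
      near? : Decidable (λ e → e ∈ A × Touches Y e)
      near? e = (e ∈? A) ×-dec touches? Y e

      far? : Decidable (λ e → e ∈ A × ¬ Touches Y e)
      far? e = (e ∈? A) ×-dec ¬? (touches? Y e)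

    near far : Subset size
    near = select near?
    far  = select far?

    private
      contract-far contract-near : Vertex → Vertex
      contract-far x with x ∈? Y
      ... | yes _ = x
      ... | no _  = v
      contract-near x with x ∈? Y
      ... | yes _ = v
      ... | no _  = x

      far-fixed : ∀ {x} → x ∈ Y ⊎ x ≡ v → contract-far x ≡ x
      far-fixed {x} p with x ∈? Y
      ... | yes _ = refl
      far-fixed {x} (inj₁ x∈) | no x∉ = contradiction x∈ x∉
      far-fixed {x} (inj₂ eq) | no _  = sym eq

      far-collapsed : ∀ {x} → x ∉ Y → contract-far x ≡ v
      far-collapsed {x} x∉ with x ∈? Y
      ... | yes x∈ = contradiction x∈ x∉
      ... | no _   = refl

      near-fixed : ∀ {x} → x ∉ Y → contract-near x ≡ x
      near-fixed {x} x∉ with x ∈? Y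
      ... | yes x∈ = contradiction x∈ x∉
      ... | no _   = refl

      near-collapsed : ∀ {x} → x ∈ Y ⊎ x ≡ v → contract-near x ≡ v
      near-collapsed {x} p with x ∈? Y
      ... | yes _ = refl
      near-collapsed {x} (inj₁ x∈) | no x∉ = contradiction x∈ x∉
      near-collapsed {x} (inj₂ eq) | no _  = eq

      near-ends : ∀ {e} → e ∈ A → Touches Y e → (end₁ e ∈ Y ⊎ end₁ e ≡ v) × (end₂ e ∈ Y ⊎ end₂ e ≡ v)
      near-ends m (inj₁ p) = inj₁ p , hinged m (inj₁ (refl , refl)) p
      near-ends m (inj₂ p) = hinged m (inj₂ (refl , refl)) p , inj₁ p

    -- Sending everything outside `Y` to `v` is a retraction: far edges collapse to `v` and near
    -- edges survive, so a link in `T ∩ A` becomes one in `T ∩ near`.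
    near-tight : Tight A → Tight near
    near-tight tight {T} face {e} m with ∈-select⁻ near? m
    ... | m′ , t = conn-cong (far-fixed (proj₁ (near-ends m′ t))) (far-fixed (proj₂ (near-ends m′ t)))
                    (link-gmap contract-far project (tight face m′))
      where
      project : ∀ {f} → f ∈ T ∩ A → Link (T ∩ near) (contract-far (end₁ f)) (contract-far (end₂ f))
      project {f} f∈ with x∈p∩q⁻ T A f∈ | touches? Y f
      ... | f∈T , f∈A | yes t = conn-cong (sym (far-fixed (proj₁ (near-ends f∈A t))))
          (sym (far-fixed (proj₂ (near-ends f∈A t))))
        (span (x∈p∩q⁺ (f∈T , ∈-select⁺ near? (f∈A , t))))
      ... | f∈T , f∈A | no ¬t = conn-cong (sym (far-collapsed (¬t ∘ inj₁))) (sym (far-collapsed (¬t ∘ inj₂))) stop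

    far-tight : Tight A → Tight far
    far-tight tight {T} face {e} m with ∈-select⁻ far? m
    ... | m′ , ¬t = conn-cong (near-fixed (¬t ∘ inj₁)) (near-fixed (¬t ∘ inj₂))
        (link-gmap contract-near project (tight face m′))
      where
      project : ∀ {f} → f ∈ T ∩ A → Link (T ∩ far) (contract-near (end₁ f)) (contract-near (end₂ f))
      project {f} f∈ with x∈p∩q⁻ T A f∈ | touches? Y f
      ... | f∈T , f∈A | yes t = conn-cong (sym (near-collapsed (proj₁ (near-ends f∈A t))))
          (sym (near-collapsed (proj₂ (near-ends f∈A t)))) stop
      ... | f∈T , f∈A | no ¬t = conn-cong (sym (near-fixed (¬t ∘ inj₁))) (sym (near-fixed (¬t ∘ inj₂)))
        (span (x∈p∩q⁺ (f∈T , ∈-select⁺ far? (f∈A , ¬t))))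

    loose-part : Loose A → Loose near ⊎ Loose far
    loose-part (T , e , b , m , ¬s) with touches? Y e
    ... | yes t = inj₁ (T , e , b , ∈-select⁺ near? (m , t) , ¬s ∘ link-mono λ m′ →
      x∈p∩q⁺ (proj₁ (x∈p∩q⁻ T near m′) , proj₁ (∈-select⁻ near? (proj₂ (x∈p∩q⁻ T near m′)))))
    ... | no ¬t = inj₂ (T , e , b , ∈-select⁺ far? (m , ¬t) , ¬s ∘ link-mono λ m′ →
      x∈p∩q⁺ (proj₁ (x∈p∩q⁻ T far m′) , proj₁ (∈-select⁻ far? (proj₂ (x∈p∩q⁻ T far m′)))))

    near-< : ∀ {e} → e ∈ A → ¬ Touches Y e → ∣ near ∣ < ∣ A ∣
    near-< m ¬t = p⊂q⇒∣p∣<∣q∣ (proj₁ ∘ ∈-select⁻ near? , _ , m , ¬t ∘ proj₂ ∘ ∈-select⁻ near?)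

    far-< : ∀ {e} → e ∈ A → Touches Y e → ∣ far ∣ < ∣ A ∣
    far-< m t = p⊂q⇒∣p∣<∣q∣ (proj₁ ∘ ∈-select⁻ far? , _ , m , λ m′ → proj₂ (∈-select⁻ far? m′) t)

  -- Connectedness and absence of cut vertices in one condition, in the form that minimality
  -- delivers.
  Irreducible : Subset size → Set
  Irreducible A = ∀ {Y v e f} → Hinged A Y v → e ∈ A → Touches Y e → f ∈ A → Touches Y f

  minimal-tight : ∀ {A} → Tight A → Loose A → ¬ ¬ (∃ λ B → Tight B × Loose B × Irreducible B)
  minimal-tight tight loose k = go (<-wellFounded _) tight loose
    where
    go : ∀ {A} → Acc _<_ ∣ A ∣ → Tight A → Loose A → ⊥
    go {A} (acc rec) tight loose = k (A , tight , loose , irreducible)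
      where
      irreducible : Irreducible A
      irreducible {Y} {v} {e} {f} hinged e∈ te f∈ with touches? Y f
      ... | yes t = t
      ... | no ¬t = ⊥-elim ([ go (rec (near-< hinged f∈ ¬t)) (near-tight hinged tight)
                            , go (rec (far-< hinged e∈ te)) (far-tight hinged tight) ]′ (loose-part hinged loose))

  module _ {A} (irreducible : Irreducible A) where

    private
      Covered : Vertex → Set
      Covered v = ∃ λ e → e ∈ A × (end₁ e ≡ v ⊎ end₂ e ≡ v)

      covered? : Decidable Covered
      covered? v = any? λ e → (e ∈? A) ×-dec ((end₁ e ≟ v) ⊎-dec (end₂ e ≟ v))

    support : Subset order
    support = select covered?

    support-ends : ∀ {e} → e ∈ A → end₁ e ∈ support × end₂ e ∈ support
    support-ends {e} m = ∈-select⁺ covered? (e , m , inj₁ refl) , ∈-select⁺ covered? (e , m , inj₂ refl)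

    private
      incident : ∀ {v} → v ∈ support → ∃₂ λ e x → e ∈ A × Joins e v x
      incident m with ∈-select⁻ covered? m
      ... | e , m′ , inj₁ refl = e , _ , m′ , inj₁ (refl , refl)
      ... | e , m′ , inj₂ refl = e , _ , m′ , inj₂ (refl , refl)

      touching : ∀ {Y e y z} → Joins e y z → y ∈ Y → Touches Y e
      touching (inj₁ (refl , refl)) = inj₁
      touching (inj₂ (refl , refl)) = inj₂

      touched : ∀ {Y e y z} → Joins e y z → Touches Y e → y ∈ Y ⊎ z ∈ Y
      touched (inj₁ (refl , refl)) t = t
      touched (inj₂ (refl , refl)) t = [ inj₂ , inj₁ ]′ t

      -- The vertices reached from `u` form a hinged set, so every edge of `A` at `w` touches it.
      -- Either `w` is reached, or a neighbour of `w` is, and then their edge leads on to `w` unless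
      -- `w` is the hinge.
      irreducible-link : ∀ {B u v w} → (∀ {e y z} → e ∈ A → Joins e y z → Link B u y → Link B u z ⊎ z ≡ v) →
                         u ∈ support → w ∈ support → (w ≡ v → Link B u w) → Link B u w
      irreducible-link {B} {u} {v} {w} hinged u∈ w∈ at-hinge with incident u∈ | incident w∈
      ... | e , _ , e∈ , je | f , _ , f∈ , jf =
        reached f∈ jf (touched {e = f} jf (irreducible hinge e∈ (touching je (∈-select⁺ (link? B u) stop)) f∈))
        where
        Y : Subset order
        Y = select (link? B u)
        hinge : Hinged A Y v
        hinge m j y∈ = [ inj₁ ∘ ∈-select⁺ (link? B u) , inj₂ ]′ (hinged m j (∈-select⁻ (link? B u) y∈))
        reached : ∀ {f z} → f ∈ A → Joins f w z → w ∈ Y ⊎ z ∈ Y → Link B u w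
        reached _ _ (inj₁ w∈Y) = ∈-select⁻ (link? B u) w∈Y
        reached m j (inj₂ z∈Y) = [ id , at-hinge ]′ (hinged m (joins-sym j) (∈-select⁻ (link? B u) z∈Y))

    support-link : ∀ {u w} → u ∈ support → w ∈ support → Link A u w
    support-link {u} u∈ w∈ = irreducible-link {v = u} (λ m j l → inj₁ (l ∙ joins-link (span m) j)) u∈ w∈
        λ { refl → stop }

    support-linked : Linked support
    support-linked u∈ w∈ = link-mono (λ m → within (proj₁ (support-ends m)) (proj₂ (support-ends m)))
        (support-link u∈ w∈)

    support-cut : ∀ x → Linked (del support x)
    support-cut x {u} {w} u∈ w∈ = link-mono (λ m → ∈-induced (∈-select⁻ avoiding? m))
      (irreducible-link {B = B} {v = x} hinged (proj₁ (∈-del⁻ u∈)) (proj₁ (∈-del⁻ w∈)) λ w≡x →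
          contradiction w≡x (proj₂ (∈-del⁻ w∈)))
      where
      Avoiding : Edge → Set
      Avoiding e = e ∈ A × end₁ e ≢ x × end₂ e ≢ x
      avoiding? : Decidable Avoiding
      avoiding? e = (e ∈? A) ×-dec ¬? (end₁ e ≟ x) ×-dec ¬? (end₂ e ≟ x)
      B : Subset size
      B = select avoiding?
      ∈-induced : ∀ {e} → Avoiding e → e ∈ induced (del support x) ⊤
      ∈-induced (m , p , q) = within (∈-del⁺ (proj₁ (support-ends m)) p) (∈-del⁺ (proj₂ (support-ends m)) q)
      avoids : ∀ {y} → Link B u y → y ≢ x
      avoids l = link-closed {P = _≢ x} (λ m → let _ , p , q = ∈-select⁻ avoiding? m in (λ _ → q) , λ _ → p) l (proj₂ (∈-del⁻ u∈))
      hinged : ∀ {e y z} → e ∈ A → Joins e y z → Link B u y → Link B u z ⊎ z ≡ x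
      hinged {e} {y} {z} m j l with z ≟ x
      ... | yes z≡x = inj₂ z≡x
      ... | no z≢x  = inj₁ (l ∙ joins-link (span (∈-select⁺ avoiding? (m , avoid-ends j))) j)
        where
        avoid-ends : Joins e y z → end₁ e ≢ x × end₂ e ≢ x
        avoid-ends (inj₁ (refl , refl)) = avoids l , z≢x
        avoid-ends (inj₂ (refl , refl)) = z≢x , avoids l

  avoiding : Subset order → Subset size
  avoiding U = select (λ e → ¬? (touches? U e))

  ∈-avoiding⁺ : ∀ {U e} → ¬ Touches U e → e ∈ avoiding U
  ∈-avoiding⁺ {U} = ∈-select⁺ (λ e → ¬? (touches? U e))

  ∈-avoiding⁻ : ∀ {U e} → e ∈ avoiding U → ¬ Touches U e
  ∈-avoiding⁻ {U} = ∈-select⁻ (λ e → ¬? (touches? U e))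

  module _ (face⇒basis : ∀ {T} → OnFace T → Basis T) {T₀} (face₀ : OnFace T₀) {k′}
           (flat : ∀ {A} → Tight A → ∀ {e} → Spans A e → e ∈ A)
           (few-values : ∀ {A} → Tight A → Loose A → ¬ (∀ {T} → Basis T → ∣ T₀ ∩ A ∣ ≤ ∣ T ∩ A ∣ + k′))
           {A} (tight : Tight A) (loose : Loose A) (irreducible : Irreducible A) where

    private
      W : Subset order
      W = support irreducible

      w₀ : Vertex
      w₀ = end₁ (proj₁ (proj₂ loose))

      w₀∈W : w₀ ∈ W
      w₀∈W = proj₁ (support-ends irreducible (proj₁ (proj₂ (proj₂ (proj₂ loose)))))

    -- By `disjoint` and `closed`, a union of components of `G` without `W`; `loosened` is what has
    -- to be maintained while `U` shrinks to a single one.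
    record Outer (U : Subset order) : Set where
      field
        disjoint : ∀ {v} → v ∈ U → v ∉ W
        closed   : ∀ {e u v} → Joins e u v → u ∈ U → v ∈ U ⊎ v ∈ W
        loosened : Loose (avoiding U)

      ends∈ : ∀ {e} → Touches U e → (end₁ e ∈ U ⊎ end₁ e ∈ W) × (end₂ e ∈ U ⊎ end₂ e ∈ W)
      ends∈ (inj₁ p) = inj₁ p , closed (inj₁ (refl , refl)) p
      ends∈ (inj₂ p) = closed (inj₂ (refl , refl)) p , inj₁ p

      A⊆ : A ⊆ avoiding U
      A⊆ m = ∈-avoiding⁺ [ (λ p → disjoint p (proj₁ (support-ends irreducible m)))
                          , (λ p → disjoint p (proj₂ (support-ends irreducible m))) ]′

    module Collapse {U : Subset order} (c : Vertex) where

      collapse : Vertex → Vertex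
      collapse x with x ∈? U
      ... | yes _ = c
      ... | no _  = x

      fixed : ∀ {x} → x ∉ U → collapse x ≡ x
      fixed {x} x∉ with x ∈? U
      ... | yes x∈ = contradiction x∈ x∉
      ... | no _   = refl

      -- Excursions of a walk into U are short-circuited by R.
      short-circuit : ∀ {R : Vertex → Vertex → Set} {T u v} →
        (∀ {e} → e ∈ T → e ∈ avoiding U → Conn R (end₁ e) (end₂ e)) →
        (∀ {e x} → e ∈ T → Touches U e → (end₁ e ≡ x ⊎ end₂ e ≡ x) → x ∉ U → Conn R c x) →
        Link T u v → Conn R (collapse u) (collapse v)
      short-circuit {R} {T} direct detour = link-gmap collapse along
        where
        to-c : ∀ {e x} → e ∈ T → Touches U e → (end₁ e ≡ x ⊎ end₂ e ≡ x) → Conn R c (collapse x)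
        to-c {x = x} m t end with x ∈? U
        ... | yes _ = stop
        ... | no x∉ = detour m t end x∉
        along : ∀ {e} → e ∈ T → Conn R (collapse (end₁ e)) (collapse (end₂ e))
        along {e} m = by (touches? U e)
          where
          by : Dec (Touches U e) → Conn R (collapse (end₁ e)) (collapse (end₂ e))
          by (yes t) = back (to-c m t (inj₁ refl)) ∙ to-c m t (inj₂ refl)
          by (no ¬t) = conn-cong (sym (fixed (¬t ∘ inj₁))) (sym (fixed (¬t ∘ inj₂))) (direct m (∈-avoiding⁺ ¬t))

    module _ {U} (outer : Outer U) where
      open Outer outer

      in-W : ∀ {e x} → Touches U e → end₁ e ≡ x ⊎ end₂ e ≡ x → x ∉ U → x ∈ W
      in-W t (inj₁ refl) x∉ = [ (λ x∈ → contradiction x∈ x∉) , id ]′ (proj₁ (ends∈ t))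
      in-W t (inj₂ refl) x∉ = [ (λ x∈ → contradiction x∈ x∉) , id ]′ (proj₂ (ends∈ t))

      -- A base on the face spans all edges. Where its path runs through `U`, it enters and leaves
      -- at vertices of `W`, which the base already links inside `A`.
      avoiding-tight : Tight (avoiding U)
      avoiding-tight {T} face {e} m = conn-cong (fixed (∈-avoiding⁻ m ∘ inj₁)) (fixed (∈-avoiding⁻ m ∘ inj₂))
        (short-circuit (λ m′ a → span (x∈p∩q⁺ (m′ , a)))
          (λ _ t end x∉ → link-map (link-mono T∩A⊆ ∘ tight face) (support-link irreducible w₀∈W (in-W t end x∉)))
          (proj₂ (face⇒basis face) e))
        where
        open Collapse {U} w₀
        T∩A⊆ : T ∩ A ⊆ T ∩ avoiding U
        T∩A⊆ m′ = x∈p∩q⁺ (proj₁ (x∈p∩q⁻ T A m′) , A⊆ (proj₂ (x∈p∩q⁻ T A m′)))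

      Marked : Vertex → Set
      Marked n = n ∈ W × ∃ λ e → (end₁ e ≡ n × end₂ e ∈ U) ⊎ (end₂ e ≡ n × end₁ e ∈ U)

      marked? : Decidable Marked
      marked? n = (n ∈? W) ×-dec any? λ e → ((end₁ e ≟ n) ×-dec (end₂ e ∈? U)) ⊎-dec ((end₂ e ≟ n) ×-dec (end₁ e ∈? U))

      N : Subset order
      N = select marked?

      in-N : ∀ {e x} → Touches U e → end₁ e ≡ x ⊎ end₂ e ≡ x → x ∉ U → x ∈ N
      in-N {e} (inj₁ p) (inj₁ refl) x∉ = contradiction p x∉
      in-N {e} (inj₂ p) (inj₁ refl) x∉ = ∈-select⁺ marked? (in-W {e} (inj₂ p) (inj₁ refl) x∉ , e , inj₁ (refl , p))
      in-N {e} (inj₁ p) (inj₂ refl) x∉ = ∈-select⁺ marked? (in-W {e} (inj₁ p) (inj₂ refl) x∉ , e , inj₂ (refl , p))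
      in-N {e} (inj₂ p) (inj₂ refl) x∉ = contradiction p x∉

      -- A star on N makes up for the part of a base inside U.
      N-large : suc (suc k′) ≤ ∣ N ∣
      N-large with suc (suc k′) ℕ.≤? ∣ N ∣
      ... | yes p = p
      ... | no ¬p = ⊥-elim (few-values avoiding-tight loosened
          (bound (star (members N) (ℕ.≤-trans (ℕ.≤-reflexive (length-members N)) (ℕ.≤-pred (ℕ.≰⇒> ¬p))))))
        where
        Hub : List Vertex → Set
        Hub ns = ∃₂ λ c ms → length ms ≤ k′ × (∀ {n} → n ∈ₗ ns → n ≡ c ⊎ n ∈ₗ ms)
        -- One vertex as centre leaves at most `k′` rays, which bounds the difference of the traces
        -- by `k′`. The centre `w₀` is a dummy for the empty list.
        star : ∀ ns → length ns ≤ suc k′ → Hub ns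
        star []       _       = w₀ , [] , z≤n , λ ()
        star (n ∷ ns) (s≤s p) = n , ns , p , λ { (here eq) → inj₁ eq ; (there m) → inj₂ m }
        bound : Hub (members N) → ∀ {T} → Basis T → ∣ T₀ ∩ avoiding U ∣ ≤ ∣ T ∩ avoiding U ∣ + k′
        bound (c , ms , small , star) {T} b = ℕ.≤-trans
          (forest-size-listed {Q = Q} (forest-⊆ (proj₁ ∘ x∈p∩q⁻ T₀ (avoiding U)) (proj₁ (face⇒basis face₀)))
            (λ {e} m → conn-cong (fixed (∈-avoiding⁻ (proj₂ (x∈p∩q⁻ T₀ (avoiding U) m)) ∘ inj₁))
                (fixed (∈-avoiding⁻ (proj₂ (x∈p∩q⁻ T₀ (avoiding U) m)) ∘ inj₂))
              (short-circuit direct (λ {e} _ t end x∉ → spoke (star (∈-members⁺ (in-N {e} t end x∉)))) (proj₂ b e))))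
          (ℕ.≤-trans (ℕ.≤-reflexive (length-++ (pairs (T ∩ avoiding U))))
            (ℕ.+-mono-≤ (ℕ.≤-reflexive (length-pairs (T ∩ avoiding U)))
                (ℕ.≤-trans (ℕ.≤-reflexive (length-map (c ,_) ms)) small)))
          where
          open Collapse {U} c
          Q : List (Vertex × Vertex)
          Q = pairs (T ∩ avoiding U) ++ map (c ,_) ms
          direct : ∀ {e} → e ∈ T → e ∈ avoiding U → Conn (Listed Q) (end₁ e) (end₂ e)
          direct m a = conn-map (step ∘ ∈-++⁺ˡ) (link⇒listed (span (x∈p∩q⁺ (m , a))))
          spoke : ∀ {n} → n ≡ c ⊎ n ∈ₗ ms → Conn (Listed Q) c n
          spoke (inj₁ refl) = stop
          spoke (inj₂ m)    = step (∈-++⁺ʳ (pairs (T ∩ avoiding U)) (∈-map⁺ (c ,_) m))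

    -- `U` is split into the component of `u` and the rest. If the traces of `T` on both
    -- `avoiding U₁` and `avoiding U₂` spanned `e`, their intersection would too, because `T` is a
    -- forest; so one of the two sets inherits looseness.
    outer-part : ∀ {U} → Outer U → ∀ {u u′} → u ∈ U → u′ ∈ U → ¬ LinkIn U u u′ →
                 ∃ λ U′ → Outer U′ × ∣ U′ ∣ < ∣ U ∣
    outer-part {U} outer {u} {u′} u∈ u′∈ ¬l = choose loosened
      where
      open Outer outer
      here? : Decidable (λ x → x ∈ U × LinkIn U u x)
      here? x = (x ∈? U) ×-dec link? (induced U ⊤) u x
      there? : Decidable (λ x → x ∈ U × ¬ LinkIn U u x)
      there? x = (x ∈? U) ×-dec ¬? (link? (induced U ⊤) u x)
      U₁ U₂ : Subset order
      U₁ = select here?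
      U₂ = select there?
      closed₁ : ∀ {e x y} → Joins e x y → x ∈ U₁ → y ∈ U₁ ⊎ y ∈ W
      closed₁ {e} j x∈₁ with ∈-select⁻ here? x∈₁
      ... | x∈ , l = [ (λ y∈ → inj₁ (∈-select⁺ here? (y∈ , l ∙ joins-within {e = e} j x∈ y∈))) , inj₂ ]′ (closed j x∈)
      closed₂ : ∀ {e x y} → Joins e x y → x ∈ U₂ → y ∈ U₂ ⊎ y ∈ W
      closed₂ {e} j x∈₂ with ∈-select⁻ there? x∈₂
      ... | x∈ , ¬l′ = [ (λ y∈ → inj₁ (∈-select⁺ there? (y∈ , λ l →
          ¬l′ (l ∙ back (joins-within {e = e} j x∈ y∈))))) , inj₂ ]′ (closed j x∈)
      avoiding-mono : ∀ {Y} → Y ⊆ U → avoiding U ⊆ avoiding Y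
      avoiding-mono Y⊆U m = ∈-avoiding⁺ (∈-avoiding⁻ m ∘ [ inj₁ ∘ Y⊆U , inj₂ ∘ Y⊆U ]′)
      U₁⊆U : U₁ ⊆ U
      U₁⊆U = proj₁ ∘ ∈-select⁻ here?
      U₂⊆U : U₂ ⊆ U
      U₂⊆U = proj₁ ∘ ∈-select⁻ there?
      part₁ : Loose (avoiding U₁) → ∃ λ U′ → Outer U′ × ∣ U′ ∣ < ∣ U ∣
      part₁ l = U₁ , record { disjoint = disjoint ∘ U₁⊆U ; closed = λ {e} → closed₁ {e} ; loosened = l } ,
        p⊂q⇒∣p∣<∣q∣ (U₁⊆U , u′ , u′∈ , ¬l ∘ proj₂ ∘ ∈-select⁻ here?)
      part₂ : Loose (avoiding U₂) → ∃ λ U′ → Outer U′ × ∣ U′ ∣ < ∣ U ∣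
      part₂ l = U₂ , record { disjoint = disjoint ∘ U₂⊆U ; closed = λ {e} → closed₂ {e} ; loosened = l } ,
        p⊂q⇒∣p∣<∣q∣ (U₂⊆U , u , u∈ , λ m → proj₂ (∈-select⁻ there? m) stop)
      covered : ∀ {x} → x ∈ U → x ∈ U₁ ⊎ x ∈ U₂
      covered {x} x∈ with link? (induced U ⊤) u x
      ... | yes l = inj₁ (∈-select⁺ here? (x∈ , l))
      ... | no ¬l′ = inj₂ (∈-select⁺ there? (x∈ , ¬l′))
      avoids-both : ∀ {e} → e ∈ avoiding U₁ → e ∈ avoiding U₂ → e ∈ avoiding U
      avoids-both m₁ m₂ = ∈-avoiding⁺ [ [ ∈-avoiding⁻ m₁ ∘ inj₁ , ∈-avoiding⁻ m₂ ∘ inj₁ ]′ ∘ covered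
                                       , [ ∈-avoiding⁻ m₁ ∘ inj₂ , ∈-avoiding⁻ m₂ ∘ inj₂ ]′ ∘ covered ]′
      choose : Loose (avoiding U) → ∃ λ U′ → Outer U′ × ∣ U′ ∣ < ∣ U ∣
      choose (T , e , b , m , ¬s) with spans? (T ∩ avoiding U₁) e | spans? (T ∩ avoiding U₂) e
      ... | no ¬s₁ | _      = part₁ (T , e , b , avoiding-mono U₁⊆U m , ¬s₁)
      ... | yes _  | no ¬s₂ = part₂ (T , e , b , avoiding-mono U₂⊆U m , ¬s₂)
      ... | yes s₁ | yes s₂ = contradiction (link-mono both (link-∩ (proj₁ b) (proj₁ ∘ x∈p∩q⁻ T _)
          (proj₁ ∘ x∈p∩q⁻ T _) s₁ s₂)) ¬s
        where
        both : (T ∩ avoiding U₁) ∩ (T ∩ avoiding U₂) ⊆ T ∩ avoiding U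
        both m′ with x∈p∩q⁻ (T ∩ avoiding U₁) (T ∩ avoiding U₂) m′
        ... | p , q = x∈p∩q⁺ (proj₁ (x∈p∩q⁻ T _ p) , avoids-both (proj₂ (x∈p∩q⁻ T _ p)) (proj₂ (x∈p∩q⁻ T _ q)))

    private
      outside? : Decidable (_∉ W)
      outside? v = ¬? (v ∈? W)

    -- An edge avoiding this set has both ends in `W`, so `A` spans it and, being flat, contains it.
    -- The looseness asked for is therefore that of `A`.
    outer₀ : Outer (select outside?)
    outer₀ = record
      { disjoint = ∈-select⁻ outside?
      ; closed   = λ {e} {u} {v} _ _ → inside-or-not v
      ; loosened = loosen loose
      }
      where
      inside-or-not : ∀ v → v ∈ select outside? ⊎ v ∈ W
      inside-or-not v with v ∈? W
      ... | yes p = inj₂ p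
      ... | no ¬p = inj₁ (∈-select⁺ outside? ¬p)
      in-W₀ : ∀ {v} → v ∉ select outside? → v ∈ W
      in-W₀ {v} v∉ = [ (λ p → contradiction p v∉) , id ]′ (inside-or-not v)
      avoiding⊆A : avoiding (select outside?) ⊆ A
      avoiding⊆A m = flat tight (support-link irreducible (in-W₀ (∈-avoiding⁻ m ∘ inj₁)) (in-W₀ (∈-avoiding⁻ m ∘ inj₂)))
      loosen : Loose A → Loose (avoiding (select outside?))
      loosen (T , e , b , m , ¬s) = T , e , b ,
        ∈-avoiding⁺ [ (λ p → ∈-select⁻ outside? p (proj₁ (support-ends irreducible m))) ,
            (λ p → ∈-select⁻ outside? p (proj₂ (support-ends irreducible m))) ]′ ,
        ¬s ∘ link-mono λ m′ → x∈p∩q⁺ (proj₁ (x∈p∩q⁻ T _ m′) , avoiding⊆A (proj₂ (x∈p∩q⁻ T _ m′)))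

    pattern-of : ∀ {U} → Outer U → Linked U → ConePattern (suc k′)
    pattern-of {U} outer U-linked = record
      { W = W ; U = U ; N = N outer
      ; W-linked = support-linked irreducible
      ; W-cut    = support-cut irreducible
      ; U-linked = U-linked
      ; disjoint = Outer.disjoint outer
      ; N⊆W      = proj₁ ∘ ∈-select⁻ (marked? outer)
      ; marked   = adjacent ∘ proj₂ ∘ ∈-select⁻ (marked? outer)
      ; size     = N-large outer
      }
      where
      adjacent : ∀ {n} → ∃ (λ e → (end₁ e ≡ n × end₂ e ∈ U) ⊎ (end₂ e ≡ n × end₁ e ∈ U)) → ∃₂ λ e u → u ∈ U ×
          Joins e u n
      adjacent (e , inj₁ (eq , p)) = e , end₂ e , p , inj₂ (eq , refl)
      adjacent (e , inj₂ (eq , p)) = e , end₁ e , p , inj₁ (refl , eq)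

    tight-pattern : ConePattern (suc k′)
    tight-pattern = go (<-wellFounded _) outer₀
      where
      go : ∀ {U} → Acc _<_ ∣ U ∣ → Outer U → ConePattern (suc k′)
      go {U} (acc rec) outer with any? (λ u → (u ∈? U) ×-dec any? λ v → (v ∈? U) ×-dec ¬? (link? (induced U ⊤) u v))
      ... | yes (u , u∈ , v , v∈ , ¬l) with outer-part outer u∈ v∈ ¬l
      ...   | U′ , outer′ , smaller = go (rec smaller) outer′
      go {U} (acc rec) outer | no none = pattern-of outer linked
        where
        linked : Linked U
        linked {u} {v} u∈ v∈ with link? (induced U ⊤) u v
        ... | yes l = l
        ... | no ¬l = contradiction (u , u∈ , v , v∈ , ¬l) none

-- Tight sets of a facet of the base configuration

∈─⁻ : ∀ {n} (p q : Subset n) {x} → x ∈ p ─ q → x ∈ p × x ∉ q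
∈─⁻ p q m = p─q⊆p p q m , λ x∈q → outside-q p q m x∈q
  where
  outside-q : ∀ {n} (p q : Subset n) {x} → x ∈ p ─ q → ¬ x ∈ q
  outside-q (_ ∷ p) (_ ∷ q) (there m) (there m′) = outside-q p q m m′
  outside-q (Subset.inside ∷ p) (Subset.inside ∷ q) () here
  outside-q (Subset.outside ∷ p) (Subset.inside ∷ q) () here

module PatternFromFacet {c ℓ₁ ℓ₂} (F : OrderedField c ℓ₁ ℓ₂) (G : Graph) where
  open BaseConfiguration F G
  open Patterns G
  open RingProperties ring using (+-cancelʳ)

  -- Basis exchange moves T towards T′; some step must change the value.
  unequal-swap : ∀ g {T T′} → Basis T → Basis T′ → ¬ val g T ≈ val g T′ →
    ∃ λ T → ∃₂ λ f e → Basis T × f ∈ T × Basis (swap T f e) × ¬ Spans (del T f) e × ¬ coefficient g f ≈ coefficient g e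
  unequal-swap g {T} {T′} bT bT′ neq = go T bT neq (<-wellFounded _)
    where
    Result : Set _
    Result = ∃ λ T → ∃₂ λ f e → Basis T × f ∈ T × Basis (swap T f e) × ¬ Spans (del T f) e ×
        ¬ coefficient g f ≈ coefficient g e
    go : ∀ T → Basis T → ¬ val g T ≈ val g T′ → Acc _<_ ∣ T ─ T′ ∣ → Result
    go T bT neq (acc rec) with any? (λ f → (f ∈? T) ×-dec ¬? (f ∈? T′))
    ... | no none = contradiction (Eq.reflexive (cong (val g) (⊆-antisym T⊆T′ T′⊆T))) neq
      where
      T⊆T′ : T ⊆ T′
      T⊆T′ {x} m with x ∈? T′
      ... | yes p = p
      ... | no ¬p = contradiction (x , m , ¬p) none
      T′⊆T : T′ ⊆ T
      T′⊆T {x} m with x ∈? T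
      ... | yes p = p
      ... | no ¬p = contradiction (link-mono (λ m′ → ∈-del⁺ (T⊆T′ m′) λ { refl → ¬p m′ }) (proj₂ bT x)) (proj₁ bT′ m)
    ... | yes (f , f∈T , f∉T′) with any? (λ e → (e ∈? T′) ×-dec ¬? (spans? (del T f) e))
    ...   | no none = contradiction (link-map sp (proj₂ bT′ f)) (proj₁ bT f∈T)
      where
      sp : ∀ {x} → x ∈ T′ → Spans (del T f) x
      sp {x} m with spans? (del T f) x
      ... | yes s = s
      ... | no ¬s = contradiction (x , m , ¬s) none
    ...   | yes (e , e∈T′ , ¬s) with basis-swap bT f∈T (λ { refl → f∉T′ e∈T′ })
        (exchange {Z = swap T f e} ∈-add⁺ (span (∈-add _ e)) ¬s (proj₂ bT e))
    ...     | e∉T , b with coefficient g f ≈? coefficient g e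
    ...       | no ≉ = T , f , e , bT , f∈T , b , ¬s , ≉
    ...       | yes eq = go (swap T f e) b (λ p → neq (≈-trans (≈-sym same) p))
        (rec (p⊂q⇒∣p∣<∣q∣ (smaller , f , x∈p∧x∉q⇒x∈p─q f∈T f∉T′ , gone)))
      where
      same : val g (swap T f e) ≈ val g T
      same = +-cancelʳ (coefficient g f) _ _ (≈-trans (val-swap g f∈T e∉T) (+-congˡ (≈-sym eq)))
      smaller : swap T f e ─ T′ ⊆ T ─ T′
      smaller m with ∈─⁻ (swap T f e) T′ m
      ... | m′ , ∉T′ with ∈-add⁻ m′
      ...   | inj₁ m″      = x∈p∧x∉q⇒x∈p─q (proj₁ (∈-del⁻ m″)) ∉T′
      ...   | inj₂ refl = contradiction e∈T′ ∉T′
      gone : f ∉ swap T f e ─ T′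
      gone m with ∈-add⁻ (proj₁ (∈─⁻ (swap T f e) T′ m))
      ... | inj₁ m′      = proj₂ (∈-del⁻ m′) refl
      ... | inj₂ refl = f∉T′ e∈T′

  module _ {g k′} (facet : FacetDefining F V g) (many : ¬ AtMostValues F V (suc k′) g) where

    OnFace : Subset size → Set _
    OnFace T = Basis T × val g T ≈ 0#

    -- An empty face lies in the empty face of the constant `1#`, so `g` would be a multiple of that
    -- constant and take a single value.
    face-nonempty : ¬ ¬ ∃ OnFace
    face-nonempty none = many ((λ _ → proj₁ multiple * 1#) , λ {x} x∈ →
        zero , ≈-trans (proj₂ multiple x∈) (*-congˡ (value-constantly 1# x)))
      where
      full : ∃ λ B → Forest B × Subset.⊥ ⊆ B × B ⊆ ⊤ × (∀ {e} → e ∈ ⊤ → Spans B e)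
      full = extend {I = Subset.⊥} (λ m → contradiction m ∉⊥) (λ _ → ∈⊤)
      T : Subset size
      T = proj₁ full
      basis : Basis T
      basis = proj₁ (proj₂ full) , λ e → proj₂ (proj₂ (proj₂ (proj₂ full))) ∈⊤
      multiple : ∃ λ t → ∀ {x} → x ∈ᵤ V → value g x ≈ t * value (constantly 1#) x
      multiple = proportional {g} {constantly 1#} facet
        (λ {x} _ → ≤-respʳ-≈ (≈-sym (value-constantly 1# x)) 0≤1)
        (λ all → 0≉1 (≈-trans (≈-sym (proj₂ (all (vertex basis)))) (value-constantly 1# (indicator F G T))))
        (λ { ((T , sf , refl) , z) → ⊥-elim (none (T , spanningForest⇒basis sf , z)) })

    open TightSets G OnFace

    module _ {T₀} (face₀ : OnFace T₀) where

      -- By tightness the deficit of `A` vanishes on the face, by looseness not everywhere, so `g`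
      -- is a multiple of it. Deficits from `0` to `k′` give at most `suc k′` values.
      few-values : ∀ {A} → Tight A → Loose A → ¬ (∀ {T} → Basis T → ∣ T₀ ∩ A ∣ ≤ ∣ T ∩ A ∣ + k′)
      few-values {A} tight (T , e , bT , e∈A , ¬s) bound =
        many ((λ i → t * ι (toℕ i)) , λ { (T , sf , refl) → at (spanningForest⇒basis sf) })
        where
        l : AffineFunction F size
        l = deficit ∣ T₀ ∩ A ∣ A
        proper : ¬ (V ⊆ᵤ Face F V l)
        proper all = let d , eq = ℕ.m≤n⇒∃[o]m+o≡n (trace-size-< bT (tight face₀) e∈A ¬s) in
          ι-suc≉0 d (≈-trans (≈-sym (val-deficit {A = A} {T} {suc d} (trans (ℕ.+-suc ∣ T ∩ A ∣ d) eq)))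
              (proj₂ (all (vertex bT))))
        zero-on-face : ∀ {T} → OnFace T → val l T ≈ 0#
        zero-on-face {T} face = val-deficit {A = A} {T} (trans (ℕ.+-identityʳ _)
          (ℕ.≤-antisym (trace-size-≤ (proj₁ face) (tight face₀)) (trace-size-≤ (proj₁ face₀) (tight face))))
        multiple : ∃ λ t → ∀ {x} → x ∈ᵤ V → value g x ≈ t * value l x
        multiple = proportional {g} {l} facet (deficit-nonNeg (tight face₀)) proper
          (λ { ((T , sf , refl) , z) → (T , sf , refl) , zero-on-face (spanningForest⇒basis sf , z) })
        t : Carrier
        t = proj₁ multiple
        at : ∀ {T} → Basis T → ∃ λ (i : Fin (suc k′)) → val g T ≈ t * ι (toℕ i)
        at {T} b = fromℕ< d< , ≈-trans (proj₂ multiple (vertex b)) (*-congˡ (val-deficit {A = A} {T}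
            (trans (cong (∣ T ∩ A ∣ +_) (toℕ-fromℕ< d<)) (ℕ.m+[n∸m]≡n (trace-size-≤ b (tight face₀))))))
          where
          d< : ∣ T₀ ∩ A ∣ ∸ ∣ T ∩ A ∣ < suc k′
          d< = s≤s (ℕ.m≤n+o⇒m∸n≤o ∣ T₀ ∩ A ∣ ∣ T ∩ A ∣ (bound b))

      record UnevenSwap : Set (ℓ₁ ⊔ ℓ₂) where
        field
          {T}       : Subset size
          {hi lo}   : Edge
          basis     : Basis T
          hi∈       : hi ∈ T
          unspanned : ¬ Spans (del T hi) lo
          lo≤hi     : coefficient g lo ⊑ coefficient g hi
          lo≉hi     : ¬ coefficient g lo ≈ coefficient g hi

      uneven-swap : UnevenSwap
      uneven-swap = orient (unequal-swap g (proj₁ face₀) (proj₁ (proj₂ off))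
          (λ eq → proj₂ (proj₂ off) (≈-trans (≈-sym eq) (proj₂ face₀))))
        where
        off : ∃ λ T → Basis T × ¬ val g T ≈ 0#
        off with Any.any? (λ T → ¬? (val g T ≈? 0#)) bases
        ... | yes some = let T , m , ≉ = find some in T , ∈-bases⁻ m , ≉
        ... | no none  = ⊥-elim (proj₁ (proj₂ facet) λ { (T , sf , refl) → (T , sf , refl) ,
            zero-at (spanningForest⇒basis sf) })
          where
          zero-at : ∀ {T} → Basis T → val g T ≈ 0#
          zero-at {T} b with val g T ≈? 0#
          ... | yes z = z
          ... | no ≉  = contradiction (lose (∈-bases⁺ b) ≉) none
        orient : (∃ λ T → ∃₂ λ f e → Basis T × f ∈ T × Basis (swap T f e) × ¬ Spans (del T f) e ×
            ¬ coefficient g f ≈ coefficient g e) → UnevenSwap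
        orient (T , f , e , bT , f∈T , b , ¬s , ≉) with total (coefficient g f) (coefficient g e)
        ... | inj₂ e≤f = record { basis = bT ; hi∈ = f∈T ; unspanned = ¬s ; lo≤hi = e≤f ; lo≉hi = ≉ ∘ ≈-sym }
        ... | inj₁ f≤e = record { basis = b ; hi∈ = ∈-add _ _ ; unspanned = proj₁ bT f∈T ∘ link-mono back-to ;
            lo≤hi = f≤e ; lo≉hi = ≉ }
          where
          back-to : del (swap T f e) e ⊆ del T f
          back-to m with ∈-add⁻ (proj₁ (∈-del⁻ m))
          ... | inj₁ m′ = m′
          ... | inj₂ eq = contradiction eq (proj₂ (∈-del⁻ m))

      module _ (uneven : UnevenSwap) where
        open UnevenSwap uneven

        private
          light? : Decidable (λ x → coefficient g x ⊑ coefficient g lo)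
          light? x = coefficient g x ≤? coefficient g lo

        -- Greedy: a base of minimal weight contains as many light edges as possible.
        light : Subset size
        light = select light?

        -- Since `hi` is not light, the light part of `T` lies in `del T hi`, which does not span
        -- the light edge `lo`.
        light-loose : Loose light
        light-loose = T , lo , basis , ∈-select⁺ light? ≤-refl , unspanned ∘ link-mono λ {x} m →
          ∈-del⁺ (proj₁ (x∈p∩q⁻ T light m)) λ { refl → lo≉hi (antisym lo≤hi
              (∈-select⁻ light? (proj₂ (x∈p∩q⁻ T light m)))) }

        -- Were a light `x` unspanned, an edge `f` of `T` that is not light could be exchanged for
        -- it. The value starts at zero and must stay nonnegative, so `f` weighs no more than `x`
        -- and is light after all.
        light-tight : Tight light
        light-tight {T} (bT , zT) {x} x∈ with spans? (T ∩ light) x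
        ... | yes s = s
        ... | no ¬s with peel {X = T ∩ light} {T} (proj₁ ∘ x∈p∩q⁻ T light) (proj₂ bT x) ¬s
        ...   | f , f∈T , f∉ , h with basis-swap bT f∈T (λ { refl → f∉ (x∈p∩q⁺ (f∈T , x∈)) })
            (h {swap T f x} ∈-add⁺ (span (∈-add _ x)))
        ...     | x∉T , b′ = contradiction (x∈p∩q⁺ (f∈T , ∈-select⁺ light? (≤-trans lighter (∈-select⁻ light? x∈)))) f∉
          where
          lighter : coefficient g f ⊑ coefficient g x
          lighter = ≤-respˡ-≈ (+-identityˡ _) (≤-respʳ-≈ (≈-trans (val-swap g f∈T x∉T)
              (≈-trans (+-congʳ zT) (+-identityˡ _)))
            (+-monoˡ-≤ (coefficient g f) (proj₁ facet (vertex b′))))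

      module _ (1≤k′ : 1 ≤ k′) where

        -- Otherwise the facet has the form x_e = 0: the set of edges other than `e` is tight, loose
        -- through a base containing `e`, and has deficit at most one, hence at most `k′`.
        in-face : ∀ e → ¬ ¬ (∃ λ T → OnFace T × e ∈ T)
        in-face e none = few-values {A} tight loose bound
          where
          A : Subset size
          A = del ⊤ e
          in-A : ∀ {T} → OnFace T → T ⊆ A
          in-A {T} face m = ∈-del⁺ ∈⊤ λ { refl → none (T , face , m) }
          tight : Tight A
          tight face _ = link-mono (λ m → x∈p∩q⁺ (m , in-A face m)) (proj₂ (proj₁ face) _)
          singleton : Forest (add Subset.⊥ e)
          singleton = forest-add (λ m → contradiction m ∉⊥)
            λ s → noLoops e (link-closed {P = end₁ e ≡_} (λ m → contradiction m ∉⊥) s refl)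
          full : ∃ λ B → Forest B × add Subset.⊥ e ⊆ B × B ⊆ ⊤ × (∀ {e} → e ∈ ⊤ → Spans B e)
          full = extend singleton (λ _ → ∈⊤)
          T : Subset size
          T = proj₁ full
          bT : Basis T
          bT = proj₁ (proj₂ full) , λ e → proj₂ (proj₂ (proj₂ (proj₂ full))) ∈⊤
          e∈T : e ∈ T
          e∈T = proj₁ (proj₂ (proj₂ full)) (∈-add _ e)
          loose : Loose A
          loose with any? (λ x → (x ∈? T₀) ×-dec ¬? (spans? (T ∩ A) x))
          ... | yes (x , x∈ , ¬s) = T , x , bT , in-A face₀ x∈ , ¬s
          ... | no none′ = contradiction
            (link-mono (λ m → ∈-del⁺ (proj₁ (x∈p∩q⁻ T A m)) (proj₂ (∈-del⁻ (proj₂ (x∈p∩q⁻ T A m)))))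
                (link-map sp (proj₂ (proj₁ face₀) e)))
            (proj₁ bT e∈T)
            where
            sp : ∀ {x} → x ∈ T₀ → Spans (T ∩ A) x
            sp {x} m with spans? (T ∩ A) x
            ... | yes s = s
            ... | no ¬s = contradiction (x , m , ¬s) none′
          bound : ∀ {T} → Basis T → ∣ T₀ ∩ A ∣ ≤ ∣ T ∩ A ∣ + k′
          bound {T} b = ℕ.≤-trans (∣p∩q∣≤∣p∣ T₀ A) (ℕ.≤-trans (forest-size (proj₁ (proj₁ face₀)) (λ _ → proj₂ b _))
            (ℕ.≤-trans (p⊆q⇒∣p∣≤∣q∣ T⊆) (ℕ.≤-trans (ℕ.≤-reflexive (trans (∣add∣ e∉) (sym (ℕ.+-comm _ 1))))
                (ℕ.+-monoʳ-≤ ∣ T ∩ A ∣ 1≤k′))))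
            where
            e∉ : e ∉ T ∩ A
            e∉ m = proj₂ (∈-del⁻ (proj₂ (x∈p∩q⁻ T A m))) refl
            T⊆ : T ⊆ add (T ∩ A) e
            T⊆ {x} m with x ≟ e
            ... | yes refl = ∈-add _ x
            ... | no x≢e     = ∈-add⁺ (x∈p∩q⁺ (m , ∈-del⁺ ∈⊤ x≢e))

        -- If `e` were missing from `A`, a base on the face through `e` would span `e` by its part
        -- in `A`, which omits `e`.
        tight-flat : ∀ {A} → Tight A → ∀ {e} → Spans A e → e ∈ A
        tight-flat {A} tight {e} s with e ∈? A
        ... | yes m = m
        ... | no ∉A = ⊥-elim (in-face e λ (T , face , e∈T) → proj₁ (proj₁ face) e∈T
          (link-mono (λ m → ∈-del⁺ (proj₁ (x∈p∩q⁻ T A m)) λ { refl → ∉A (proj₂ (x∈p∩q⁻ T A m)) })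
              (link-map (tight face) s)))

  cone-pattern : ∀ {g k′} → FacetDefining F V g → ¬ AtMostValues F V (suc k′) g → ¬ ¬ ConePattern (suc k′)
  cone-pattern {g} {k′} facet many none = face-nonempty facet many λ (T₀ , face₀) →
      conclude k′ many none face₀ (uneven-swap facet many face₀)
    where
    conclude : ∀ k′ (many : ¬ AtMostValues F V (suc k′) g) (none : ¬ ConePattern (suc k′)) {T₀}
        (face₀ : OnFace facet many T₀) →
               UnevenSwap facet many face₀ → ⊥
    -- `hi` lies on a cycle: in `T` it is indispensable for linking the ends of `lo`, and `lo`, a
    -- different edge, links them directly.
    conclude zero many none face₀ uneven = bypassed-edge hi
      (exchange {Z = del ⊤ hi} (λ m → ∈-del⁺ ∈⊤ (proj₂ (∈-del⁻ m))) (span (∈-del⁺ ∈⊤ λ { refl → lo≉hi ≈-refl }))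
          unspanned (proj₂ basis lo))
      none
      where open UnevenSwap uneven
    conclude (suc k″) many none face₀ uneven = minimal-tight
      (light-tight facet many face₀ uneven) (light-loose facet many face₀ uneven)
      λ (B , tight , loose , irreducible) → none
        (tight-pattern proj₁ face₀ (tight-flat facet many face₀ (s≤s z≤n)) (few-values facet many face₀) tight
            loose irreducible)
      where open TightSets G (OnFace facet many)

subset-of-size : ∀ {n} (p : Subset n) k → k ≤ ∣ p ∣ → ∃ λ q → q ⊆ p × ∣ q ∣ ≡ k
subset-of-size {n} p zero _ = Subset.⊥ , (λ m → contradiction m ∉⊥) , ∣⊥∣≡0 n
subset-of-size (inside ∷ p) (suc k) (s≤s k≤) with subset-of-size p k k≤
... | q , q⊆p , eq = inside ∷ q , in⊆in q⊆p , cong suc eq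
subset-of-size (outside ∷ p) (suc k) k≤ with subset-of-size p (suc k) k≤
... | q , q⊆p , eq = outside ∷ q , out⊆ q⊆p , eq

-- Contracting a biconnected graph

module Merging (G : Graph) where
  open GraphicMatroid G
  open Walks G
  open Patterns G

  link-exit : ∀ {B u v ℓ} {P : Vertex → Set ℓ} → Decidable P → Link B u v → P u → ¬ P v →
              ∃ λ e → ∃₂ λ x y → e ∈ B × Joins e x y × P x × ¬ P y
  link-exit {B} {P = P} P? l pu ¬pv
    with any? (λ e → (e ∈? B) ×-dec (P? (end₁ e) ×-dec ¬? (P? (end₂ e))))
       | any? (λ e → (e ∈? B) ×-dec (P? (end₂ e) ×-dec ¬? (P? (end₁ e))))
  ... | yes (e , m , p , ¬q) | _ = e , _ , _ , m , inj₁ (refl , refl) , p , ¬q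
  ... | no _ | yes (e , m , p , ¬q) = e , _ , _ , m , inj₂ (refl , refl) , p , ¬q
  ... | no none₁ | no none₂ = contradiction (link-closed {P = P}
      (λ {e} m → (λ p → stay (P? (end₂ e)) λ ¬q → none₁ (e , m , p , ¬q))
                                                                           , (λ p → stay (P? (end₁ e)) λ ¬q → none₂ (e , m , p , ¬q))) l pu) ¬pv
    where
    stay : ∀ {ℓ} {Q : Set ℓ} → Dec Q → ¬ ¬ Q → Q
    stay (yes q) _ = q
    stay (no ¬q) f = contradiction ¬q f

  linked-⊆ : ∀ {X Y} → X ⊆ Y → Y ⊆ X → Linked X → Linked Y
  linked-⊆ X⊆Y Y⊆X linked u∈ v∈ = link-mono (λ m → within (X⊆Y (proj₁ (within⁻ m))) (X⊆Y (proj₂ (within⁻ m))))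
      (linked (Y⊆X u∈) (Y⊆X v∈))

  linkIn-mono : ∀ {X Y} → X ⊆ Y → ∀ {u v} → LinkIn X u v → LinkIn Y u v
  linkIn-mono X⊆Y = link-mono λ m → within (X⊆Y (proj₁ (within⁻ m))) (X⊆Y (proj₂ (within⁻ m)))

  joins-in : ∀ {X e x y} → e ∈ induced X ⊤ → Joins e x y → x ∈ X × y ∈ X
  joins-in m (inj₁ (refl , refl)) = within⁻ m
  joins-in m (inj₂ (refl , refl)) = proj₂ (within⁻ m) , proj₁ (within⁻ m)

  linked-from : ∀ {X c} → (∀ {x} → x ∈ X → LinkIn X c x) → Linked X
  linked-from f u∈ v∈ = back (f u∈) ∙ f v∈

  -- The parts of W are the fibres of c. Contracting them leaves a biconnected graph on the set R
  -- of representatives.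
  module _ (W : Subset order) where

    part? : (c : Vertex → Vertex) → ∀ r → Decidable (λ x → x ∈ W × c x ≡ r)
    part? c r x = (x ∈? W) ×-dec (c x ≟ r)

    rest? : (c : Vertex → Vertex) → ∀ r → Decidable (λ x → x ∈ W × c x ≢ r)
    rest? c r x = (x ∈? W) ×-dec ¬? (c x ≟ r)

    rest₂? : (c : Vertex → Vertex) → ∀ p q → Decidable (λ x → x ∈ W × c x ≢ p × c x ≢ q)
    rest₂? c p q x = (x ∈? W) ×-dec ¬? (c x ≟ p) ×-dec ¬? (c x ≟ q)

    part rest : (Vertex → Vertex) → Vertex → Subset order
    part c r = select (part? c r)
    rest c r = select (rest? c r)

    rest₂ : (Vertex → Vertex) → Vertex → Vertex → Subset order
    rest₂ c p q = select (rest₂? c p q)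

    record Partition (R : Subset order) (c : Vertex → Vertex) : Set where
      field
        R⊆W         : R ⊆ W
        represented : ∀ {x} → x ∈ W → c x ∈ R
        fixes       : ∀ {r} → r ∈ R → c r ≡ r
        part-linked : ∀ {r} → r ∈ R → Linked (part c r)
        rest-linked : ∀ {r} → r ∈ R → Linked (rest c r)

    module _ {R c} (π : Partition R c) {p} (p∈R : p ∈ R) where
      open Partition π

      private
        Z : Subset order
        Z = rest c p

      -- The edge connects the union of the two parts; `linked` says that they do not form a
      -- separating pair of the quotient, so the merged part is no cut vertex.
      record Mergeable : Set where
        field
          {q x y} : Vertex
          {e}     : Edge
          q∈R     : q ∈ R
          q≢p     : q ≢ p
          x∈      : x ∈ part c q
          y∈      : y ∈ part c p
          joins   : Joins e x y
          linked  : Linked (rest₂ c p q)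

      -- The parts of `p` and `q₀` cut `K` off, and the rest of `Z` hangs together with `q₀`. This
      -- is the extremal configuration: as long as no mergeable part appears, `K` can be shrunk.
      record Remote (q₀ : Vertex) (K : Subset order) : Set where
        field
          q₀∈R     : q₀ ∈ R
          q₀≢p     : q₀ ≢ p
          K⊆       : K ⊆ rest₂ c p q₀
          nonempty : Nonempty K
          closed   : ∀ {e x y} → Joins e x y → x ∈ K → y ∈ W → y ∈ K ⊎ c y ≡ q₀ ⊎ c y ≡ p
          others   : ∀ {z} → z ∈ Z → z ∉ K → LinkIn (select (λ x → (x ∈? Z) ×-dec ¬? (x ∈? K))) q₀ z

      others? : ∀ K → Decidable (λ x → x ∈ Z × x ∉ K)
      others? K x = (x ∈? Z) ×-dec ¬? (x ∈? K)

      module _ {q₀ K} (remote : Remote q₀ K) where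
        open Remote remote

        private
          k₀ : Vertex
          k₀ = proj₁ nonempty

          K-facts : ∀ {x} → x ∈ K → x ∈ W × c x ≢ p × c x ≢ q₀
          K-facts m = ∈-select⁻ (rest₂? c p q₀) (K⊆ m)

          q₀∈W : q₀ ∈ W
          q₀∈W = R⊆W q₀∈R

          -- Without the part of `q₀`, what is left of `W` is still connected, so `K` has an exit
          -- there; it can only lead to the part of `p`.
          gate : ∃ λ e → ∃₂ λ x y → Joins e x y × x ∈ K × y ∈ W × c y ≡ p
          gate with link-exit (_∈? K) (rest-linked q₀∈R {k₀} {p}
                (∈-select⁺ (rest? c q₀) (proj₁ (K-facts (proj₂ nonempty)) , proj₂ (proj₂ (K-facts (proj₂ nonempty)))))
                (∈-select⁺ (rest? c q₀) (R⊆W p∈R , λ eq → q₀≢p (trans (sym eq) (fixes p∈R)))))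
                (proj₂ nonempty) (λ m → proj₁ (proj₂ (K-facts m)) (fixes p∈R))
          ... | e , x , y , m , j , x∈ , y∉ with ∈-select⁻ (rest? c q₀) (proj₂ (joins-in m j))
          ...   | y∈W , ≢q₀ = e , x , y , j , x∈ , y∈W ,
            [ (λ y∈ → contradiction y∈ y∉) , [ (λ eq → contradiction eq ≢q₀) , id ]′ ]′ (closed j x∈ y∈W)

          x : Vertex
          x = proj₁ (proj₂ gate)

          x∈K : x ∈ K
          x∈K = proj₁ (proj₂ (proj₂ (proj₂ (proj₂ gate))))

          q : Vertex
          q = c x

          q∈R′ : q ∈ R
          q∈R′ = represented (proj₁ (K-facts x∈K))

          q≢p′ : q ≢ p
          q≢p′ = proj₁ (proj₂ (K-facts x∈K))

          q≢q₀ : q ≢ q₀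
          q≢q₀ = proj₂ (proj₂ (K-facts x∈K))

          x∈part : x ∈ part c q
          x∈part = ∈-select⁺ (part? c q) (proj₁ (K-facts x∈K) , refl)

          Q⊆K : part c q ⊆ K
          Q⊆K z∈ = link-closed {P = _∈ K} (λ m → stay m (inj₁ (refl , refl)) , stay m (inj₂ (refl , refl)))
              (part-linked q∈R′ x∈part z∈) x∈K
            where
            stay : ∀ {e u v} → e ∈ induced (part c q) ⊤ → Joins e u v → u ∈ K → v ∈ K
            stay m j u∈ with ∈-select⁻ (part? c q) (proj₂ (joins-in m j))
            ... | v∈W , cv = [ id , [ (λ eq → contradiction (trans (sym cv) eq) q≢q₀) ,
                (λ eq → contradiction (trans (sym cv) eq) q≢p′) ]′ ]′ (closed j u∈ v∈W)

          R₂ : Subset order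
          R₂ = rest₂ c p q

          q₀∈R₂ : q₀ ∈ R₂
          q₀∈R₂ = ∈-select⁺ (rest₂? c p q) (q₀∈W , (λ eq → q₀≢p (trans (sym (fixes q₀∈R)) eq)) , λ eq →
              q≢q₀ (trans (sym eq) (fixes q₀∈R)))

          far? : Decidable (λ z → z ∈ R₂ × ¬ LinkIn R₂ q₀ z)
          far? z = (z ∈? R₂) ×-dec ¬? (link? (induced R₂ ⊤) q₀ z)

          K′ : Subset order
          K′ = select far?

          near : ∀ {z} → z ∈ R₂ → z ∉ K′ → LinkIn R₂ q₀ z
          near {z} z∈ z∉ with link? (induced R₂ ⊤) q₀ z
          ... | yes l = l
          ... | no ¬l = contradiction (∈-select⁺ far? (z∈ , ¬l)) z∉

          R₂⊆Z : R₂ ⊆ Z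
          R₂⊆Z m = let w , ≢p , _ = ∈-select⁻ (rest₂? c p q) m in ∈-select⁺ (rest? c p) (w , ≢p)

          -- Whatever in `Z` lies outside `K` reaches `q₀` outside `K`, hence without meeting the
          -- part of `q`.
          K′⊆K : K′ ⊆ K
          K′⊆K {z} z∈ with z ∈? K | ∈-select⁻ far? z∈
          ... | yes m | _ = m
          ... | no ∉K | z∈R₂ , ¬l = contradiction (linkIn-mono into (others (R₂⊆Z z∈R₂) ∉K)) ¬l
            where
            into : select (others? K) ⊆ R₂
            into m = let m′ , ∉ = ∈-select⁻ (others? K) m ; w , ≢p = ∈-select⁻ (rest? c p) m′ in
              ∈-select⁺ (rest₂? c p q) (w , ≢p , λ eq → ∉ (Q⊆K (∈-select⁺ (part? c q) (w , eq))))

          closed′ : ∀ {e u v} → Joins e u v → u ∈ K′ → v ∈ W → v ∈ K′ ⊎ c v ≡ q ⊎ c v ≡ p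
          closed′ {e} {u} {v} j u∈ v∈ with c v ≟ q | c v ≟ p
          ... | yes eq | _      = inj₂ (inj₁ eq)
          ... | no _   | yes eq = inj₂ (inj₂ eq)
          ... | no ≢q  | no ≢p  = inj₁ (∈-select⁺ far? (v∈R₂ , λ l →
              proj₂ u-far (l ∙ back (joins-within {e = e} j (proj₁ u-far) v∈R₂))))
            where
            u-far = ∈-select⁻ far? u∈
            v∈R₂ = ∈-select⁺ (rest₂? c p q) (v∈ , ≢p , ≢q)

          O : Subset order
          O = select (others? K′)

          near-in-O : ∀ {z} → LinkIn R₂ q₀ z → LinkIn O q₀ z
          near-in-O l = proj₂ (link-closed {P = λ u → LinkIn R₂ q₀ u × LinkIn O q₀ u}
            (λ m → along m (inj₁ (refl , refl)) , along m (inj₂ (refl , refl))) l (stop , stop))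
            where
            in-O : ∀ {u} → u ∈ R₂ → LinkIn R₂ q₀ u → u ∈ O
            in-O u∈ l = ∈-select⁺ (others? K′) (R₂⊆Z u∈ , λ m → proj₂ (∈-select⁻ far? m) l)
            along : ∀ {e u v} → e ∈ induced R₂ ⊤ → Joins e u v → LinkIn R₂ q₀ u × LinkIn O q₀ u →
                LinkIn R₂ q₀ v × LinkIn O q₀ v
            along {e} m j (l , lO) = l′ , lO ∙ joins-within {e = e} j (in-O (proj₁ (joins-in m j)) l)
                (in-O (proj₂ (joins-in m j)) l′)
              where l′ = l ∙ joins-link (span m) j

          Q⊆O : part c q ⊆ O
          Q⊆O m = let w , eq = ∈-select⁻ (part? c q) m in
            ∈-select⁺ (others? K′) (∈-select⁺ (rest? c p) (w , λ eq′ → q≢p′ (trans (sym eq) eq′)) ,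
              λ m′ → proj₂ (proj₂ (∈-select⁻ (rest₂? c p q) (proj₁ (∈-select⁻ far? m′)))) eq)

          -- The part of `q` together with `K′` has an exit in `Z`. It starts in the part of `q`,
          -- since edges from `K′` lead only to `K′`, to that part or to the part of `p`; and it
          -- ends at a vertex still linked to `q₀`.
          door : LinkIn O q₀ x
          door with link-exit (λ u → (u ∈? part c q) ⊎-dec (u ∈? K′))
                 (rest-linked p∈R {x} {q₀} (∈-select⁺ (rest? c p) (proj₁ (K-facts x∈K) , q≢p′)) (R₂⊆Z q₀∈R₂))
                 (inj₁ x∈part)
                 [ (λ m → q≢q₀ (trans (sym (proj₂ (∈-select⁻ (part? c q) m))) (fixes q₀∈R))) ,
                     (λ m → proj₂ (∈-select⁻ far? m) stop) ]′
          ... | e , u , v , m , j , from , ¬to = by from (joins-in m j)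
            where
            by : u ∈ part c q ⊎ u ∈ K′ → u ∈ Z × v ∈ Z → LinkIn O q₀ x
            by (inj₂ u∈K′) (_ , v∈Z) = let w , ≢p = ∈-select⁻ (rest? c p) v∈Z in
              [ (λ v∈ → contradiction (inj₂ v∈) ¬to) , [ (λ eq →
                  contradiction (inj₁ (∈-select⁺ (part? c q) (w , eq))) ¬to)
                                                       , (λ eq → contradiction eq ≢p) ]′ ]′ (closed′ j u∈K′ w)
            by (inj₁ u∈Q) (_ , v∈Z) = near-in-O (near v∈R₂ (¬to ∘ inj₂)) ∙ back (joins-within {e = e} j (Q⊆O u∈Q) v∈O) ∙
                linkIn-mono Q⊆O (part-linked q∈R′ u∈Q x∈part)
              where
              v∈R₂ : v ∈ R₂
              v∈R₂ = let w , ≢p = ∈-select⁻ (rest? c p) v∈Z in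
                ∈-select⁺ (rest₂? c p q) (w , ≢p , λ eq → ¬to (inj₁ (∈-select⁺ (part? c q) (w , eq))))
              v∈O : v ∈ O
              v∈O = ∈-select⁺ (others? K′) (v∈Z , ¬to ∘ inj₂)

          others′ : ∀ {z} → z ∈ Z → z ∉ K′ → LinkIn O q z
          others′ {z} z∈ z∉ = back (from-q₀ (proj₁ q-in) (proj₂ q-in)) ∙ from-q₀ z∈ z∉
            where
            from-q₀ : ∀ {z} → z ∈ Z → z ∉ K′ → LinkIn O q₀ z
            from-q₀ {z} z∈ z∉ with c z ≟ q | ∈-select⁻ (rest? c p) z∈
            ... | yes eq | w , _  = door ∙ linkIn-mono Q⊆O (part-linked q∈R′ x∈part (∈-select⁺ (part? c q) (w , eq)))
            ... | no ≢q  | w , ≢p = near-in-O (near (∈-select⁺ (rest₂? c p q) (w , ≢p , ≢q)) z∉)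
            q-in : q ∈ Z × q ∉ K′
            q-in = ∈-select⁻ (others? K′) (Q⊆O (∈-select⁺ (part? c q) (R⊆W q∈R′ , fixes q∈R′)))

        -- If removing the parts of `p` and `q` cuts nothing off from `q₀`, they can be merged.
        -- Otherwise `q` takes over from `q₀`, and the set cut off has lost `x`.
        remote-step : Mergeable ⊎ ∃₂ λ q K′ → Remote q K′ × ∣ K′ ∣ < ∣ K ∣
        remote-step with any? (_∈? K′)
        ... | no none = inj₁ (record
          { q∈R = q∈R′ ; q≢p = q≢p′ ; x∈ = x∈part
          ; y∈ = ∈-select⁺ (part? c p) (proj₂ (proj₂ (proj₂ (proj₂ (proj₂ gate)))))
          ; joins = proj₁ (proj₂ (proj₂ (proj₂ gate)))
          ; linked = linked-from λ z∈ → near z∈ λ m → none (_ , m) })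
        ... | yes nonempty′ = inj₂ (q , K′ , record
          { q₀∈R = q∈R′ ; q₀≢p = q≢p′ ; K⊆ = proj₁ ∘ ∈-select⁻ far? ; nonempty = nonempty′
          ; closed = λ {e} → closed′ {e} ; others = others′ } ,
          p⊂q⇒∣p∣<∣q∣ (K′⊆K , x , x∈K , λ m → proj₂ (proj₂ (∈-select⁻ (rest₂? c p q) (proj₁ (∈-select⁻ far? m)))) refl))

      remote-merge : ∀ {q₀ K} → Acc _<_ ∣ K ∣ → Remote q₀ K → Mergeable
      remote-merge (acc rec) remote with remote-step remote
      ... | inj₁ mergeable              = mergeable
      ... | inj₂ (q , K′ , remote′ , s) = remote-merge (rec s) remote′

      remote₀ : ∀ {q₀ q₁} → q₀ ∈ R → q₁ ∈ R → q₀ ≢ p → q₁ ≢ p → q₁ ≢ q₀ → Remote q₀ (rest₂ c p q₀)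
      remote₀ {q₀} {q₁} q₀∈R q₁∈R q₀≢p q₁≢p q₁≢q₀ = record
        { q₀∈R = q₀∈R ; q₀≢p = q₀≢p ; K⊆ = id
        ; nonempty = q₁ , ∈-select⁺ (rest₂? c p q₀) (R⊆W q₁∈R , (λ eq → q₁≢p (trans (sym (fixes q₁∈R)) eq)) ,
            λ eq → q₁≢q₀ (trans (sym (fixes q₁∈R)) eq))
        ; closed = λ _ _ → decide
        ; others = λ z∈ z∉ → linkIn-mono Q⊆O (part-linked q₀∈R (∈-select⁺ (part? c q₀) (R⊆W q₀∈R , fixes q₀∈R))
            (O⊆Q z∈ z∉))
        }
        where
        decide : ∀ {y} → y ∈ W → y ∈ rest₂ c p q₀ ⊎ c y ≡ q₀ ⊎ c y ≡ p
        decide {y} w with c y ≟ q₀ | c y ≟ p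
        ... | yes eq | _      = inj₂ (inj₁ eq)
        ... | no _   | yes eq = inj₂ (inj₂ eq)
        ... | no ≢q  | no ≢p  = inj₁ (∈-select⁺ (rest₂? c p q₀) (w , ≢p , ≢q))
        Q⊆O : part c q₀ ⊆ select (others? (rest₂ c p q₀))
        Q⊆O m = let w , eq = ∈-select⁻ (part? c q₀) m in
          ∈-select⁺ (others? (rest₂ c p q₀)) (∈-select⁺ (rest? c p) (w , λ eq′ → q₀≢p (trans (sym eq) eq′)) ,
            λ m′ → proj₂ (proj₂ (∈-select⁻ (rest₂? c p q₀) m′)) eq)
        O⊆Q : ∀ {z} → z ∈ Z → z ∉ rest₂ c p q₀ → z ∈ part c q₀
        O⊆Q {z} z∈ z∉ with ∈-select⁻ (rest? c p) z∈
        ... | w , ≢p = [ (λ m → contradiction m z∉) , [ (λ eq → ∈-select⁺ (part? c q₀) (w , eq)) ,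
            (λ eq → contradiction eq ≢p) ]′ ]′ (decide w)

      redirect : Vertex → Vertex → Vertex
      redirect q x with c x ≟ p
      ... | yes _ = q
      ... | no _  = c x

      redirect-p : ∀ {q x} → c x ≡ p → redirect q x ≡ q
      redirect-p {q} {x} eq with c x ≟ p
      ... | yes _  = refl
      ... | no neq = contradiction eq neq

      redirect-other : ∀ {q x} → c x ≢ p → redirect q x ≡ c x
      redirect-other {q} {x} neq with c x ≟ p
      ... | yes eq = contradiction eq neq
      ... | no _   = refl

      module _ (mergeable : Mergeable) where
        open Mergeable mergeable

        private
          c′ : Vertex → Vertex
          c′ = redirect q

          to-q : ∀ {z} → c z ≡ p ⊎ c z ≡ q → c′ z ≡ q
          to-q (inj₁ eq) = redirect-p eq
          to-q {z} (inj₂ eq) = trans (redirect-other (λ eq′ → q≢p (trans (sym eq) eq′))) eq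

          from-q : ∀ {z} → c′ z ≡ q → c z ≡ p ⊎ c z ≡ q
          from-q {z} eq with c z ≟ p
          ... | yes eq′ = inj₁ eq′
          ... | no _    = inj₂ eq

          to-r : ∀ {z r} → r ≢ p → c z ≡ r → c′ z ≡ r
          to-r r≢p eq = trans (redirect-other λ eq′ → r≢p (trans (sym eq) eq′)) eq

          from-r : ∀ {z r} → r ≢ q → c′ z ≡ r → c z ≡ r
          from-r {z} r≢q eq with c z ≟ p
          ... | yes _ = contradiction (sym eq) r≢q
          ... | no _  = eq

        merge : Partition (del R p) c′
        merge = record
          { R⊆W         = R⊆W ∘ proj₁ ∘ ∈-del⁻
          ; represented = represented′
          ; fixes       = λ m → to-r (proj₂ (∈-del⁻ m)) (fixes (proj₁ (∈-del⁻ m)))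
          ; part-linked = part-linked′
          ; rest-linked = rest-linked′
          }
          where
          represented′ : ∀ {z} → z ∈ W → c′ z ∈ del R p
          represented′ {z} w with c z ≟ p
          ... | yes _ = ∈-del⁺ q∈R q≢p
          ... | no ≢p = ∈-del⁺ (represented w) ≢p
          P⊆ : part c p ⊆ part c′ q
          P⊆ m = let w , eq = ∈-select⁻ (part? c p) m in ∈-select⁺ (part? c′ q) (w , to-q (inj₁ eq))
          Q⊆ : part c q ⊆ part c′ q
          Q⊆ m = let w , eq = ∈-select⁻ (part? c q) m in ∈-select⁺ (part? c′ q) (w , to-q (inj₂ eq))
          part-linked′ : ∀ {r} → r ∈ del R p → Linked (part c′ r)
          part-linked′ {r} r∈ with r ≟ q
          ... | yes refl = linked-from {c = x} λ m → from-x (∈-select⁻ (part? c′ q) m)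
            where
            from-x : ∀ {z} → z ∈ W × c′ z ≡ q → LinkIn (part c′ q) x z
            from-x (w , eq) with from-q eq
            ... | inj₂ eq′ = linkIn-mono Q⊆ (part-linked q∈R x∈ (∈-select⁺ (part? c q) (w , eq′)))
            ... | inj₁ eq′ = joins-within {e = e} joins (Q⊆ x∈) (P⊆ y∈) ∙
                linkIn-mono P⊆ (part-linked p∈R y∈ (∈-select⁺ (part? c p) (w , eq′)))
          ... | no r≢q = linked-⊆
            (λ m → let w , eq = ∈-select⁻ (part? c r) m in ∈-select⁺ (part? c′ r) (w , to-r (proj₂ (∈-del⁻ r∈)) eq))
            (λ m → let w , eq = ∈-select⁻ (part? c′ r) m in ∈-select⁺ (part? c r) (w , from-r r≢q eq))
            (part-linked (proj₁ (∈-del⁻ r∈)))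
          rest-linked′ : ∀ {r} → r ∈ del R p → Linked (rest c′ r)
          rest-linked′ {r} r∈ with r ≟ q
          ... | yes refl = linked-⊆
            (λ m → let w , ≢p , ≢q = ∈-select⁻ (rest₂? c p q) m in ∈-select⁺ (rest? c′ q) (w , [ ≢p , ≢q ]′ ∘ from-q))
            (λ m → let w , neq = ∈-select⁻ (rest? c′ q) m in ∈-select⁺ (rest₂? c p q) (w , neq ∘ to-q ∘ inj₁ , neq ∘ to-q ∘ inj₂))
            linked
          ... | no r≢q = linked-⊆
            (λ m → let w , neq = ∈-select⁻ (rest? c r) m in ∈-select⁺ (rest? c′ r) (w , neq ∘ from-r r≢q))
            (λ m → let w , neq = ∈-select⁻ (rest? c′ r) m in ∈-select⁺ (rest? c r) (w , neq ∘ to-r (proj₂ (∈-del⁻ r∈))))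
            (rest-linked (proj₁ (∈-del⁻ r∈)))

    discrete : Linked W → (∀ v → Linked (del W v)) → Partition W id
    discrete W-linked W-cut = record
      { R⊆W         = id
      ; represented = id
      ; fixes       = λ _ → refl
      ; part-linked = λ {r} _ u∈ v∈ → same (proj₂ (∈-select⁻ (part? id r) u∈)) (proj₂ (∈-select⁻ (part? id r) v∈))
      ; rest-linked = λ {r} _ → linked-⊆
          (λ m → ∈-select⁺ (rest? id r) (∈-del⁻ m)) (λ m → let w , neq = ∈-select⁻ (rest? id r) m in ∈-del⁺ w neq) (W-cut r)
      }
      where
      same : ∀ {B u v r} → u ≡ r → v ≡ r → Link B u v
      same refl refl = stop

    -- Each `p` outside `N` is dissolved into a neighbouring part. The search for that part starts
    -- from `n₀`, and `n₁` makes the initial remote set nonempty.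
    merge-down : ∀ {N n₀ n₁ R c} → n₀ ∈ N → n₁ ∈ N → n₁ ≢ n₀ → N ⊆ R → Partition R c → Acc _<_ ∣ R ∣ →
                 ∃ λ c → Partition N c
    merge-down {N} {n₀} {n₁} {R} {c} n₀∈ n₁∈ n₁≢n₀ N⊆R π (acc rec) with any? (λ p → (p ∈? R) ×-dec ¬? (p ∈? N))
    ... | yes (p , p∈R , p∉N) = merge-down n₀∈ n₁∈ n₁≢n₀ (λ m → ∈-del⁺ (N⊆R m) λ { refl → p∉N m })
      (merge π p∈R (remote-merge π p∈R (<-wellFounded _)
        (remote₀ π p∈R (N⊆R n₀∈) (N⊆R n₁∈) (λ { refl → p∉N n₀∈ }) (λ { refl → p∉N n₁∈ }) n₁≢n₀)))
      (rec (∣del∣< p∈R))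
    ... | no none = c , record
      { R⊆W         = R⊆W ∘ N⊆R
      ; represented = R⊆N ∘ represented
      ; fixes       = fixes ∘ N⊆R
      ; part-linked = λ m → part-linked (N⊆R m)
      ; rest-linked = λ m → rest-linked (N⊆R m)
      }
      where
      open Partition π
      R⊆N : R ⊆ N
      R⊆N {z} m with z ∈? N
      ... | yes m′ = m′
      ... | no ∉N  = contradiction (z , m , ∉N) none

enumerate : ∀ {n} (p : Subset n) {m} → ∣ p ∣ ≡ m → ∃ λ (f : Fin m → Fin n) →
            (∀ {i j} → f i ≡ f j → i ≡ j) × (∀ i → f i ∈ p) × (∀ {x} → x ∈ p → ∃ λ i → f i ≡ x)
enumerate [] refl = (λ ()) , (λ { {()} }) , (λ ()) , λ ()
enumerate (outside ∷ p) eq with enumerate p eq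
... | f , inj , f∈ , onto = suc ∘ f , inj ∘ suc-injective , there ∘ f∈ , λ { (there m) → let i , e = onto m in i , cong suc e }
enumerate {suc n} (inside ∷ p) {suc m} eq with enumerate p (ℕ.suc-injective eq)
... | f , inj , f∈ , onto = g , g-inj , g∈ , λ { here → zero , refl ; (there x∈) → let i , e = onto x∈ in suc i , cong suc e }
  where
  g : Fin (suc m) → Fin (suc n)
  g zero    = zero
  g (suc i) = suc (f i)
  g-inj : ∀ {i j} → g i ≡ g j → i ≡ j
  g-inj {zero}  {zero}  _ = refl
  g-inj {suc i} {suc j} e = cong suc (inj (suc-injective e))
  g∈ : ∀ i → g i ∈ (inside ∷ p)
  g∈ zero    = here
  g∈ (suc i) = there (f∈ i)

-- Spanning subgraphs of complete graphs

-- A quotient of `G` may have parallel edges; taking it as the set of those edges of a complete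
-- graph that `G` represents keeps it simple.
complete : ℕ → Graph
complete zero = record
  { order = 0 ; size = 0 ; end₁ = λ () ; end₂ = λ () ; noLoops = λ () ; noParallels = λ { {()} } }
complete (suc n) = cone (complete n)

complete-order : ∀ n → Graph.order (complete n) ≡ n
complete-order zero    = refl
complete-order (suc n) = cong suc (complete-order n)

complete-joins : ∀ n {u v} → u ≢ v → ∃ λ e → Graph.Joins (complete n) e u v
complete-joins (suc n) {zero}  {zero}  u≢v = contradiction refl u≢v
complete-joins (suc n) {zero}  {suc v} u≢v = size ↑ʳ v ,
  inj₁ (cong (coneEnd₁ (complete n)) (splitAt-↑ʳ size order v) , cong (coneEnd₂ (complete n)) (splitAt-↑ʳ size order v))
  where open Graph (complete n)
complete-joins (suc n) {suc u} {zero}  u≢v = size ↑ʳ u ,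
  inj₂ (cong (coneEnd₁ (complete n)) (splitAt-↑ʳ size order u) , cong (coneEnd₂ (complete n)) (splitAt-↑ʳ size order u))
  where open Graph (complete n)
complete-joins (suc n) {suc u} {suc v} u≢v with complete-joins n (u≢v ∘ cong suc)
... | e , j = e ↑ˡ order , lift j
  where
  open Graph (complete n)
  lift : Joins e u v → Graph.Joins (complete (suc n)) (e ↑ˡ order) (suc u) (suc v)
  lift (inj₁ (p , q)) = inj₁ ( trans (cong (coneEnd₁ (complete n)) (splitAt-↑ˡ size e order)) (cong suc p)
                             , trans (cong (coneEnd₂ (complete n)) (splitAt-↑ˡ size e order)) (cong suc q))
  lift (inj₂ (p , q)) = inj₂ ( trans (cong (coneEnd₁ (complete n)) (splitAt-↑ˡ size e order)) (cong suc p)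
                             , trans (cong (coneEnd₂ (complete n)) (splitAt-↑ˡ size e order)) (cong suc q))

module _ (K : Graph) where
  private module K = Graph K

  -- With edges selected by an injection, deleting one is composition with `punchIn`.
  restrict : ∀ {s} (φ : Fin s → K.Edge) → (∀ {e f} → φ e ≡ φ f → e ≡ f) → Graph
  restrict {s} φ injective = record
    { order       = K.order
    ; size        = s
    ; end₁        = K.end₁ ∘ φ
    ; end₂        = K.end₂ ∘ φ
    ; noLoops     = K.noLoops ∘ φ
    ; noParallels = λ p q → injective (K.noParallels p q)
    }

  module _ {s} (φ : Fin (suc s) → K.Edge) (injective : ∀ {e f} → φ e ≡ φ f → e ≡ f) (e : Fin (suc s)) where

    private
      H H-e : Graph
      H   = restrict φ injective
      H-e = restrict (φ ∘ punchIn e) (punchIn-injective e _ _ ∘ injective)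

      adjacent : ∀ {X u v} → Graph.Adjacent H X (⊤ - e) u v → Graph.Adjacent H-e X ⊤ u v
      adjacent {u = u} {v} (u∈ , v∈ , f , f∈ , j) = u∈ , v∈ , punchOut e≢f , ∈⊤ ,
        subst (λ x → K.Joins (φ x) u v) (sym (punchIn-punchOut e≢f)) j
        where
        e≢f : e ≢ f
        e≢f e≡f = proj₂ (∈-del⁻ (subst (f ∈_) (minus≡del ⊤ e) f∈)) (sym e≡f)

    biconnected-punch : Graph.Biconnected H (⊤ - e) → Graph.Biconnected H-e ⊤
    biconnected-punch ((ne , conn) , cut) =
      (ne , λ u∈ v∈ → Star.map adjacent (conn u∈ v∈)) , λ v → proj₁ (cut v) , λ u∈ w∈ →
          Star.map adjacent (proj₂ (cut v) u∈ w∈)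

  -- Edges are deleted as long as biconnectivity survives; `P` is carried along so that the
  -- remaining ones are still represented in `G`.
  minimal-subgraph : ∀ {P : K.Edge → Set} {s} (φ : Fin s → K.Edge) (injective : ∀ {e f} → φ e ≡ φ f → e ≡ f) →
    (∀ e → P (φ e)) → Graph.Biconnected (restrict φ injective) ⊤ →
    ¬ ¬ (∃ λ s′ → ∃₂ λ (φ′ : Fin s′ → K.Edge) (injective′ : ∀ {e f} → φ′ e ≡ φ′ f → e ≡ f) →
         (∀ e → P (φ′ e)) × Graph.MinimallyBiconnected (restrict φ′ injective′))
  minimal-subgraph {s = zero} φ injective all biconnected k = k (zero , φ , injective , all , biconnected , λ ())
  minimal-subgraph {P} {suc s} φ injective all biconnected k =
      ¬¬-excluded-middle {A = ∃ λ e → Graph.Biconnected (restrict φ injective) (⊤ - e)} λ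
    { (yes (e , b)) → minimal-subgraph {P} (φ ∘ punchIn e) (punchIn-injective e _ _ ∘ injective)
        (all ∘ punchIn e) (biconnected-punch φ injective e b) k
    ; (no none)     → k (suc s , φ , injective , all , biconnected , λ e b → none (e , b)) }

-- The cone minor carried by a cone pattern

two-vertices : ∀ {m k} → 1 ≤ k → m ≡ suc k → ∃₂ λ (i j : Fin m) → i ≢ j
two-vertices (s≤s _) refl = zero , suc zero , λ ()

module ConeFromPattern (G : Graph) {k} (1≤k : 1 ≤ k) (pattern₀ : Patterns.ConePattern G k) where
  open GraphicMatroid G hiding (swap)
  open Walks G
  open Patterns G
  open Merging G
  open ConePattern pattern₀

  linked⇒connected : ∀ {X} → Nonempty X → Linked X → Connected X ⊤
  linked⇒connected {X} ne linked = ne , λ u∈ v∈ → link⇒walk (∈-select⁻ (inside? X ⊤)) (linked u∈ v∈)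

  -- The number of parts is a variable because the order of the complete graph equals `suc k` only
  -- propositionally.
  module _ {m} (m≡ : m ≡ suc k) where

    private
      marks : ∃ λ N′ → N′ ⊆ N × ∣ N′ ∣ ≡ suc k
      marks = subset-of-size N (suc k) (ConePattern.size pattern₀)

      N′ : Subset order
      N′ = proj₁ marks

      N′⊆N : N′ ⊆ N
      N′⊆N = proj₁ (proj₂ marks)

      listing : ∃ λ (f : Fin m → Vertex) → (∀ {i j} → f i ≡ f j → i ≡ j) × (∀ i → f i ∈ N′) ×
          (∀ {x} → x ∈ N′ → ∃ λ i → f i ≡ x)
      listing = enumerate N′ (trans (proj₂ (proj₂ marks)) (sym m≡))

    rep : Fin m → Vertex
    rep = proj₁ listing

    rep-injective : ∀ {i j} → rep i ≡ rep j → i ≡ j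
    rep-injective = proj₁ (proj₂ listing)

    rep∈N′ : ∀ i → rep i ∈ N′
    rep∈N′ = proj₁ (proj₂ (proj₂ listing))

    i₀ i₁ : Fin m
    i₀ = proj₁ (two-vertices 1≤k m≡)
    i₁ = proj₁ (proj₂ (two-vertices 1≤k m≡))

    i₀≢i₁ : i₀ ≢ i₁
    i₀≢i₁ = proj₂ (proj₂ (two-vertices 1≤k m≡))

    abstract
      partition : ∃ λ c → Partition W N′ c
      partition = merge-down W (rep∈N′ i₀) (rep∈N′ i₁) (i₀≢i₁ ∘ sym ∘ rep-injective) (N⊆W ∘ N′⊆N)
          (discrete W W-linked W-cut) (<-wellFounded _)

    c : Vertex → Vertex
    c = proj₁ partition

    open Partition (proj₂ partition)

    index : Vertex → Fin m
    index x with any? (λ i → rep i ≟ c x)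
    ... | yes (i , _) = i
    -- A default for vertices outside `W`; on `W` the search succeeds, by `rep-index`.
    ... | no _        = i₀

    rep-index : ∀ {x} → x ∈ W → rep (index x) ≡ c x
    rep-index {x} x∈ with any? (λ i → rep i ≟ c x)
    ... | yes (i , eq) = eq
    ... | no none      = contradiction (proj₂ (proj₂ (proj₂ listing)) (represented x∈)) none

    Branch : Fin m → Subset order
    Branch i = part W c (rep i)

    rep∈N : ∀ i → rep i ∈ N
    rep∈N i = N′⊆N (rep∈N′ i)

    rep∈W : ∀ i → rep i ∈ W
    rep∈W i = N⊆W (rep∈N i)

    rep∈Branch : ∀ i → rep i ∈ Branch i
    rep∈Branch i = ∈-select⁺ (part? W c (rep i)) (rep∈W i , fixes (rep∈N′ i))

    ∈-Branch : ∀ {x} → x ∈ W → x ∈ Branch (index x)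
    ∈-Branch {x} x∈ = ∈-select⁺ (part? W c (rep (index x))) (x∈ , sym (rep-index x∈))

    index-rep : ∀ i → index (rep i) ≡ i
    index-rep i = rep-injective (trans (rep-index (rep∈W i)) (fixes (rep∈N′ i)))

    Branch-disjoint : ∀ {i j x} → x ∈ Branch i → x ∈ Branch j → i ≡ j
    Branch-disjoint {i} {j} p q = rep-injective (trans (sym (proj₂ (∈-select⁻ (part? W c (rep i)) p)))
        (proj₂ (∈-select⁻ (part? W c (rep j)) q)))

    Neighbours : Fin m → Fin m → Set
    Neighbours i j = ∃ λ f → (end₁ f ∈ Branch i × end₂ f ∈ Branch j) ⊎ (end₂ f ∈ Branch i × end₁ f ∈ Branch j)

    neighbours? : ∀ i j → Dec (Neighbours i j)
    neighbours? i j = any? λ f → ((end₁ f ∈? Branch i) ×-dec (end₂ f ∈? Branch j)) ⊎-dec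
        ((end₂ f ∈? Branch i) ×-dec (end₁ f ∈? Branch j))

    neighbours-sym : ∀ {i j} → Neighbours i j → Neighbours j i
    neighbours-sym (f , inj₁ (p , q)) = f , inj₂ (q , p)
    neighbours-sym (f , inj₂ (p , q)) = f , inj₁ (q , p)

  private
    K : Graph
    K = complete (suc k)
    module K = Graph K

    open module Quotient = GraphicMatroid K using () renaming (Link to LinkK)

    m≡ : K.order ≡ suc k
    m≡ = complete-order (suc k)

    Represented : K.Edge → Set
    Represented e = Neighbours m≡ (K.end₁ e) (K.end₂ e)

    represented? : Decidable Represented
    represented? e = neighbours? m≡ (K.end₁ e) (K.end₂ e)

    E : Subset K.size
    E = select represented?

    edges : ∃ λ (f : Fin ∣ E ∣ → K.Edge) → (∀ {i j} → f i ≡ f j → i ≡ j) × (∀ i → f i ∈ E) ×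
        (∀ {x} → x ∈ E → ∃ λ i → f i ≡ x)
    edges = enumerate E refl

    φ : Fin ∣ E ∣ → K.Edge
    φ = proj₁ edges

    H : Graph
    H = restrict K φ (proj₁ (proj₂ edges))
    module H = Graph H

    neighbour-walk : ∀ {X i j} → i ∈ X → j ∈ X → i ≢ j → Neighbours m≡ i j → H.Walk X ⊤ i j
    neighbour-walk {X} {i} {j} i∈ j∈ i≢j nb with complete-joins (suc k) i≢j
    ... | e , joins with proj₂ (proj₂ (proj₂ edges)) {e} (∈-select⁺ represented? (orient joins))
      where
      orient : K.Joins e i j → Represented e
      orient (inj₁ (p , q)) = subst₂ (Neighbours m≡) (sym p) (sym q) nb
      orient (inj₂ (p , q)) = subst₂ (Neighbours m≡) (sym p) (sym q) (neighbours-sym m≡ nb)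
    ...   | f , eq = (i∈ , j∈ , f , ∈⊤ , subst (λ x → K.Joins x i j) (sym eq) joins) ◅ ε

    -- Along a link in `Y`, an edge inside one part projects to a trivial walk, and an edge between
    -- two parts to the edge of `H` that it represents.
    quotient-walk : ∀ {Y X} → Linked Y → Y ⊆ W → (∀ {y} → y ∈ Y → index m≡ y ∈ X) →
                    ∀ {u v} → u ∈ Y → v ∈ Y → H.Walk X ⊤ (index m≡ u) (index m≡ v)
    quotient-walk {Y} {X} linked Y⊆W into {u} {v} u∈ v∈ =
      conn-fold {R = Chosen (induced Y ⊤)} {E = λ x y → H.Walk X ⊤ (index m≡ x) (index m≡ y)}
        (record { refl = ε ; sym = Walks.walk-sym H ; trans = Star._◅◅_ }) (λ { (chosen m) → along m }) (linked u∈ v∈)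
      where
      along : ∀ {e} → e ∈ induced Y ⊤ → H.Walk X ⊤ (index m≡ (end₁ e)) (index m≡ (end₂ e))
      along {e} m with within⁻ {Y} m | index m≡ (end₁ e) ≟ index m≡ (end₂ e)
      ... | p , q | yes eq = subst (H.Walk X ⊤ _) eq ε
      ... | p , q | no neq = neighbour-walk (into p) (into q) neq (e , inj₁ (∈-Branch m≡ (Y⊆W p) , ∈-Branch m≡ (Y⊆W q)))

    π = proj₂ (partition m≡)

    H-biconnected : H.Biconnected ⊤
    H-biconnected = ((i₀ m≡ , ∈⊤) , λ {i} {j} _ _ → subst₂ (H.Walk ⊤ ⊤) (index-rep m≡ i) (index-rep m≡ j)
        (quotient-walk W-linked id (λ _ → ∈⊤) (rep∈W m≡ i) (rep∈W m≡ j))) ,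
      λ v → subst (λ X → H.Connected X ⊤) (sym (minus≡del ⊤ v)) (nonempty v , λ {i} {j} i∈ j∈ →
          subst₂ (H.Walk (del ⊤ v) ⊤) (index-rep m≡ i) (index-rep m≡ j)
        (quotient-walk (Partition.rest-linked π (rep∈N′ m≡ v)) (proj₁ ∘ ∈-select⁻ (rest? W (c m≡) (rep m≡ v)))
            (away v) (in-rest v i∈) (in-rest v j∈)))
      where
      nonempty : ∀ v → Nonempty (del ⊤ v)
      nonempty v with i₀ m≡ ≟ v
      ... | yes refl = i₁ m≡ , ∈-del⁺ ∈⊤ (i₀≢i₁ m≡ ∘ sym)
      ... | no neq   = i₀ m≡ , ∈-del⁺ ∈⊤ neq
      away : ∀ v {y} → y ∈ rest W (c m≡) (rep m≡ v) → index m≡ y ∈ del ⊤ v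
      away v {y} y∈ with ∈-select⁻ (rest? W (c m≡) (rep m≡ v)) y∈
      ... | w , neq = ∈-del⁺ ∈⊤ λ eq → neq (trans (sym (rep-index m≡ w)) (cong (rep m≡) eq))
      in-rest : ∀ v {i} → i ∈ del ⊤ v → rep m≡ i ∈ rest W (c m≡) (rep m≡ v)
      in-rest v {i} i∈ = ∈-select⁺ (rest? W (c m≡) (rep m≡ v)) (rep∈W m≡ i ,
        λ eq → proj₂ (∈-del⁻ i∈) (rep-injective m≡ (trans (sym (Partition.fixes π (rep∈N′ m≡ i))) eq)))

    module _ {s} (ψ : Fin s → K.Edge) (injective : ∀ {e f} → ψ e ≡ ψ f → e ≡ f) (all : ∀ e → Represented (ψ e)) where

      branches : Fin (suc K.order) → Subset order
      branches zero    = U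
      branches (suc i) = Branch m≡ i

      spoke : ∀ i → ∃₂ λ u v → u ∈ U × v ∈ Branch m≡ i × ∃ λ f → Joins f u v
      spoke i with marked (rep∈N m≡ i)
      ... | e , u , u∈ , j = u , rep m≡ i , u∈ , rep∈Branch m≡ i , e , j

      rim : ∀ {i j} → Neighbours m≡ i j → ∃₂ λ u v → u ∈ Branch m≡ i × v ∈ Branch m≡ j × ∃ λ f → Joins f u v
      rim (f , inj₁ (p , q)) = _ , _ , p , q , f , inj₁ (refl , refl)
      rim (f , inj₂ (p , q)) = _ , _ , p , q , f , inj₂ (refl , refl)

      disjoint′ : ∀ {x y v} → v ∈ branches x → v ∈ branches y → x ≡ y
      disjoint′ {zero}  {zero}  p q = refl
      disjoint′ {zero}  {suc j} p q = contradiction (proj₁ (∈-select⁻ (part? W (c m≡) (rep m≡ j)) q)) (disjoint p)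
      disjoint′ {suc i} {zero}  p q = contradiction (proj₁ (∈-select⁻ (part? W (c m≡) (rep m≡ i)) p)) (disjoint q)
      disjoint′ {suc i} {suc j} p q = cong suc (Branch-disjoint m≡ p q)

      cone-edge : ∀ (e : Fin s ⊎ Fin K.order) → ∃₂ λ u v →
        u ∈ branches (coneEnd₁ (restrict K ψ injective) e) × v ∈ branches (coneEnd₂ (restrict K ψ injective) e)
            × ∃ λ f → Joins f u v
      cone-edge (inj₁ e) = rim (all e)
      cone-edge (inj₂ i) = spoke i

      cone-minor : cone (restrict K ψ injective) ≼ G
      cone-minor = record
        { branch    = branches
        ; connected = connected
        ; disjoint  = λ {x} {y} x≢y (v , m) → x≢y (disjoint′ (proj₁ (x∈p∩q⁻ (branches x) (branches y) m))
            (proj₂ (x∈p∩q⁻ (branches x) (branches y) m)))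
        ; edge      = λ e → cone-edge (splitAt s e)
        }
        where
        connected : ∀ x → Connected (branches x) ⊤
        connected zero    = linked⇒connected (proj₁ (spoke (i₀ m≡)) , proj₁ (proj₂ (proj₂ (spoke (i₀ m≡))))) U-linked
        connected (suc i) = linked⇒connected (rep m≡ i , rep∈Branch m≡ i) (Partition.part-linked π (rep∈N′ m≡ i))

  cone-exists : ¬ ¬ ∃ λ H → Graph.order H ≡ suc k × Graph.MinimallyBiconnected H × cone H ≼ G
  cone-exists none = minimal-subgraph K {Represented} φ (proj₁ (proj₂ edges))
      (λ e → ∈-select⁻ represented? (proj₁ (proj₂ (proj₂ edges)) e)) H-biconnected
    λ (s , ψ , injective , all , minimal) → none (restrict K ψ injective , m≡ , minimal , cone-minor ψ injective all)

theorem5p6 : ∀ {c ℓ₁ ℓ₂} (F : OrderedField c ℓ₁ ℓ₂) (k : ℕ) → 1 ≤ k → (G : Graph) →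
    IsLevelGraph F k G ⇔
    ((H : Graph) → Graph.order H ≡ suc k → Graph.MinimallyBiconnected H → ¬ (cone H ≼ G))
theorem5p6 F k@(suc k′) 1≤k G = mk⇔ excluded levels
  where
  open BaseConfiguration F G using (atMostValues?)
  excluded : IsLevelGraph F k G → (H : Graph) → Graph.order H ≡ suc k → Graph.MinimallyBiconnected H → ¬ (cone H ≼ G)
  excluded level H order≡ (biconnected , _) minor with two-vertices 1≤k order≡
  ... | _ , _ , root≢next = LevelsFromMinor.too-many-values F H G minor biconnected root≢next
      (ℕ.≤-reflexive (sym order≡)) level
  levels : ((H : Graph) → Graph.order H ≡ suc k → Graph.MinimallyBiconnected H → ¬ (cone H ≼ G)) → IsLevelGraph F k G
  levels none l facet = decidable-stable (atMostValues? k l) λ many →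
    PatternFromFacet.cone-pattern F G facet many λ pattern₀ →
    ConeFromPattern.cone-exists G 1≤k pattern₀ λ (H , order≡ , minimal , minor) → none H order≡ minimal minor
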